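{- Let $\omega_{\mathrm{bool}}$ be the exponent of Boolean matrix multiplication. For $n$-vertex $m$-edge graphs where $m=\Theta(n^{2})$, there is no fully dynamic sensitivity oracle for subgraph connectivity with preprocessing time $O(n^{\omega_{\mathrm{bool}}-\epsilon})$ and update and query time of the form $f(d)\cdot n^{o(1)}$ (for a function $f$), for any constant $\epsilon>0$.
   Context: Fully dynamic sensitivity oracle problem for subgraph connectivity. Preprocessing phase: given an integer $d_{\star}$ and an undirected graph $G=(V,E)$ with $n$ vertices and $m$ edges, whose vertex set is partitioned into activated vertices $V_{\mathrm{on}}$ and deactivated vertices $V_{\mathrm{off}}$ with $n_{\mathrm{off}}=|V_{\mathrm{off}}|$, build a data structure. Update phase: a single set $D\subseteq V$ with $|D|=d\le d_{\star}$ is received, representing the vertices whose states are switched; let $V_{\mathrm{new}}=(V_{\mathrm{on}}\setminus D)\cup(V_{\mathrm{off}}\cap D)$. Query phase: each query gives $u,v\in V_{\mathrm{new}}$ and must be answered by whether $u$ and $v$ are connected in $G[V_{\mathrm{new}}]$. Preprocessing time, update time and (per-)query time are the times taken in the three phases. When discussing lower bounds, $d=d_{\star}$ is assumed for each update. The exponent $\omega_{\mathrm{bool}}$ is the infimum of the reals $c$ such that the Boolean product of two $n\times n$ matrices can be computed in $O(n^{c})$ time. -}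

module Defs where

open import Data.Bool.Base using (Bool; true; false; if_then_else_; _∧_; _∨_; T)
open import Data.Fin.Base using (Fin; toℕ; remQuot)
open import Data.Fin.Properties using () renaming (_<?_ to _<ᶠ?_)
open import Data.Fin.Subset using (Subset; _∈_; ∁; _∩_; _∪_; _─_; ∣_∣)
open import Data.Fin.Subset.Properties using (_∈?_)
open import Data.Integer.Base using (+_; -[1+_])
open import Data.List.Base using (List; []; _∷_; allFin; filter; map; tabulate)
open import Data.Nat.Base
  using (ℕ; zero; suc; _+_; _*_; _∸_; _/_; _^_; _≤_; _<_; _≡ᵇ_; NonZero)
open import Data.Product.Base using (∃; ∃-syntax; ∃₂; _×_; _,_; uncurry)
open import Data.Rational.Base as ℚ using (ℚ; 0ℚ; ↥_; ↧ₙ_)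
import Data.Rational.Properties as ℚ
open import Data.Sum.Base using (_⊎_)
open import Data.Unit.Base using (⊤)
import Data.Vec.Base as Vec
import Data.Vec.Functional as Vector
open import Relation.Binary.Construct.Closure.ReflexiveTransitive using (Star)
open import Relation.Binary.Definitions using (tri<; tri≈; tri>)
open import Relation.Binary.PropositionalEquality
open import Relation.Nullary.Decidable using (does)
open import Relation.Nullary.Negation using (¬_; contradiction)

------------------------------------------------------------------------
-- Real numbers as Dedekind cuts: x is given by the set of rationals
-- strictly below it, a proper nonempty lower set with no greatest element.

record ℝ : Set₁ where
  field
    below     : ℚ → Set
    inhabited : ∃[ q ] below q
    proper    : ∃[ q ] ¬ below q
    lower     : ∀ {p q} → p ℚ.< q → below q → below p
    open-up   : ∀ {q} → below q → ∃[ r ] q ℚ.< r × below r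

open ℝ public

infix  4 _≤ʳ_
infixl 6 _-ʳ_

_≤ʳ_ : ℝ → ℝ → Set
x ≤ʳ y = ∀ {q} → below x q → below y q

Positive : ℝ → Set
Positive x = below x 0ℚ

IsInfimum : (ℝ → Set) → ℝ → Set₁
IsInfimum S x =
    (∀ c → S c → x ≤ʳ c)
  × (∀ y → (∀ c → S c → y ≤ʳ c) → y ≤ʳ x)

private
  add-sub : ∀ p q → p ≡ (p ℚ.+ q) ℚ.- q
  add-sub p q = sym (begin
    (p ℚ.+ q) ℚ.- q       ≡⟨ ℚ.+-assoc p q (ℚ.- q) ⟩
    p ℚ.+ (q ℚ.+ ℚ.- q)   ≡⟨ cong (p ℚ.+_) (ℚ.+-inverseʳ q) ⟩
    p ℚ.+ 0ℚ              ≡⟨ ℚ.+-identityʳ p ⟩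
    p                     ∎)
    where open ≡-Reasoning

  sub-add : ∀ p q → (p ℚ.- q) ℚ.+ q ≡ p
  sub-add p q = begin
    (p ℚ.- q) ℚ.+ q       ≡⟨ ℚ.+-assoc p (ℚ.- q) q ⟩
    p ℚ.+ (ℚ.- q ℚ.+ q)   ≡⟨ cong (p ℚ.+_) (ℚ.+-inverseˡ q) ⟩
    p ℚ.+ 0ℚ              ≡⟨ ℚ.+-identityʳ p ⟩
    p                     ∎
    where open ≡-Reasoning

  below⇒< : ∀ (x : ℝ) {p q} → below x p → ¬ below x q → p ℚ.< q
  below⇒< x {p} {q} p∈ q∉ with ℚ.<-cmp p q
  ... | tri< p<q _ _  = p<q
  ... | tri≈ _ refl _ = contradiction p∈ q∉
  ... | tri> _ _ q<p  = contradiction (lower x q<p p∈) q∉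

_-ʳ_ : ℝ → ℝ → ℝ
below (x -ʳ y) q = ∃₂ λ r s → below x r × ¬ below y s × q ≡ r ℚ.- s
inhabited (x -ʳ y) with inhabited x | proper y
... | r , r∈ | s , s∉ = r ℚ.- s , r , s , r∈ , s∉ , refl
proper (x -ʳ y) with proper x | inhabited y
... | r , r∉ | s , s∈ = r ℚ.- s , λ where
  (r′ , s′ , r′∈ , s′∉ , eq) →
    ℚ.<-irrefl (sym eq)
      (ℚ.+-mono-< (below⇒< x r′∈ r∉) (ℚ.neg-antimono-< (below⇒< y s∈ s′∉)))
lower (x -ʳ y) {p} p<q (r , s , r∈ , s∉ , refl) =
    p ℚ.+ s , s
  , lower x (subst (p ℚ.+ s ℚ.<_) (sub-add r s) (ℚ.+-monoˡ-< s p<q)) r∈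
  , s∉ , add-sub p s
open-up (x -ʳ y) (r , s , r∈ , s∉ , refl) with open-up x r∈
... | r′ , r<r′ , r′∈ =
  r′ ℚ.- s , ℚ.+-monoˡ-< (ℚ.- s) r<r′ , r′ , s , r′∈ , s∉ , refl

-- e(n) = o(1)
Vanishing : (ℕ → ℝ) → Set
Vanishing e = ∀ δ → 0ℚ ℚ.< δ → ∃[ N ] ∀ n → N ≤ n →
  below (e n) (ℚ.- δ) × ¬ below (e n) δ

infix 4 _≤_·_^ℚ_ _≤_·_^ℝ_

-- For n ≥ 1 and q = a / b, the inequality t ≤ C n^q raised to the power b,
-- with a negative power of n moved to the left.
_≤_·_^ℚ_ : ℕ → ℕ → ℕ → ℚ → Set
t ≤ C · n ^ℚ q with ↥ q
... | + a      = t ^ ↧ₙ q ≤ C ^ ↧ₙ q * n ^ a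
... | -[1+ a ] = t ^ ↧ₙ q * n ^ suc a ≤ C ^ ↧ₙ q

-- For n ≥ 1, n^x is the infimum of the n^q over the rationals q ≥ x.
_≤_·_^ℝ_ : ℕ → ℕ → ℕ → ℝ → Set
t ≤ C · n ^ℝ x = ∀ q → ¬ below x q → t ≤ C · n ^ℚ q

------------------------------------------------------------------------
-- The word RAM.
--
-- The memory consists of arrays 0, 1, 2, … of words; a program can only name
-- arrays by literals, so each program uses finitely many of them.  (The
-- finitely many arrays may equally be interleaved into one address space.)

Memory : Set
Memory = ℕ → ℕ → ℕ

_[_,_↦_] : Memory → ℕ → ℕ → ℕ → Memory
(σ [ x , i ↦ v ]) y j = if (y ≡ᵇ x) ∧ (j ≡ᵇ i) then v else σ y j

data Op : Set where
  add sub mul div : Op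

data Expr : Set where
  lit  : ℕ → Expr
  load : ℕ → Expr → Expr
  op   : Op → Expr → Expr → Expr

data Program : Set where
  skip    : Program
  store   : (x : ℕ) (index value : Expr) → Program
  _⨾_     : Program → Program → Program
  ifnz    : (guard : Expr) (then else : Program) → Program
  whilenz : (guard : Expr) (body : Program) → Program

⟦_⟧ᵒ : Op → ℕ → ℕ → ℕ
⟦ add ⟧ᵒ a b       = a + b
⟦ sub ⟧ᵒ a b       = a ∸ b
⟦ mul ⟧ᵒ a b       = a * b
⟦ div ⟧ᵒ a zero    = 0
⟦ div ⟧ᵒ a (suc b) = a / suc b

⟦_⟧ : Expr → Memory → ℕ
⟦ lit k ⟧    σ = k
⟦ load x a ⟧ σ = σ x (⟦ a ⟧ σ)
⟦ op o a b ⟧ σ = ⟦ o ⟧ᵒ (⟦ a ⟧ σ) (⟦ b ⟧ σ)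

-- ⟨ P , σ ⟩⇓[ W ] t , τ : started in σ, P halts in τ after t steps.
-- Every skip, store and guard test costs one step; the expressions of a
-- program have fixed size, so evaluating one takes O(1) word operations.
-- Words hold the numbers below W: a store whose index or value does not fit
-- has no transition, so a run that would overflow does not count as halting.
data ⟨_,_⟩⇓[_]_,_ : Program → Memory → ℕ → ℕ → Memory → Set where
  ⇓-skip : ∀ {σ W} → ⟨ skip , σ ⟩⇓[ W ] 1 , σ
  ⇓-store : ∀ {x a b σ W} → ⟦ a ⟧ σ < W → ⟦ b ⟧ σ < W →
    ⟨ store x a b , σ ⟩⇓[ W ] 1 , (σ [ x , ⟦ a ⟧ σ ↦ ⟦ b ⟧ σ ])
  ⇓-seq : ∀ {P Q σ σ′ σ″ W s t} →
    ⟨ P , σ ⟩⇓[ W ] s , σ′ → ⟨ Q , σ′ ⟩⇓[ W ] t , σ″ →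
    ⟨ P ⨾ Q , σ ⟩⇓[ W ] s + t , σ″
  ⇓-then : ∀ {g P Q σ σ′ W t} → ⟦ g ⟧ σ ≢ 0 →
    ⟨ P , σ ⟩⇓[ W ] t , σ′ → ⟨ ifnz g P Q , σ ⟩⇓[ W ] suc t , σ′
  ⇓-else : ∀ {g P Q σ σ′ W t} → ⟦ g ⟧ σ ≡ 0 →
    ⟨ Q , σ ⟩⇓[ W ] t , σ′ → ⟨ ifnz g P Q , σ ⟩⇓[ W ] suc t , σ′
  ⇓-done : ∀ {g P σ W} → ⟦ g ⟧ σ ≡ 0 →
    ⟨ whilenz g P , σ ⟩⇓[ W ] 1 , σ
  ⇓-loop : ∀ {g P σ σ′ σ″ W s t} → ⟦ g ⟧ σ ≢ 0 →
    ⟨ P , σ ⟩⇓[ W ] s , σ′ → ⟨ whilenz g P , σ′ ⟩⇓[ W ] t , σ″ →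
    ⟨ whilenz g P , σ ⟩⇓[ W ] suc (s + t) , σ″

-- Words of k · log₂ (n + 2) = O(log n) bits.
wordBound : ℕ → ℕ → ℕ
wordBound k n = (2 + n) ^ k

blank : Memory
blank _ _ = 0

writeFrom : ℕ → ℕ → List ℕ → Memory → Memory
writeFrom x i []       σ = σ
writeFrom x i (v ∷ vs) σ = writeFrom x (suc i) vs (σ [ x , i ↦ v ])

-- Overwrites only the first cells of array x, as many as the list is long.
write : ℕ → List ℕ → Memory → Memory
write x = writeFrom x 0

bit : Bool → ℕ
bit b = if b then 1 else 0

------------------------------------------------------------------------
-- Boolean matrix multiplication

Matrix : ℕ → Set
Matrix n = Fin n → Fin n → Bool

_⊗_ : ∀ {n} → Matrix n → Matrix n → Matrix n
(A ⊗ B) i j = Vector.foldr _∨_ false λ k → A i k ∧ B k j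

rowMajor : ∀ {n} → Matrix n → List ℕ
rowMajor {n} M = tabulate λ (p : Fin (n * n)) → bit (uncurry M (remQuot n p))

-- The factors are in arrays 1 and 2, the product is to be left in array 3.
matrixInput : ∀ {n} → Matrix n → Matrix n → Memory
matrixInput {n} A B =
  write 0 (n ∷ []) (write 1 (rowMajor A) (write 2 (rowMajor B) blank))

-- The product of two n × n Boolean matrices can be computed in O(n^c) time.
BMMComputable : ℝ → Set
BMMComputable c =
  ∃[ P ] ∃[ k ] ∃[ C ] ∀ n .{{_ : NonZero n}} (A B : Matrix n) →
  ∃₂ λ t σ →
      ⟨ P , matrixInput A B ⟩⇓[ wordBound k n ] t , σ
    × t ≤ C · n ^ℝ c
    × (∀ i j → σ 3 (toℕ i * n + toℕ j) ≡ bit ((A ⊗ B) i j))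

Isωbool : ℝ → Set₁
Isωbool = IsInfimum BMMComputable

------------------------------------------------------------------------
-- Graphs

record Graph (n : ℕ) : Set where
  field
    adj    : Matrix n
    symm   : ∀ u v → adj u v ≡ adj v u
    irrefl : ∀ v → adj v v ≡ false

open Graph public

edgeCount : ∀ {n} → Graph n → ℕ
edgeCount G = Vector.foldr _+_ 0 λ u → Vector.foldr _+_ 0 λ v →
  bit (does (u <ᶠ? v) ∧ adj G u v)

-- n² / c ≤ m ≤ c n²; a class of graphs has m = Θ(n²) when this holds with
-- one constant c for all its members.
Dense : ∀ {n} → ℕ → Graph n → Set
Dense {n} c G = n * n ≤ c * edgeCount G × edgeCount G ≤ c * (n * n)

InducedAdj : ∀ {n} → Graph n → Subset n → Fin n → Fin n → Set
InducedAdj G S u v = u ∈ S × v ∈ S × T (adj G u v)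

-- Used only for u, v ∈ S.
Connected : ∀ {n} → Graph n → Subset n → Fin n → Fin n → Set
Connected G S = Star (InducedAdj G S)

------------------------------------------------------------------------
-- Fully dynamic sensitivity oracles for subgraph connectivity

switch : ∀ {n} → Subset n → Subset n → Subset n
switch Von D = (Von ─ D) ∪ (∁ Von ∩ D)

graphInput : ∀ {n} → ℕ → Graph n → Subset n → Memory
graphInput {n} d⋆ G Von =
  write 0 (n ∷ d⋆ ∷ [])
    (write 1 (map bit (Vec.toList Von)) (write 2 (rowMajor (adj G)) blank))

updateInput : ∀ {n} → Subset n → Memory → Memory
updateInput {n} D =
  write 3 (∣ D ∣ ∷ map toℕ (filter (_∈? D) (allFin n)))

queryInput : ∀ {n} → Fin n → Fin n → Memory → Memory
queryInput u v = write 4 (toℕ u ∷ toℕ v ∷ [])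

-- From memory σ, the program Q answers the given queries one after the other
-- (each run starting from the memory left by the previous one, the answer
-- being left in array 5), and the time of each query satisfies B.
AnswersAll : ∀ {n} → Program → (W : ℕ) (B : ℕ → Set) →
  Graph n → Subset n → Memory → List (Fin n × Fin n) → Set
AnswersAll Q W B G S σ [] = ⊤
AnswersAll Q W B G S σ ((u , v) ∷ qs) = u ∈ S → v ∈ S →
  ∃₂ λ t τ →
      ⟨ Q , queryInput u v σ ⟩⇓[ W ] t , τ
    × B t
    × ((τ 5 0 ≡ 1 × Connected G S u v) ⊎ (τ 5 0 ≡ 0 × ¬ Connected G S u v))
    × AnswersAll Q W B G S τ qs

-- An oracle for the n-vertex graphs with n² / c ≤ m ≤ c n², with
-- preprocessing time O(n^x), for each fixed d⋆, and update and query times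
-- f(d) · n^o(1), where each update has size d = d⋆.
record Oracle (c : ℕ) (x : ℝ) : Set₁ where
  field
    preprocess update query : Program
    k : ℕ
    C : ℕ → ℕ
    f : ℕ → ℕ
    e-update e-query : ℕ → ℝ
    update-vanishing : Vanishing e-update
    query-vanishing : Vanishing e-query
    correct : ∀ n .{{_ : NonZero n}} d → d ≤ n →
      (G : Graph n) (Von : Subset n) → Dense c G →
      ∃₂ λ t σ →
          ⟨ preprocess , graphInput d G Von ⟩⇓[ wordBound k n ] t , σ
        × t ≤ C d · n ^ℝ x
        × (∀ (D : Subset n) → ∣ D ∣ ≡ d →
           ∃₂ λ t′ σ′ →
               ⟨ update , updateInput D σ ⟩⇓[ wordBound k n ] t′ , σ′
             × t′ ≤ f d · n ^ℝ e-update n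
             × (∀ qs → AnswersAll query (wordBound k n)
                         (λ s → s ≤ f d · n ^ℝ e-query n)
                         G (switch Von D) σ′ qs))

-- Write x = ω - ε and suppose that an oracle with preprocessing time O(n ^ x) exists.
--
-- If ω > 2, choose a rational u with max(2, x) ≤ u < ω and u > 2, and let A, B be N × N.
-- In the tripartite graph with an edge from row i to middle vertex k when A i k, and
-- from k to column j when B k j, let exactly the middle vertices be on.  Switching on
-- row i and column j makes these two connected iff (A ⊗ B) i j.  One preprocessing
-- followed by N² updates and queries, each of which takes N ^ o(1) steps and is undone
-- from a log of the overwritten words, multiplies A and B in time O(N ^ u), contradicting
-- u < ω.  Additional switched-off vertices make the graph dense, and large enough for
-- the o(1) to be at most u - 2.
--
-- If ω ≤ 2, the preprocessing takes time O(n ^ (2 - δ)), δ > 0.  Already for an empty update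
-- and one query the oracle then leaves unread some pair of cells of the adjacency matrix
-- of a graph with two components of linear size between which there are Ω(n²) non-edges;
-- turning that non-edge into an edge changes the answer, but not the run.

module Submission where

open import Defs
open import Data.Bool.Base using (Bool; true; false; if_then_else_; _∧_; _∨_; not; T)
open import Data.Bool.Properties using (∨-comm; ∨-identityʳ; T-≡; T-∧; T-∨)
open import Data.Empty using (⊥-elim)
open import Data.Fin.Base as Fin using (Fin; zero; suc; toℕ; combine; remQuot; fromℕ<; _↑ˡ_; _↑ʳ_)
open import Data.Fin.Properties using
  ( toℕ<n; toℕ-combine; toℕ-injective; combine-remQuot; remQuot-combine; combine-injective; toℕ-↑ˡ; toℕ-↑ʳ
  ; ↑ˡ-injective; ↑ʳ-injective; toℕ-fromℕ<; ¬∀⟶∃¬; all?; pigeonhole)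
  renaming (_≟_ to _≟ᶠ_; _<?_ to _<ᶠ?_; <⇒≢ to <ᶠ⇒≢)
open import Data.Fin.Subset using (Subset; _∈_; _∉_; ∁; _∩_; _∪_; _─_; ⁅_⁆; ⊤; ⊥; ∣_∣)
open import Data.Fin.Subset.Properties
open import Data.Integer.Base as ℤ using (-[1+_])
import Data.Integer.Properties as ℤ
open import Data.List.Base as List using (List; []; _∷_; _++_; length; tabulate; lookup; filter)
open import Data.List.Properties using (length-++; length-tabulate; filter-accept; filter-reject)
open import Data.List.Relation.Unary.All using (All; []; _∷_)
open import Data.List.Relation.Unary.All.Properties using (++⁻ˡ; ++⁻ʳ; tabulate⁺; ¬Any⇒All¬)
open import Data.List.Relation.Unary.Any as Any using (Any)
open import Data.List.Relation.Unary.Any.Properties using (lookup-index)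
open import Data.Nat.Base
open import Data.Nat.DivMod using (+-distrib-/-∣ˡ; m*n/n≡m; m<n⇒m/n≡0)
open import Data.Nat.Divisibility using (m∣m*n)
open import Data.Nat.Properties
open import Data.Nat.Solver using (module +-*-Solver)
open import Data.Nat.Tactic.RingSolver using (solve-∀)
open import Data.Product.Base
open import Data.Product.Properties using (≡-dec; ,-injectiveʳ)
open import Data.Rational.Base as ℚ using (ℚ; mkℚ; 0ℚ; 1ℚ)
import Data.Rational.Properties as ℚ
open import Data.Rational.Unnormalised.Base as ℚᵘ using (mkℚᵘ; *≤*; *<*; *≡*)
import Data.Rational.Unnormalised.Properties as ℚᵘ
open import Data.Sum.Base as Sum using (_⊎_; inj₁; inj₂)
import Data.Unit.Base as Unit
open import Data.Unit.Base using (tt)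
import Data.Vec.Base as Vec
import Data.Vec.Functional as Vector
open import Data.Vec.Properties using (lookup∘tabulate; lookup⇒[]=; []=⇒lookup)
open import Function.Base using (_∘_; case_of_; id)
open import Function.Bundles using (Equivalence)
open import Relation.Binary.Construct.Closure.ReflexiveTransitive using (Star; _◅_) renaming (ε to done)
open import Relation.Binary.Definitions using (tri<; tri≈; tri>)
open import Relation.Binary.PropositionalEquality
open import Relation.Nullary.Decidable using (Dec; yes; no; does; dec-true; _⊎-dec_)
open import Relation.Nullary.Negation using (¬_; contradiction)
open import Relation.Unary using (Decidable)

-- Powers and roots

-- Both cases are necessary: the N² entries of the product cost at least N² steps, so the reduction
-- cannot reach an exponent below 2, and ω > 2 is not known. Cuts are constructive, so it cannot be
-- decided whether ω ≤ 2, and no rational between x and ω can be produced outright. The two cases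
-- therefore yield `¬ ¬ below ω 2` and `¬ below ω 2`, which clash. The exponent u is sought among
-- the multiples of 1 / (b + 1), with b so large that one grid step is at most ε and that 2 plus one
-- step is still below ω; since the goal is a negation, it is enough that a last grid point below ω
-- cannot fail to exist. The log is needed because an oracle admits a single update, while copying
-- its memory for each entry would be too expensive; undoing costs only a constant factor over the
-- run. The number P of filler blocks is fixed before N, so that the thresholds hidden in o(1) are
-- passed for every N ≥ 1 and small matrices need no separate treatment.

^-distribʳ-* : ∀ k m n → (m * n) ^ k ≡ m ^ k * n ^ k
^-distribʳ-* zero    m n = refl
^-distribʳ-* (suc k) m n = begin
  m * n * (m * n) ^ k     ≡⟨ cong (m * n *_) (^-distribʳ-* k m n) ⟩
  m * n * (m ^ k * n ^ k) ≡⟨ lem m n (m ^ k) (n ^ k) ⟩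
  m * m ^ k * (n * n ^ k) ∎
  where
  open ≡-Reasoning
  lem : ∀ a b c d → a * b * (c * d) ≡ a * c * (b * d)
  lem = solve-∀

^-swap : ∀ m j k → (m ^ j) ^ k ≡ (m ^ k) ^ j
^-swap m j k = trans (^-*-assoc m j k) (trans (cong (m ^_) (*-comm j k)) (sym (^-*-assoc m k j)))

^-cancelˡ-≤ : ∀ k .{{_ : NonZero k}} {m n} → m ^ k ≤ n ^ k → m ≤ n
^-cancelˡ-≤ k m^k≤n^k = ≮⇒≥ λ n<m → <⇒≱ (^-monoˡ-< k n<m) m^k≤n^k

m≤m^n : ∀ m n .{{_ : NonZero n}} → m ≤ m ^ n
m≤m^n zero    n       = z≤n
m≤m^n (suc m) (suc n) = m≤m*n (suc m) (suc m ^ n) {{m^n≢0 (suc m) n}}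

n<2^n : ∀ n → n < 2 ^ n
n<2^n zero    = ≤-refl
n<2^n (suc n) = +-mono-≤ (>-nonZero⁻¹ (2 ^ n) {{m^n≢0 2 n}})
  (≤-trans (n<2^n n) (m≤m+n (2 ^ n) 0))

-- Turns a bound on t ^ b into one natural number that bounds t. It depends on n only, so it can
-- serve as the time limit of every run before any run is known.
greatest-root : ∀ b .{{_ : NonZero b}} y → ∃[ T ] (T ^ b ≤ y × ∀ t → t ^ b ≤ y → t ≤ T)
greatest-root b@(suc _) y = search y λ t t^b≤y → ≤-trans (m≤m^n t b) t^b≤y
  where
  search : ∀ s → (∀ t → t ^ b ≤ y → t ≤ s) → ∃[ T ] (T ^ b ≤ y × ∀ t → t ^ b ≤ y → t ≤ T)
  search zero    ub = 0 , z≤n , ub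
  search (suc s) ub with suc s ^ b ≤? y
  ... | yes p = suc s , p , ub
  ... | no ¬p = search s λ t q → s≤s⁻¹ (≤∧≢⇒< (ub t q) λ { refl → ¬p q })

-- t ≤ C · n ^ (a / b), raised to the power b.
record Bound (n a b C t : ℕ) : Set where
  constructor bounded
  field unbounded : t ^ b ≤ C ^ b * n ^ a

module _ {n a b : ℕ} .{{_ : NonZero n}} .{{_ : NonZero b}} where

  -- Fractional exponents are compared after raising everything to the power b b′; the b-th root is
  -- taken back at the end.
  bound-rescale : ∀ {a′ b′ C t} → a * b′ ≤ a′ * b →
    Bound n a b C t → Bound n a′ b′ C t
  bound-rescale {a′} {b′} {C} {t} ab′≤a′b (bounded p) = bounded (^-cancelˡ-≤ b (begin
    (t ^ b′) ^ b                    ≡⟨ ^-swap t b′ b ⟩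
    (t ^ b) ^ b′                    ≤⟨ ^-monoˡ-≤ b′ p ⟩
    (C ^ b * n ^ a) ^ b′            ≡⟨ ^-distribʳ-* b′ (C ^ b) (n ^ a) ⟩
    (C ^ b) ^ b′ * (n ^ a) ^ b′     ≡⟨ cong₂ _*_ (^-swap C b b′) (^-*-assoc n a b′) ⟩
    (C ^ b′) ^ b * n ^ (a * b′)     ≤⟨ *-monoʳ-≤ ((C ^ b′) ^ b) (^-monoʳ-≤ n ab′≤a′b) ⟩
    (C ^ b′) ^ b * n ^ (a′ * b)     ≡⟨ cong ((C ^ b′) ^ b *_) (^-*-assoc n a′ b) ⟨
    (C ^ b′) ^ b * (n ^ a′) ^ b     ≡⟨ ^-distribʳ-* b (C ^ b′) (n ^ a′) ⟨
    (C ^ b′ * n ^ a′) ^ b           ∎))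
    where open ≤-Reasoning

  bound-weaken : ∀ {C C′ t t′} → t′ ≤ t → C ≤ C′ → Bound n a b C t → Bound n a b C′ t′
  bound-weaken t′≤t C≤C′ (bounded p) = bounded (≤-trans (^-monoˡ-≤ b t′≤t)
    (≤-trans p (*-monoˡ-≤ (n ^ a) (^-monoˡ-≤ b C≤C′))))

  bound-* : ∀ {C t} m → Bound n a b C t → Bound n a b (m * C) (m * t)
  bound-* {C} {t} m (bounded p) = bounded (begin
    (m * t) ^ b               ≡⟨ ^-distribʳ-* b m t ⟩
    m ^ b * t ^ b             ≤⟨ *-monoʳ-≤ (m ^ b) p ⟩
    m ^ b * (C ^ b * n ^ a)   ≡⟨ *-assoc (m ^ b) (C ^ b) (n ^ a) ⟨
    m ^ b * C ^ b * n ^ a     ≡⟨ cong (_* n ^ a) (^-distribʳ-* b m C) ⟨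
    (m * C) ^ b * n ^ a       ∎)
    where open ≤-Reasoning

  -- Raised to the power b the bound is not additive, so the sum is replaced by twice the larger
  -- term.
  bound-+ : ∀ {C C′ t t′} → Bound n a b C t → Bound n a b C′ t′ →
    Bound n a b (2 * (C + C′)) (t + t′)
  bound-+ {C} {C′} {t} {t′} p p′ with ≤-total t t′
  ... | inj₁ t≤t′ = bound-weaken (subst (t + t′ ≤_) (cong (t′ +_) (sym (+-identityʳ t′))) (+-monoˡ-≤ t′ t≤t′))
                      ≤-refl (bound-* 2 (bound-weaken ≤-refl (m≤n+m C′ C) p′))
  ... | inj₂ t′≤t = bound-weaken (subst (t + t′ ≤_) (cong (t +_) (sym (+-identityʳ t))) (+-monoʳ-≤ t t′≤t))
                      ≤-refl (bound-* 2 (bound-weaken ≤-refl (m≤m+n C C′) p))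

  bound-square-* : ∀ {a′ C t} → a + b * 2 ≡ a′ → Bound n a b C t → Bound n a′ b C (n * n * t)
  bound-square-* {C = C} {t} refl (bounded p) = bounded (begin
    (n * n * t) ^ b              ≡⟨ ^-distribʳ-* b (n * n) t ⟩
    (n * n) ^ b * t ^ b          ≤⟨ *-monoʳ-≤ ((n * n) ^ b) p ⟩
    (n * n) ^ b * (C ^ b * n ^ a) ≡⟨ lem ((n * n) ^ b) (C ^ b) (n ^ a) ⟩
    C ^ b * (n ^ a * (n * n) ^ b) ≡⟨ cong (λ z → C ^ b * (n ^ a * z))
        (trans (cong (λ z → (n * z) ^ b) (sym (*-identityʳ n)))
        (trans (^-*-assoc n 2 b) (cong (n ^_) (*-comm 2 b)))) ⟩
    C ^ b * (n ^ a * n ^ (b * 2)) ≡⟨ cong (C ^ b *_) (^-distribˡ-+-* n a (b * 2)) ⟨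
    C ^ b * n ^ (a + b * 2)      ∎)
    where
    open ≤-Reasoning
    lem : ∀ x y z → x * (y * z) ≡ y * (z * x)
    lem = solve-∀

  -- K ^ (a / b) need not be an integer; K ^ a is one that dominates it.
  bound-scale : ∀ {m C t} K .{{_ : NonZero K}} → m ≡ K * n → Bound m a b C t → Bound n a b (C * K ^ a) t
  bound-scale {C = C} {t} K refl (bounded p) = bounded (begin
    t ^ b                           ≤⟨ p ⟩
    C ^ b * (K * n) ^ a             ≡⟨ cong (C ^ b *_) (^-distribʳ-* a K n) ⟩
    C ^ b * (K ^ a * n ^ a)         ≤⟨ *-monoʳ-≤ (C ^ b) (*-monoˡ-≤ (n ^ a) (m≤m^n (K ^ a) b)) ⟩
    C ^ b * ((K ^ a) ^ b * n ^ a)   ≡⟨ *-assoc (C ^ b) _ _ ⟨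
    C ^ b * (K ^ a) ^ b * n ^ a     ≡⟨ cong (_* n ^ a) (^-distribʳ-* b C (K ^ a)) ⟨
    (C * K ^ a) ^ b * n ^ a         ∎)
    where open ≤-Reasoning

  bound-crude : ∀ {C t} → Bound n a b C t → t ≤ C * n ^ a
  bound-crude {C} {t} (bounded p) = ^-cancelˡ-≤ b (begin
    t ^ b                  ≤⟨ p ⟩
    C ^ b * n ^ a          ≤⟨ *-monoʳ-≤ (C ^ b) (m≤m^n (n ^ a) b) ⟩
    C ^ b * (n ^ a) ^ b    ≡⟨ ^-distribʳ-* b C (n ^ a) ⟨
    (C * n ^ a) ^ b        ∎)
    where open ≤-Reasoning

-- Rational exponents

-- frac a b is a / (1 + b); abstract so that a and b can be inferred from it.
abstract
  frac : ℕ → ℕ → ℚ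
  frac a b = ℚ.fromℚᵘ (mkℚᵘ (ℤ.+ a) b)

  frac-≃ : ∀ a b → ℚ.toℚᵘ (frac a b) ℚᵘ.≃ mkℚᵘ (ℤ.+ a) b
  frac-≃ a b = ℚ.toℚᵘ-fromℚᵘ (mkℚᵘ (ℤ.+ a) b)

frac-≤⁻ : ∀ a b {q} → frac a b ℚ.≤ q → mkℚᵘ (ℤ.+ a) b ℚᵘ.≤ ℚ.toℚᵘ q
frac-≤⁻ a b le = ℚᵘ.≤-respˡ-≃ (frac-≃ a b) (ℚ.toℚᵘ-mono-≤ le)

≤-frac⁻ : ∀ a b {q} → q ℚ.≤ frac a b → ℚ.toℚᵘ q ℚᵘ.≤ mkℚᵘ (ℤ.+ a) b
≤-frac⁻ a b le = ℚᵘ.≤-respʳ-≃ (frac-≃ a b) (ℚ.toℚᵘ-mono-≤ le)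

≤-frac⁺ : ∀ a b {q} → ℚ.toℚᵘ q ℚᵘ.≤ mkℚᵘ (ℤ.+ a) b → q ℚ.≤ frac a b
≤-frac⁺ a b le = ℚ.toℚᵘ-cancel-≤ (ℚᵘ.≤-respʳ-≃ (ℚᵘ.≃-sym (frac-≃ a b)) le)

frac-≤⁺ : ∀ a b {q} → mkℚᵘ (ℤ.+ a) b ℚᵘ.≤ ℚ.toℚᵘ q → frac a b ℚ.≤ q
frac-≤⁺ a b le = ℚ.toℚᵘ-cancel-≤ (ℚᵘ.≤-respˡ-≃ (ℚᵘ.≃-sym (frac-≃ a b)) le)

frac-mono-≤ : ∀ {a b c d} → a * suc d ≤ c * suc b → frac a b ℚ.≤ frac c d
frac-mono-≤ {a} {b} {c} {d} le = frac-≤⁺ a b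
  (ℚᵘ.≤-respʳ-≃ (ℚᵘ.≃-sym (frac-≃ c d))
    (*≤* (subst₂ ℤ._≤_ (ℤ.pos-* a (suc d)) (ℤ.pos-* c (suc b)) (ℤ.+≤+ le))))

frac-positive : ∀ a b → 0ℚ ℚ.< frac (suc a) b
frac-positive a b = ℚ.toℚᵘ-cancel-< (ℚᵘ.<-respʳ-≃ (ℚᵘ.≃-sym (frac-≃ (suc a) b)) (*<* (ℤ.+<+ z<s)))

frac-+ : ∀ a c b → frac a b ℚ.+ frac c b ≡ frac (a + c) b
frac-+ a c b = ℚ.toℚᵘ-injective (begin
  ℚ.toℚᵘ (frac a b ℚ.+ frac c b)              ≈⟨ ℚ.toℚᵘ-homo-+ (frac a b) (frac c b) ⟩
  ℚ.toℚᵘ (frac a b) ℚᵘ.+ ℚ.toℚᵘ (frac c b)    ≈⟨ ℚᵘ.+-cong (frac-≃ a b) (frac-≃ c b) ⟩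
  mkℚᵘ (ℤ.+ a) b ℚᵘ.+ mkℚᵘ (ℤ.+ c) b              ≈⟨ *≡* lem ⟩
  mkℚᵘ (ℤ.+ (a + c)) b                          ≈⟨ frac-≃ (a + c) b ⟨
  ℚ.toℚᵘ (frac (a + c) b)                     ∎)
  where
  open ℚᵘ.≃-Reasoning
  lem : (ℤ.+ a ℤ.* ℤ.+ suc b ℤ.+ ℤ.+ c ℤ.* ℤ.+ suc b) ℤ.* ℤ.+ suc b ≡ ℤ.+ (a + c) ℤ.* ℤ.+ (suc b * suc b)
  lem = trans (cong (ℤ._* ℤ.+ suc b) (sym (ℤ.*-distribʳ-+ (ℤ.+ suc b) (ℤ.+ a) (ℤ.+ c))))
    (trans (ℤ.*-assoc (ℤ.+ (a + c)) (ℤ.+ suc b) (ℤ.+ suc b)) (cong (ℤ.+ (a + c) ℤ.*_) (sym (ℤ.pos-* (suc b) (suc b)))))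

module _ {n a b C t : ℕ} .{{_ : NonZero n}} where

  -- `frac a b` is stored in lowest terms, so the exponents found here may differ from a and b + 1;
  -- `bound-rescale` leads back to them.
  ^ℚ⇒bound : t ≤ C · n ^ℚ frac a b → Bound n a (suc b) C t
  ^ℚ⇒bound p with frac a b | ≤-frac⁻ a b ℚ.≤-refl
  ... | mkℚ (ℤ.+ a′) b′ _ | *≤* le =
    bound-rescale {n} {a′} {suc b′} (ℤ.drop‿+≤+ (subst₂ ℤ._≤_ (sym (ℤ.pos-* a′ (suc b)))
        (sym (ℤ.pos-* a (suc b′))) le)) (bounded p)
  -- This case cannot occur, but weakening is simpler than refuting it: dropping the power of n
  -- leaves exponent 0.
  ... | mkℚ -[1+ a′ ] b′ _ | _ =
    bound-rescale {n} {0} {suc b′} z≤n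
      (bounded (≤-trans (≤-trans (m≤m*n (t ^ suc b′) (n ^ suc a′) {{m^n≢0 n (suc a′)}}) p)
        (≤-reflexive (sym (*-identityʳ (C ^ suc b′))))))

  bound⇒^ℚ : ∀ {q} → frac a b ℚ.≤ q → Bound n a (suc b) C t → t ≤ C · n ^ℚ q
  bound⇒^ℚ {q} a/b≤q p with q | frac-≤⁻ a b a/b≤q
  ... | mkℚ (ℤ.+ a′) b′ _ | *≤* le =
    Bound.unbounded (bound-rescale {n} {a} {suc b} {a′}
        (ℤ.drop‿+≤+ (subst₂ ℤ._≤_ (sym (ℤ.pos-* a (suc b′))) (sym (ℤ.pos-* a′ (suc b))) le)) p)
  ... | mkℚ -[1+ a′ ] b′ _ | *≤* le with subst₂ ℤ._≤_ (sym (ℤ.pos-* a (suc b′))) refl le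
  ... | ()

-- Cuts

lower-≤ : ∀ (x : ℝ) {p q} → p ℚ.≤ q → below x q → below x p
lower-≤ x {p} {q} p≤q q∈ with ℚ.<-cmp p q
... | tri< p<q _ _  = lower x p<q q∈
... | tri≈ _ refl _ = q∈
... | tri> _ _ q<p  = contradiction (ℚ.<-≤-trans q<p p≤q) (ℚ.<-irrefl refl)

⌈_⌉ : ℚ → ℝ
below     ⌈ q ⌉ p = p ℚ.< q
inhabited ⌈ q ⌉ = q ℚ.- 1ℚ , subst (q ℚ.- 1ℚ ℚ.<_) (ℚ.+-identityʳ q)
  (ℚ.+-monoʳ-< q {ℚ.- 1ℚ} {0ℚ} (ℚ.*<* ℤ.-<+))
proper    ⌈ q ⌉ = q , ℚ.<-irrefl refl
lower     ⌈ q ⌉ = ℚ.<-trans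
open-up   ⌈ q ⌉ p<q with ℚ.<-dense p<q
... | r , p<r , r<q = r , p<r , r<q

-- Whatever lies outside ε is at least r, hence at least one grid step; if m / (b + 1) were below ω
-- - ε, the next grid point would be below ω.
above-shift : ∀ (ω ε : ℝ) {m b r} → below ε r → frac 1 b ℚ.≤ r →
  ¬ below ω (frac (suc m) b) → ¬ below (ω -ʳ ε) (frac m b)
above-shift ω ε {m} {b} {r} r∈ 1/b≤r m+1∉ (a , s , a∈ , s∉ , eq) =
  m+1∉ (lower-≤ ω (begin
    frac (suc m) b            ≡⟨ cong (λ k → frac k b) (+-comm m 1) ⟨
    frac (m + 1) b            ≡⟨ frac-+ m 1 b ⟨
    frac m b ℚ.+ frac 1 b     ≤⟨ ℚ.+-monoʳ-≤ (frac m b) (ℚ.≤-trans 1/b≤r r≤s) ⟩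
    frac m b ℚ.+ s            ≡⟨ cong (ℚ._+ s) eq ⟩
    a ℚ.- s ℚ.+ s             ≡⟨ ℚ.+-assoc a (ℚ.- s) s ⟩
    a ℚ.+ (ℚ.- s ℚ.+ s)       ≡⟨ cong (a ℚ.+_) (ℚ.+-inverseˡ s) ⟩
    a ℚ.+ 0ℚ                  ≡⟨ ℚ.+-identityʳ a ⟩
    a                         ∎) a∈)
  where
  open ℚ.≤-Reasoning
  r≤s : r ℚ.≤ s
  r≤s = ℚ.≮⇒≥ λ s<r → s∉ (lower ε s<r r∈)

-- The denominator suc (e + d * suc e), for arbitrary e, is suc d * suc e: it leaves room
-- for a second denominator suc e.
unit-frac-≤ : ∀ {r} → 0ℚ ℚ.< r → ∃[ d ] ∀ e → frac 1 (e + d * suc e) ℚ.≤ r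
unit-frac-≤ {mkℚ (ℤ.+ zero) d _}  (ℚ.*<* (ℤ.+<+ ()))
unit-frac-≤ {mkℚ (ℤ.+ suc n) d _} _ = d , λ e → frac-≤⁺ 1 _ (*≤*
  (subst₂ ℤ._≤_ (ℤ.pos-* 1 (suc d)) (ℤ.pos-* (suc n) (suc d * suc e))
    (ℤ.+≤+ (≤-trans (≤-reflexive (*-identityˡ (suc d)))
      (≤-trans (m≤m*n (suc d) (suc e)) (m≤n*m (suc d * suc e) (suc n)))))))
unit-frac-≤ {mkℚ -[1+ n ] d _}    (ℚ.*<* ())

-- A rational above 2 with denominator e + 1 exceeds 2 by at least 1 / (e + 1), hence by at least 1
-- / ((d + 1) (e + 1)) for every d.
2+unit-≤ : ∀ {q} → frac 2 0 ℚ.< q → ∃[ e ] ∀ d →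
  frac (suc (2 * suc (e + d * suc e))) (e + d * suc e) ℚ.≤ q
2+unit-≤ {q} 2<q with q | ℚᵘ.<-respˡ-≃ (frac-≃ 2 0) (ℚ.toℚᵘ-mono-< 2<q)
... | mkℚ (ℤ.+ n) e _ | *<* lt = e , λ d → frac-≤⁺ _ _ (*≤*
  (subst₂ ℤ._≤_ (ℤ.pos-* (suc (2 * B d)) (suc e)) (ℤ.pos-* n (B d))
    (ℤ.+≤+ (begin
      suc (2 * B d) * suc e   ≡⟨ lem (B d) (suc e) ⟩
      suc e + 2 * suc e * B d ≤⟨ +-monoˡ-≤ (2 * suc e * B d) (m≤n*m (suc e) (suc d)) ⟩
      B d + 2 * suc e * B d   ≤⟨ *-monoˡ-≤ (B d) lt′ ⟩
      n * B d                 ∎))))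
  where
  open ≤-Reasoning
  B : ℕ → ℕ
  B d = suc d * suc e
  lem : ∀ b e → suc (2 * b) * e ≡ e + 2 * e * b
  lem = solve-∀
  lt′ : 2 * suc e < n
  lt′ = ℤ.drop‿+<+ (subst₂ ℤ._<_ (sym (ℤ.pos-* 2 (suc e))) (ℤ.*-identityʳ (ℤ.+ n)) lt)
... | mkℚ -[1+ n ] e _ | *<* ()

frac-archimedean : ∀ q b → ∃[ m ] q ℚ.≤ frac m b
frac-archimedean (mkℚ (ℤ.+ n) d _) b = n * suc b , ≤-frac⁺ _ b (*≤*
  (subst₂ ℤ._≤_ (ℤ.pos-* n (suc b)) (ℤ.pos-* (n * suc b) (suc d))
    (ℤ.+≤+ (m≤m*n (n * suc b) (suc d)))))
frac-archimedean (mkℚ -[1+ n ] d _) b = 0 , ≤-frac⁺ _ b (*≤* ℤ.-≤+)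

-- Classically, the cut x falls between two consecutive multiples of 1 / suc b.
lattice-gap : ∀ (x : ℝ) b {m₀} → below x (frac m₀ b) →
  ¬ (∀ m → m₀ ≤ m → below x (frac m b) → ¬ ¬ below x (frac (suc m) b))
lattice-gap x b {m₀} m₀∈ all-in with proper x
... | q , q∉ with frac-archimedean q b
-- If no step could leave the cut, m₁ steps from m₀ would reach a grid point at or beyond the
-- excluded q.
... | m₁ , q≤m₁ = climb m₁ λ m₀+m₁∈ → q∉ (lower-≤ x (ℚ.≤-trans q≤m₁ (frac-mono-≤ (*-monoˡ-≤ (suc b) (m≤n+m m₁ m₀)))) m₀+m₁∈)
  where
  climb : ∀ j → ¬ ¬ below x (frac (m₀ + j) b)
  climb zero    k = k (subst (λ i → below x (frac i b)) (sym (+-identityʳ m₀)) m₀∈)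
  climb (suc j) k = climb j λ j∈ → all-in (m₀ + j) (m≤m+n m₀ j) j∈
    λ sj∈ → k (subst (λ i → below x (frac i b)) (sym (+-suc m₀ j)) sj∈)

-- The cells read by a run

Cell : Set
Cell = ℕ × ℕ

loads : Expr → Memory → List Cell
loads (lit k)    σ = []
loads (load x a) σ = (x , ⟦ a ⟧ σ) ∷ loads a σ
loads (op o a b) σ = loads a σ ++ loads b σ

reads : ∀ {P σ W t τ} → ⟨ P , σ ⟩⇓[ W ] t , τ → List Cell
reads ⇓-skip                        = []
reads (⇓-store {a = a} {b} {σ} _ _) = loads a σ ++ loads b σ
reads (⇓-seq p q)                   = reads p ++ reads q
reads (⇓-then {g} {σ = σ} _ p)      = loads g σ ++ reads p
reads (⇓-else {g} {σ = σ} _ q)      = loads g σ ++ reads q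
reads (⇓-done {g} {σ = σ} _)        = loads g σ
reads (⇓-loop {g} {σ = σ} _ p q)    = loads g σ ++ reads p ++ reads q

loadCount : Expr → ℕ
loadCount (lit k)    = 0
loadCount (load x a) = suc (loadCount a)
loadCount (op o a b) = loadCount a + loadCount b

length-loads : ∀ e σ → length (loads e σ) ≡ loadCount e
length-loads (lit k)    σ = refl
length-loads (load x a) σ = cong suc (length-loads a σ)
length-loads (op o a b) σ = trans (length-++ (loads a σ))
  (cong₂ _+_ (length-loads a σ) (length-loads b σ))

programLoads : Program → ℕ
programLoads skip          = 0
programLoads (store x a b) = loadCount a + loadCount b
programLoads (P ⨾ Q)       = programLoads P + programLoads Q
programLoads (ifnz g P Q)  = loadCount g + (programLoads P + programLoads Q)
programLoads (whilenz g P) = loadCount g + programLoads P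

-- A step evaluates only expressions from the program text, so the number of loads in the text
-- bounds the reads per step. Adding over subprograms instead of maximising makes each case a
-- polynomial inequality.
length-reads : ∀ {P σ W t τ} (r : ⟨ P , σ ⟩⇓[ W ] t , τ) →
  length (reads r) ≤ programLoads P * t
length-reads ⇓-skip = z≤n
length-reads (⇓-store {a = a} {b} {σ} _ _) = ≤-reflexive (begin
  length (loads a σ ++ loads b σ)          ≡⟨ length-loads (op add a b) σ ⟩
  loadCount a + loadCount b                ≡⟨ *-identityʳ _ ⟨
  (loadCount a + loadCount b) * 1          ∎)
  where open ≡-Reasoning
length-reads (⇓-seq {P} {Q} {s = s} {t} p q) = begin
  length (reads p ++ reads q)              ≡⟨ length-++ (reads p) ⟩
  length (reads p) + length (reads q)      ≤⟨ +-mono-≤ (length-reads p) (length-reads q) ⟩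
  programLoads P * s + programLoads Q * t  ≤⟨ m≤m+n _ _ ⟩
  programLoads P * s + programLoads Q * t + (programLoads P * t + programLoads Q * s)
                                           ≡⟨ lem (programLoads P) (programLoads Q) s t ⟩
  (programLoads P + programLoads Q) * (s + t) ∎
  where
  open ≤-Reasoning
  lem : ∀ a b s t → a * s + b * t + (a * t + b * s) ≡ (a + b) * (s + t)
  lem = solve-∀
length-reads (⇓-then {g} {P} {Q} {σ} {t = t} _ p) = begin
  length (loads g σ ++ reads p)            ≡⟨ length-++ (loads g σ) ⟩
  length (loads g σ) + length (reads p)    ≤⟨ +-mono-≤ (≤-reflexive (length-loads g σ)) (length-reads p) ⟩
  loadCount g + programLoads P * t         ≤⟨ m≤m+n _ _ ⟩
  loadCount g + programLoads P * t + ((loadCount g + programLoads Q) * t + programLoads P + programLoads Q)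
                                           ≡⟨ lem (loadCount g) (programLoads P) (programLoads Q) t ⟩
  (loadCount g + (programLoads P + programLoads Q)) * suc t ∎
  where
  open ≤-Reasoning
  lem : ∀ g a b t → g + a * t + ((g + b) * t + a + b) ≡ (g + (a + b)) * suc t
  lem = solve-∀
length-reads (⇓-else {g} {P} {Q} {σ} {t = t} _ q) = begin
  length (loads g σ ++ reads q)            ≡⟨ length-++ (loads g σ) ⟩
  length (loads g σ) + length (reads q)    ≤⟨ +-mono-≤ (≤-reflexive (length-loads g σ)) (length-reads q) ⟩
  loadCount g + programLoads Q * t         ≤⟨ m≤m+n _ _ ⟩
  loadCount g + programLoads Q * t + ((loadCount g + programLoads P) * t + programLoads P + programLoads Q)
                                           ≡⟨ lem (loadCount g) (programLoads P) (programLoads Q) t ⟩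
  (loadCount g + (programLoads P + programLoads Q)) * suc t ∎
  where
  open ≤-Reasoning
  lem : ∀ g a b t → g + b * t + ((g + a) * t + a + b) ≡ (g + (a + b)) * suc t
  lem = solve-∀
length-reads (⇓-done {g} {P} {σ} _) = begin
  length (loads g σ)                       ≡⟨ length-loads g σ ⟩
  loadCount g                              ≤⟨ m≤m+n _ _ ⟩
  loadCount g + programLoads P             ≡⟨ *-identityʳ _ ⟨
  (loadCount g + programLoads P) * 1       ∎
  where open ≤-Reasoning
length-reads (⇓-loop {g} {P} {σ} {s = s} {t} _ p q) = begin
  length (loads g σ ++ reads p ++ reads q) ≡⟨ length-++ (loads g σ) ⟩
  length (loads g σ) + length (reads p ++ reads q)
                                           ≡⟨ cong₂ _+_ (length-loads g σ) (length-++ (reads p)) ⟩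
  loadCount g + (length (reads p) + length (reads q))
                                           ≤⟨ +-monoʳ-≤ (loadCount g) (+-mono-≤ (length-reads p) (length-reads q)) ⟩
  loadCount g + (programLoads P * s + (loadCount g + programLoads P) * t)
                                           ≤⟨ m≤m+n _ _ ⟩
  loadCount g + (programLoads P * s + (loadCount g + programLoads P) * t) + (loadCount g * s + programLoads P)
                                           ≡⟨ lem (loadCount g) (programLoads P) s t ⟩
  (loadCount g + programLoads P) * suc (s + t) ∎
  where
  open ≤-Reasoning
  lem : ∀ g a s t → g + (a * s + (g + a) * t) + (g * s + a) ≡ (g + a) * suc (s + t)
  lem = solve-∀

module _ (Q : Cell → Set) where

  AgreeOff : Memory → Memory → Set
  AgreeOff σ τ = ∀ x i → ¬ Q (x , i) → σ x i ≡ τ x i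

  Unread : List Cell → Set
  Unread = All (λ c → ¬ Q c)

  agree-⟦⟧ : ∀ e {σ τ} → AgreeOff σ τ → Unread (loads e σ) → ⟦ e ⟧ σ ≡ ⟦ e ⟧ τ
  agree-⟦⟧ (lit k)    σ≈τ u        = refl
  agree-⟦⟧ (load x a) {τ = τ} σ≈τ (¬q ∷ u) =
    trans (σ≈τ x _ ¬q) (cong (τ x) (agree-⟦⟧ a σ≈τ u))
  agree-⟦⟧ (op o a b) {σ} σ≈τ u    =
    cong₂ ⟦ o ⟧ᵒ (agree-⟦⟧ a σ≈τ (++⁻ˡ (loads a σ) u)) (agree-⟦⟧ b σ≈τ (++⁻ʳ (loads a σ) u))

  agree-update : ∀ {σ τ x i j v w} → i ≡ j → v ≡ w → AgreeOff σ τ →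
    AgreeOff (σ [ x , i ↦ v ]) (τ [ x , j ↦ w ])
  agree-update {x = x} {i} refl refl σ≈τ y k ¬q with (y ≡ᵇ x) ∧ (k ≡ᵇ i)
  ... | true  = refl
  ... | false = σ≈τ y k ¬q

  agree-writeFrom : ∀ {σ τ} x i vs → AgreeOff σ τ → AgreeOff (writeFrom x i vs σ) (writeFrom x i vs τ)
  agree-writeFrom x i []       σ≈τ = σ≈τ
  agree-writeFrom x i (v ∷ vs) σ≈τ = agree-writeFrom x (suc i) vs (agree-update refl refl σ≈τ)

  -- Addresses, values and guards that read no cell of Q agree in both memories, so both runs take
  -- the same branches and the mixed cases are contradictory. Only the first run has to be known not
  -- to read Q.
  agree-run : ∀ {P σ σ′ W t t′ τ τ′} (r : ⟨ P , σ ⟩⇓[ W ] t , τ) → ⟨ P , σ′ ⟩⇓[ W ] t′ , τ′ →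
    Unread (reads r) → AgreeOff σ σ′ → AgreeOff τ τ′
  agree-run ⇓-skip ⇓-skip u σ≈ = σ≈
  agree-run (⇓-store {a = a} {b} {σ} _ _) (⇓-store _ _) u σ≈ =
    agree-update (agree-⟦⟧ a σ≈ (++⁻ˡ (loads a σ) u)) (agree-⟦⟧ b σ≈ (++⁻ʳ (loads a σ) u)) σ≈
  agree-run (⇓-seq p q) (⇓-seq p′ q′) u σ≈ =
    agree-run q q′ (++⁻ʳ (reads p) u) (agree-run p p′ (++⁻ˡ (reads p) u) σ≈)
  agree-run (⇓-then {g} {σ = σ} _ p) (⇓-then _ p′) u σ≈ = agree-run p p′ (++⁻ʳ (loads g σ) u) σ≈
  agree-run (⇓-then {g} {σ = σ} g≢0 _) (⇓-else g≡0 _) u σ≈ =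
    contradiction (trans (agree-⟦⟧ g σ≈ (++⁻ˡ (loads g σ) u)) g≡0) g≢0
  agree-run (⇓-else {g} {σ = σ} g≡0 _) (⇓-then g≢0 _) u σ≈ =
    contradiction (trans (sym (agree-⟦⟧ g σ≈ (++⁻ˡ (loads g σ) u))) g≡0) g≢0
  agree-run (⇓-else {g} {σ = σ} _ q) (⇓-else _ q′) u σ≈ = agree-run q q′ (++⁻ʳ (loads g σ) u) σ≈
  agree-run (⇓-done _) (⇓-done _) u σ≈ = σ≈
  agree-run (⇓-done {g} g≡0) (⇓-loop g≢0 _ _) u σ≈ =
    contradiction (trans (sym (agree-⟦⟧ g σ≈ u)) g≡0) g≢0
  agree-run (⇓-loop {g} {σ = σ} g≢0 _ _) (⇓-done g≡0) u σ≈ =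
    contradiction (trans (agree-⟦⟧ g σ≈ (++⁻ˡ (loads g σ) u)) g≡0) g≢0
  agree-run (⇓-loop {g} {σ = σ} _ p q) (⇓-loop _ p′ q′) u σ≈ =
    agree-run q q′ (++⁻ʳ (reads p) (++⁻ʳ (loads g σ) u))
      (agree-run p p′ (++⁻ˡ (reads p) (++⁻ʳ (loads g σ) u)) σ≈)

-- Sums and disjunctions over Fin n

sum-≤ : ∀ {n m} (f : Fin n → ℕ) → (∀ i → f i ≤ m) → Vector.foldr _+_ 0 f ≤ n * m
sum-≤ {zero}  f le = z≤n
sum-≤ {suc n} f le = +-mono-≤ (le zero) (sum-≤ (f ∘ suc) (le ∘ suc))

sum-≥ : ∀ {n m} (f : Fin n → ℕ) l k → l + k ≤ n →
  (∀ i → l ≤ toℕ i → toℕ i < l + k → m ≤ f i) → k * m ≤ Vector.foldr _+_ 0 f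
sum-≥         f zero    zero    le ge = z≤n
sum-≥ {suc n} f zero    (suc k) le ge = +-mono-≤ (ge zero z≤n z<s)
  (sum-≥ (f ∘ suc) 0 k (s≤s⁻¹ le) λ i _ i<k → ge (suc i) z≤n (s<s i<k))
sum-≥ {suc n} f (suc l) k       le ge = m≤n⇒m≤o+n (f zero)
  (sum-≥ (f ∘ suc) l k (s≤s⁻¹ le) λ i l≤i i<l+k → ge (suc i) (s≤s l≤i) (s<s i<l+k))

any-true : ∀ {n} (f : Fin n → Bool) i → T (f i) → T (Vector.foldr _∨_ false f)
any-true f zero    p = Equivalence.from T-∨ (inj₁ p)
any-true f (suc i) p = Equivalence.from (T-∨ {f zero}) (inj₂ (any-true (f ∘ suc) i p))

any-true⁻ : ∀ {n} (f : Fin n → Bool) → T (Vector.foldr _∨_ false f) → ∃[ i ] T (f i)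
any-true⁻ {suc n} f p with Equivalence.to (T-∨ {f zero}) p
... | inj₁ p₀ = zero , p₀
... | inj₂ ps = map suc (λ z → z) (any-true⁻ (f ∘ suc) ps)

bit≤1 : ∀ b → bit b ≤ 1
bit≤1 true  = ≤-refl
bit≤1 false = z≤n

-- Vertex states after an update

switch⁻ : ∀ {n} (Von D : Subset n) {v} → v ∈ switch Von D → v ∈ Von ⊎ v ∈ D
switch⁻ Von D v∈ with x∈p∪q⁻ (Von ─ D) (∁ Von ∩ D) v∈
... | inj₁ v∈Von─D = inj₁ (p─q⊆p Von D v∈Von─D)
... | inj₂ v∈      = inj₂ (proj₂ (x∈p∩q⁻ (∁ Von) D v∈))

on-stays : ∀ {n} {Von D : Subset n} {v} → v ∈ Von → v ∉ D → v ∈ switch Von D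
on-stays v∈Von v∉D = x∈p∪q⁺ (inj₁ (x∈p∧x∉q⇒x∈p─q v∈Von v∉D))

off-switches : ∀ {n} {Von D : Subset n} {v} → v ∉ Von → v ∈ D → v ∈ switch Von D
off-switches v∉Von v∈D = x∈p∪q⁺ (inj₂ (x∈p∩q⁺ (x∉p⇒x∈∁p v∉Von , v∈D)))

-- The tripartite graph of two matrices

<ᵇ-∧-<ᵇ-suc : ∀ a b → (a <ᵇ b) ∧ (b <ᵇ suc a) ≡ false
<ᵇ-∧-<ᵇ-suc zero    zero    = refl
<ᵇ-∧-<ᵇ-suc zero    (suc b) = refl
<ᵇ-∧-<ᵇ-suc (suc a) zero    = refl
<ᵇ-∧-<ᵇ-suc (suc a) (suc b) = <ᵇ-∧-<ᵇ-suc a b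

-- The vertices come in blocks of N: the rows of A (block 0), the columns of A,
-- which are the rows of B (block 1), the columns of B (block 2), and 2 P blocks
-- spanning a complete bipartite graph, whose only role is to make the graph
-- dense and large.
module Blocks (P : ℕ) .{{_ : NonZero P}} {N : ℕ} where

  K : ℕ
  K = 3 + (P + P)

  Vertex : Set
  Vertex = Fin (K * N)

  abstract
    coords : Vertex → Fin K × Fin N
    coords = remQuot {K} N

    vertex : Fin K → Fin N → Vertex
    vertex = combine

    toℕ-vertex : ∀ a i → toℕ (vertex a i) ≡ N * toℕ a + toℕ i
    toℕ-vertex = toℕ-combine

    coords-vertex : ∀ a i → coords (vertex a i) ≡ (a , i)
    coords-vertex = remQuot-combine

    vertex-coords : ∀ v → uncurry vertex (coords v) ≡ v
    vertex-coords = combine-remQuot {K} N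

    vertex-injective : ∀ {a b i j} → vertex a i ≡ vertex b j → a ≡ b × i ≡ j
    vertex-injective = combine-injective _ _ _ _

  vertex-injectiveˡ : ∀ {a b i j} → vertex a i ≡ vertex b j → a ≡ b
  vertex-injectiveˡ = proj₁ ∘ vertex-injective

  data View : Vertex → Set where
    view : ∀ a i → View (vertex a i)

  viewVertex : ∀ v → View v
  viewVertex v = subst View (vertex-coords v) (view _ _)

  module _ (A B : Matrix N) where

    -- Edges directed from the lower block to the higher; `linked` symmetrises. The last disjunct is
    -- the complete bipartite graph between blocks 3 to 2 + P and the blocks from 3 + P on.
    link : ℕ → Fin N → ℕ → Fin N → Bool
    link a i b j = ((a ≡ᵇ 0) ∧ (b ≡ᵇ 1)) ∧ A i j
                 ∨ ((a ≡ᵇ 1) ∧ (b ≡ᵇ 2)) ∧ B i j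
                 ∨ ((2 <ᵇ a) ∧ (a <ᵇ 3 + P)) ∧ (2 + P <ᵇ b)

    linked : Fin K × Fin N → Fin K × Fin N → Bool
    linked (a , i) (b , j) = link (toℕ a) i (toℕ b) j ∨ link (toℕ b) j (toℕ a) i

    link-irrefl : ∀ a i → link a i a i ≡ false
    link-irrefl 0 i = refl
    link-irrefl 1 i = refl
    link-irrefl 2 i = refl
    link-irrefl (suc (suc (suc a))) i = <ᵇ-∧-<ᵇ-suc a P

    graph : Graph (K * N)
    adj    graph u v = linked (coords u) (coords v)
    symm   graph u v = ∨-comm (link (toℕ (proj₁ (coords u))) (proj₂ (coords u)) (toℕ (proj₁ (coords v)))
        (proj₂ (coords v))) (link (toℕ (proj₁ (coords v))) (proj₂ (coords v)) (toℕ (proj₁ (coords u)))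
        (proj₂ (coords u)))
    irrefl graph v   = cong₂ _∨_ (link-irrefl (toℕ (proj₁ (coords v))) (proj₂ (coords v)))
        (link-irrefl (toℕ (proj₁ (coords v))) (proj₂ (coords v)))

    adj-vertex : ∀ a i b j → adj graph (vertex a i) (vertex b j) ≡ linked (a , i) (b , j)
    adj-vertex a i b j = cong₂ linked (coords-vertex a i) (coords-vertex b j)

    private
      block-< : ∀ {a} (i : Fin N) k → N * k ≤ N * a + toℕ i → k ≤ a
      block-< {a} i k le = s≤s⁻¹ (*-cancelˡ-< N k (suc a) (begin-strict
        N * k            ≤⟨ le ⟩
        N * a + toℕ i    <⟨ +-monoʳ-< (N * a) (toℕ<n i) ⟩
        N * a + N        ≡⟨ +-comm (N * a) N ⟩
        N + N * a        ≡⟨ *-suc N a ⟨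
        N * suc a        ∎))
        where open ≤-Reasoning

      block-> : ∀ {a} (i : Fin N) k → N * a + toℕ i < N * k → a < k
      block-> {a} i k lt = *-cancelˡ-< N a k (≤-<-trans (m≤m+n (N * a) (toℕ i)) lt)

    filler-edge : ∀ u v → N * 3 ≤ toℕ u → toℕ u < N * 3 + N * P →
      N * 3 + N * P ≤ toℕ v → 1 ≤ bit (does (u <ᶠ? v) ∧ adj graph u v)
    filler-edge u v l≤u u<m m≤v with viewVertex u | viewVertex v
    ... | view a i | view b j = subst (λ c → 1 ≤ bit c)
      (sym (cong₂ _∧_ (dec-true (vertex a i <ᶠ? vertex b j) (<-≤-trans u<m m≤v)) (adj-vertex a i b j)))
      (edge (toℕ a) (toℕ b)
        (block-< i 3 (subst (N * 3 ≤_) (toℕ-vertex a i) l≤u))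
        (block-> i (3 + P) (subst₂ _<_ (toℕ-vertex a i) (sym (*-distribˡ-+ N 3 P)) u<m))
        (block-< j (3 + P) (subst₂ _≤_ (sym (*-distribˡ-+ N 3 P)) (toℕ-vertex b j) m≤v)))
      where
      edge : ∀ a b {i j} → 3 ≤ a → a < 3 + P → 3 + P ≤ b → 1 ≤ bit (link a i b j ∨ link b j a i)
      edge (suc (suc (suc a))) (suc (suc (suc b))) (s≤s (s≤s (s≤s _))) a< (s≤s (s≤s P<b))
        rewrite Equivalence.to T-≡ (<⇒<ᵇ a<) | Equivalence.to T-≡ (<⇒<ᵇ P<b) = ≤-refl

    -- The filler alone has (N P)² edges, and K = 3 + 2 P ≤ 5 P because P ≥ 1, so (K N)² ≤ 25 (N
    -- P)². One constant serves all P and N.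
    dense : Dense 25 graph
    dense = lower-bound , upper-bound
      where
      upper-bound : edgeCount graph ≤ 25 * (K * N * (K * N))
      upper-bound = begin
        edgeCount graph             ≤⟨ sum-≤ {m = K * N * 1} _
            (λ u → sum-≤ {m = 1} _ λ v → bit≤1 (does (u <ᶠ? v) ∧ adj graph u v)) ⟩
        K * N * (K * N * 1)         ≡⟨ cong (K * N *_) (*-identityʳ (K * N)) ⟩
        K * N * (K * N)             ≤⟨ m≤n*m (K * N * (K * N)) 25 ⟩
        25 * (K * N * (K * N))      ∎
        where open ≤-Reasoning
      K≤5P : K ≤ 5 * P
      K≤5P = ≤-trans (+-monoˡ-≤ (P + P) (*-monoʳ-≤ 3 (>-nonZero⁻¹ P))) (≤-reflexive (lem P))
        where
        lem : ∀ p → 3 * p + (p + p) ≡ 5 * p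
        lem = solve-∀
      fits : N * 3 + N * P + N * P ≤ K * N
      fits = ≤-reflexive (lem N P)
        where
        lem : ∀ n p → n * 3 + n * p + n * p ≡ (3 + (p + p)) * n
        lem = solve-∀
      lower-bound : K * N * (K * N) ≤ 25 * edgeCount graph
      lower-bound = begin
        K * N * (K * N)                     ≤⟨ *-mono-≤ (*-monoˡ-≤ N K≤5P) (*-monoˡ-≤ N K≤5P) ⟩
        5 * P * N * (5 * P * N)             ≡⟨ lem P N ⟩
        25 * (N * P * (N * P * 1))          ≤⟨ *-monoʳ-≤ 25 (sum-≥ _ (N * 3) (N * P) (m+n≤o⇒m≤o (N * 3 + N * P) fits)
                                                λ u l≤u u<m → sum-≥ _ (N * 3 + N * P) (N * P) fits
                                                λ v m≤v _ → filler-edge u v l≤u u<m m≤v) ⟩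
        25 * edgeCount graph                ∎
        where
        open ≤-Reasoning
        lem : ∀ p n → 5 * p * n * (5 * p * n) ≡ 25 * (n * p * (n * p * 1))
        lem = solve-∀

  -- Matrix products as connectivity: a path between row i of A and column j of
  -- B through the vertices of block 1 has length two.

  middle : Subset (K * N)
  middle = Vec.tabulate λ v → toℕ (proj₁ (coords v)) ≡ᵇ 1

  middle⁺ : ∀ k → vertex (suc zero) k ∈ middle
  middle⁺ k = lookup⇒[]= _ _ (trans (lookup∘tabulate _ (vertex (suc zero) k))
    (cong (λ c → toℕ (proj₁ c) ≡ᵇ 1) (coords-vertex (suc zero) k)))

  middle⁻ : ∀ {a i} → vertex a i ∈ middle → a ≡ suc zero
  middle⁻ {a} {i} v∈ = is-one a (trans
    (sym (trans (lookup∘tabulate _ (vertex a i)) (cong (λ c → toℕ (proj₁ c) ≡ᵇ 1) (coords-vertex a i))))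
    ([]=⇒lookup v∈))
    where
    is-one : ∀ (a : Fin K) → (toℕ a ≡ᵇ 1) ≡ true → a ≡ suc zero
    is-one (suc zero) _ = refl

  endpoints : Fin N → Fin N → Subset (K * N)
  endpoints i j = ⁅ vertex zero i ⁆ ∪ ⁅ vertex (suc (suc zero)) j ⁆

  -- `updateInput` lists D in increasing order, so its contents depend on which endpoint has the
  -- smaller number.
  row<column : ∀ i j → toℕ (vertex zero i) < toℕ (vertex (suc (suc zero)) j)
  row<column i j = subst₂ _<_ (sym (toℕ-vertex zero i)) (sym (toℕ-vertex (suc (suc zero)) j))
    (<-≤-trans (+-monoʳ-< (N * 0) (toℕ<n i)) (≤-trans (≤-reflexive (trans (cong (_+ N) (*-zeroʳ N)) (sym (*-identityʳ N))))
      (≤-trans (*-monoʳ-≤ N (s≤s (z≤n {1}))) (m≤m+n (N * 2) (toℕ j)))))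

  module _ {i j : Fin N} where

    private
      x z : Vertex
      x = vertex zero i
      z = vertex (suc (suc zero)) j

      S : Subset (K * N)
      S = switch middle (endpoints i j)

    endpoints⁻ : ∀ {v} → v ∈ endpoints i j → v ≡ x ⊎ v ≡ z
    endpoints⁻ v∈ = Sum.map (x∈⁅y⁆⇒x≡y x) (x∈⁅y⁆⇒x≡y z) (x∈p∪q⁻ ⁅ x ⁆ ⁅ z ⁆ v∈)

    row-on : x ∈ S
    row-on = off-switches (λ x∈ → case middle⁻ x∈ of λ ()) (x∈p∪q⁺ (inj₁ (x∈⁅x⁆ x)))

    column-on : z ∈ S
    column-on = off-switches (λ z∈ → case middle⁻ z∈ of λ ()) (x∈p∪q⁺ {p = ⁅ x ⁆} (inj₂ (x∈⁅x⁆ z)))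

    middle-on : ∀ k → vertex (suc zero) k ∈ S
    middle-on k = on-stays (middle⁺ k) λ v∈ → case endpoints⁻ v∈ of λ where
      (inj₁ eq) → case vertex-injectiveˡ eq of λ ()
      (inj₂ eq) → case vertex-injectiveˡ eq of λ ()

    module _ (A B : Matrix N) where

      private
        G : Graph (K * N)
        G = graph A B

        adj⁺ : ∀ {a k b l} → T (linked A B (a , k) (b , l)) → T (adj G (vertex a k) (vertex b l))
        adj⁺ {a} {k} {b} {l} = subst T (sym (adj-vertex A B a k b l))

        adj⁻ : ∀ {a k b l} → T (adj G (vertex a k) (vertex b l)) → T (linked A B (a , k) (b , l))
        adj⁻ {a} {k} {b} {l} = subst T (adj-vertex A B a k b l)

      product⇒connected : T ((A ⊗ B) i j) → Connected G S x z
      product⇒connected p with any-true⁻ _ p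
      ... | k , q with Equivalence.to (T-∧ {A i k}) q
      ... | Aik , Bkj =
        (row-on , middle-on k , adj⁺ (Equivalence.from T-∨ (inj₁ (Equivalence.from (T-∨ {A i k}) (inj₁ Aik))))) ◅
        (middle-on k , column-on , adj⁺ {a = suc zero} {b = suc (suc zero)}
            (Equivalence.from T-∨ (inj₁ (Equivalence.from (T-∨ {B k j}) (inj₁ Bkj))))) ◅ done

      private
        -- What a walk from x can visit before it first meets z: block 1 is independent and x, z are
        -- not adjacent, so the walk leaves x only to some k with `A i k`, and k only back to x or
        -- on to z.
        data Reached : Vertex → Set where
          start : Reached x
          via   : ∀ k → T (A i k) → Reached (vertex (suc zero) k)

        walk : ∀ {v w} → Reached v → Star (InducedAdj G S) v w → w ≡ z → T ((A ⊗ B) i j)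
        walk start     done eq = case vertex-injectiveˡ eq of λ ()
        walk (via k _) done eq = case vertex-injectiveˡ eq of λ ()
        walk {v} r (_◅_ {j = u} (_ , u∈ , v~u) path) eq with switch⁻ middle (endpoints i j) u∈
        walk r (_◅_ {j = u} (_ , _ , v~u) path) eq | inj₂ u∈ with endpoints⁻ u∈
        walk r         ((_ , _ , v~u) ◅ path) eq | inj₂ u∈ | inj₁ refl = walk start path eq
        walk start     ((_ , _ , v~u) ◅ path) eq | inj₂ u∈ | inj₂ refl =
          ⊥-elim (adj⁻ {zero} {i} {suc (suc zero)} {j} v~u)
        walk (via k Aik) ((_ , _ , v~u) ◅ path) eq | inj₂ u∈ | inj₂ refl =
          any-true _ k (Equivalence.from T-∧ (Aik , ∨-false (B k j) (adj⁻ {suc zero} {k} {suc (suc zero)} {j} v~u)))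
          where
          ∨-false : ∀ b → T ((b ∨ false) ∨ false) → T b
          ∨-false true _ = tt
        walk r (_◅_ {j = u} (_ , _ , v~u) path) eq | inj₁ u∈ with viewVertex u
        walk r (_◅_ {j = u} (_ , _ , v~u) path) eq | inj₁ u∈ | view a l with middle⁻ {a} {l} u∈
        walk start ((_ , _ , v~u) ◅ path) eq | inj₁ u∈ | view _ l | refl =
          walk (via l (∨-false (A i l) (adj⁻ {zero} {i} {suc zero} {l} v~u))) path eq
          where
          ∨-false : ∀ b → T ((b ∨ false) ∨ false) → T b
          ∨-false true _ = tt
        walk (via k _) ((_ , _ , v~u) ◅ path) eq | inj₁ u∈ | view _ l | refl =
          ⊥-elim (adj⁻ {suc zero} {k} {suc zero} {l} v~u)

      connected⇒product : Connected G S x z → T ((A ⊗ B) i j)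
      connected⇒product path = walk start path refl

-- Inputs that differ in few cells, and pigeonhole on the cells read

module _ (Q : Cell → Set) where

  agree-tabulate : ∀ {m} x i (f g : Fin m → ℕ) {σ τ} → (∀ p → ¬ Q (x , i + toℕ p) → f p ≡ g p) →
    AgreeOff Q σ τ → AgreeOff Q (writeFrom x i (tabulate f) σ) (writeFrom x i (tabulate g) τ)
  agree-tabulate {zero}  x i f g f≈g σ≈τ = σ≈τ
  agree-tabulate {suc m} x i f g {σ} {τ} f≈g σ≈τ =
    agree-tabulate x (suc i) (f ∘ suc) (g ∘ suc)
      (λ p ¬q → f≈g (suc p) (subst (λ k → ¬ Q (x , k)) (sym (+-suc i (toℕ p))) ¬q))
      first
    where
    first : AgreeOff Q (σ [ x , i ↦ f zero ]) (τ [ x , i ↦ g zero ])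
    first y k ¬q with y ≡ᵇ x in y≡x | k ≡ᵇ i in k≡i
    ... | false | _     = σ≈τ y k ¬q
    ... | true  | false = σ≈τ y k ¬q
    ... | true  | true  = f≈g zero (subst₂ (λ y k → ¬ Q (y , k))
      (≡ᵇ⇒≡ y x (subst T (sym y≡x) tt))
      (trans (≡ᵇ⇒≡ k i (subst T (sym k≡i) tt)) (sym (+-identityʳ i))) ¬q)

module _ {m} (f g : Fin m → Cell) where

  Pair : Fin m → Cell → Set
  Pair p c = c ≡ f p ⊎ c ≡ g p

  pair? : ∀ p c → Dec (Pair p c)
  pair? p c = ≡-dec _≟_ _≟_ c (f p) ⊎-dec ≡-dec _≟_ _≟_ c (g p)

  -- If every pair met R, sending each pair to the position in R of one of its cells would, by
  -- pigeonhole, give two pairs a common cell.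
  avoided-pair : (∀ {p q c} → Pair p c → Pair q c → p ≡ q) →
    ∀ (R : List Cell) → length R < m → ∃[ p ] Unread (Pair p) R
  avoided-pair disjoint R R<m with all? (λ p → Any.any? (pair? p) R)
  ... | no ¬all = map₂ (¬Any⇒All¬ R) (¬∀⟶∃¬ m _ (λ p → Any.any? (pair? p) R) ¬all)
  ... | yes all with pigeonhole R<m (Any.index ∘ all)
  ... | p , q , p<q , eq = contradiction
    (disjoint (lookup-index (all p)) (subst (Pair q ∘ lookup R) (sym eq) (lookup-index (all q))))
    (<ᶠ⇒≢ p<q)

-- Two components that become one when a single hidden entry of the matrix is changed

module Hidden (M : ℕ) .{{_ : NonZero M}} where

  open Blocks 1 {M + M}

  xnor : Bool → Bool → Bool
  xnor true  b = b
  xnor false b = not b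

  xnor⁻ : ∀ a b → T (xnor a b) → a ≡ b
  xnor⁻ true  true  _ = refl
  xnor⁻ false false _ = refl

  half : Fin (M + M) → Bool
  half i = toℕ i <ᵇ M

  blockwise : Matrix (M + M)
  blockwise i k = xnor (half i) (half k)

  none : Matrix (M + M)
  none i k = false

  -- The M² places, a row in the first half and a column in the second, where a single edge joins
  -- the two components. As n = 10 M, these are n² / 100 non-edges.
  Gap : Set
  Gap = Fin (M * M)

  row col : Gap → Fin (M + M)
  row p = proj₁ (remQuot {M} M p) ↑ˡ M
  col p = M ↑ʳ proj₂ (remQuot {M} M p)

  bridged : Gap → Matrix (M + M)
  bridged p i k = blockwise i k ∨ (does (i ≟ᶠ row p) ∧ does (k ≟ᶠ col p))

  gap-injective : ∀ {p q} → row p ≡ row q → col p ≡ col q → p ≡ q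
  gap-injective {p} {q} r c = trans (sym (combine-remQuot {M} M p))
    (trans (cong₂ combine (↑ˡ-injective M _ _ r) (↑ʳ-injective M _ _ c)) (combine-remQuot {M} M q))

  half-row : ∀ (i : Fin M) → half (i ↑ˡ M) ≡ true
  half-row i = Equivalence.to T-≡ (<⇒<ᵇ (subst (_< M) (sym (toℕ-↑ˡ i M)) (toℕ<n i)))

  half-col : ∀ (i : Fin M) → half (M ↑ʳ i) ≡ false
  half-col i with half (M ↑ʳ i) in eq
  ... | false = refl
  ... | true  = contradiction (subst (M ≤_) (sym (toℕ-↑ʳ M i)) (m≤m+n M (toℕ i)))
                  (<⇒≱ (<ᵇ⇒< _ M (subst T (sym eq) tt)))

  -- Constant along the edges of `graph blockwise none`, hence on its components. The value on
  -- blocks from 2 on is arbitrary: with `none` as second factor they have no edges to blocks 0 and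
  -- 1.
  colour : ℕ → Fin (M + M) → Bool
  colour 0 i = half i
  colour 1 i = half i
  colour (suc (suc _)) i = false

  link-colour : ∀ a i b k → T (link blockwise none a i b k) → colour a i ≡ colour b k
  link-colour 0 i 1 k l = xnor⁻ (half i) (half k) (subst T (∨-identityʳ _) l)
  link-colour (suc (suc a)) i (suc (suc b)) k l = refl
  link-colour (suc (suc (suc a))) i 0 k l with () ← proj₂ (Equivalence.to (T-∧ {true ∧ (a <ᵇ 1)}) l)
  link-colour (suc (suc (suc a))) i 1 k l with () ← proj₂ (Equivalence.to (T-∧ {true ∧ (a <ᵇ 1)}) l)
  link-colour 1 i 2 k ()

  disconnected : ∀ {S a i b k} → colour (toℕ a) i ≢ colour (toℕ b) k →
    ¬ Connected (graph blockwise none) S (vertex a i) (vertex b k)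
  disconnected {a = a} {i} {b} {k} a≢b path = a≢b
    (subst₂ _≡_ (cong colour′ (coords-vertex a i)) (cong colour′ (coords-vertex b k)) (same-colour path))
    where
    colour′ : Fin K × Fin (M + M) → Bool
    colour′ (a , i) = colour (toℕ a) i
    linked-colour : ∀ c d → T (linked blockwise none c d) → colour′ c ≡ colour′ d
    linked-colour (a , i) (b , k) l with Equivalence.to (T-∨ {link blockwise none (toℕ a) i (toℕ b) k}) l
    ... | inj₁ l = link-colour (toℕ a) i (toℕ b) k l
    ... | inj₂ l = sym (link-colour (toℕ b) k (toℕ a) i l)
    same-colour : ∀ {S u v} → Connected (graph blockwise none) S u v → colour′ (coords u) ≡ colour′ (coords v)
    same-colour done = refl
    same-colour {u = u} (_◅_ {j = v} (_ , _ , l) path) =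
      trans (linked-colour (coords u) (coords v) l) (same-colour path)

  origin : Fin M
  origin = Fin.fromℕ< (>-nonZero⁻¹ M)

  -- A column vertex of the first half and a row vertex of the second: the joining path is source,
  -- `row p`, `col p`, target. Neither endpoint depends on p, so one query serves all gaps.
  source target : Vertex
  source = vertex (suc zero) (origin ↑ˡ M)
  target = vertex zero (M ↑ʳ origin)

  separated : ∀ {S} → ¬ Connected (graph blockwise none) S source target
  separated = disconnected λ eq → case trans (sym (half-row origin)) (trans eq (half-col origin)) of λ ()

  joined : ∀ p S → (∀ v → v ∈ S) → Connected (graph (bridged p) none) S source target
  joined p S on =
    edge′ (within (trans (half-row _) (sym (half-row origin)))) ◅
    edge across ◅
    edge′ (within (trans (half-col origin) (sym (half-col _)))) ◅ done
    where
    G : Graph (K * (M + M))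
    G = graph (bridged p) none
    edge : ∀ {i k} → T (bridged p i k) → InducedAdj G S (vertex zero i) (vertex (suc zero) k)
    edge {i} {k} l = on _ , on _ , subst T (sym (adj-vertex (bridged p) none zero i (suc zero) k))
      (Equivalence.from T-∨ (inj₁ (Equivalence.from (T-∨ {bridged p i k}) (inj₁ l))))
    edge′ : ∀ {i k} → T (bridged p i k) → InducedAdj G S (vertex (suc zero) k) (vertex zero i)
    edge′ {i} {k} l = on _ , on _ , subst T (symm G (vertex zero i) (vertex (suc zero) k)) (proj₂ (proj₂ (edge l)))
    within : ∀ {i k} → half i ≡ half k → T (bridged p i k)
    within {i} {k} eq rewrite eq with half k
    ... | true  = tt
    ... | false = tt
    across : T (bridged p (row p) (col p))
    across = Equivalence.from (T-∨ {blockwise (row p) (col p)})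
      (inj₂ (subst T (sym (cong₂ _∧_ (dec-true (row p ≟ᶠ row p) refl) (dec-true (col p ≟ᶠ col p) refl))) tt))

  cell : Vertex → Vertex → Cell
  cell u v = 2 , toℕ (combine u v)

  -- The adjacency matrix stores an edge twice; bridging gap p changes at most these two cells of
  -- the input.
  forth back : Gap → Cell
  forth p = cell (vertex zero (row p)) (vertex (suc zero) (col p))
  back  p = cell (vertex (suc zero) (col p)) (vertex zero (row p))

  cell-injective : ∀ {u v u′ v′} → cell u v ≡ cell u′ v′ → u ≡ u′ × v ≡ v′
  cell-injective eq = combine-injective _ _ _ _ (toℕ-injective (,-injectiveʳ eq))

  disjoint : ∀ {p q c} → Pair forth back p c → Pair forth back q c → p ≡ q
  disjoint (inj₁ refl) (inj₁ eq) = gap-injective (proj₂ (vertex-injective (proj₁ (cell-injective eq))))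
      (proj₂ (vertex-injective (proj₂ (cell-injective eq))))
  disjoint (inj₂ refl) (inj₂ eq) = gap-injective (proj₂ (vertex-injective (proj₂ (cell-injective eq))))
      (proj₂ (vertex-injective (proj₁ (cell-injective eq))))
  disjoint (inj₁ refl) (inj₂ eq) = case vertex-injectiveˡ (proj₁ (cell-injective eq)) of λ ()
  disjoint (inj₂ refl) (inj₁ eq) = case vertex-injectiveˡ (proj₁ (cell-injective eq)) of λ ()

  link-cong : ∀ {A A′} a i b k → (a ≡ 0 → b ≡ 1 → A i k ≡ A′ i k) →
    link A none a i b k ≡ link A′ none a i b k
  link-cong 0             i 0             k eq = refl
  link-cong 0             i 1             k eq = cong (λ z → z ∨ false) (eq refl refl)
  link-cong 0             i (suc (suc b)) k eq = refl
  link-cong (suc a)       i b             k eq = refl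

  bridged-elsewhere : ∀ p i k → ¬ (i ≡ row p × k ≡ col p) → blockwise i k ≡ bridged p i k
  bridged-elsewhere p i k ¬gap with i ≟ᶠ row p | k ≟ᶠ col p
  ... | yes i≡ | yes k≡ = contradiction (i≡ , k≡) ¬gap
  ... | yes _  | no _   = sym (∨-identityʳ _)
  ... | no _   | _      = sym (∨-identityʳ _)

  same-input : ∀ p Von → AgreeOff (Pair forth back p)
    (graphInput 0 (graph blockwise none) Von) (graphInput 0 (graph (bridged p) none) Von)
  same-input p Von = agree-writeFrom Q 0 0 (n ∷ 0 ∷ []) (agree-writeFrom Q 1 0 (List.map bit (Vec.toList Von))
    (agree-tabulate Q 2 0 _ _ same λ _ _ _ → refl {x = 0}))
    where
    Q : Cell → Set
    Q = Pair forth back p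
    n : ℕ
    n = K * (M + M)
    same-adj : ∀ u v → ¬ Q (cell u v) →
      adj (graph blockwise none) u v ≡ adj (graph (bridged p) none) u v
    same-adj u v ¬q with viewVertex u | viewVertex v
    ... | view a i | view b k = begin
      adj (graph blockwise none) (vertex a i) (vertex b k)    ≡⟨ adj-vertex blockwise none a i b k ⟩
      linked blockwise none (a , i) (b , k)                   ≡⟨ cong₂ _∨_
        (link-cong {blockwise} {bridged p} (toℕ a) i (toℕ b) k λ a≡ b≡ → bridged-elsewhere p i k λ (i≡ , k≡) →
          ¬q (inj₁ (cong₂ cell (cong₂ vertex (toℕ-injective a≡) i≡) (cong₂ vertex (toℕ-injective b≡) k≡))))
        (link-cong {blockwise} {bridged p} (toℕ b) k (toℕ a) i λ b≡ a≡ → bridged-elsewhere p k i λ (k≡ , i≡) →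
          ¬q (inj₂ (cong₂ cell (cong₂ vertex (toℕ-injective a≡) i≡) (cong₂ vertex (toℕ-injective b≡) k≡)))) ⟩
      linked (bridged p) none (a , i) (b , k)                 ≡⟨ adj-vertex (bridged p) none a i b k ⟨
      adj (graph (bridged p) none) (vertex a i) (vertex b k)  ∎
      where open ≡-Reasoning
    same : ∀ (c : Fin (n * n)) → ¬ Q (2 , toℕ c) →
      bit (uncurry (adj (graph blockwise none)) (remQuot n c)) ≡
      bit (uncurry (adj (graph (bridged p) none)) (remQuot n c))
    same c ¬q = cong bit (same-adj _ _ (subst (λ c → ¬ Q (2 , toℕ c)) (sym (combine-remQuot {n} n c)) ¬q))

-- The oracle has to read one cell of every pair of the hidden submatrix, since
-- otherwise it cannot tell the two graphs apart.

module _ {x : ℝ} (O : Oracle 25 x) (M : ℕ) .{{_ : NonZero M}} where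

  open Oracle O
  open Hidden M
  open Blocks 1 {M + M}

  private
    n : ℕ
    n = K * (M + M)

    instance
      n≢0 : NonZero n
      n≢0 = m*n≢0 K (M + M) {{_}} {{>-nonZero (≤-trans (>-nonZero⁻¹ M) (m≤m+n M M))}}

    on : ∀ v → v ∈ switch {n} ⊤ ⊥
    on v = on-stays {n} {⊤} {⊥} (∈⊤ {n} {v}) (∉⊥ {n} {v})

    one≢zero : 1 ≢ 0
    one≢zero ()

    record Session (A : Matrix (M + M)) : Set where
      field
        {t₁ t₂ t₃} : ℕ
        {σ₁ σ₂ σ₃} : Memory
        run₁ : ⟨ preprocess , graphInput 0 (graph A none) ⊤ ⟩⇓[ wordBound k n ] t₁ , σ₁
        run₂ : ⟨ update , updateInput {n} ⊥ σ₁ ⟩⇓[ wordBound k n ] t₂ , σ₂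
        run₃ : ⟨ query , queryInput source target σ₂ ⟩⇓[ wordBound k n ] t₃ , σ₃
        t₁≤  : t₁ ≤ C 0 · n ^ℝ x
        t₂≤  : t₂ ≤ f 0 · n ^ℝ e-update n
        t₃≤  : t₃ ≤ f 0 · n ^ℝ e-query n
        sound : (σ₃ 5 0 ≡ 1 × Connected (graph A none) (switch ⊤ ⊥) source target)
              ⊎ (σ₃ 5 0 ≡ 0 × ¬ Connected (graph A none) (switch ⊤ ⊥) source target)

    session : ∀ A → Session A
    session A = preprocessed (correct n 0 z≤n (graph A none) ⊤ (dense A none))
      where
      answered : ∀ {t₁ t₂ σ₁ σ₂} →
        ⟨ preprocess , graphInput 0 (graph A none) ⊤ ⟩⇓[ wordBound k n ] t₁ , σ₁ → t₁ ≤ C 0 · n ^ℝ x →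
        ⟨ update , updateInput {n} ⊥ σ₁ ⟩⇓[ wordBound k n ] t₂ , σ₂ → t₂ ≤ f 0 · n ^ℝ e-update n →
        (∃₂ λ t₃ σ₃ →
            ⟨ query , queryInput source target σ₂ ⟩⇓[ wordBound k n ] t₃ , σ₃
          × t₃ ≤ f 0 · n ^ℝ e-query n
          × ((σ₃ 5 0 ≡ 1 × Connected (graph A none) (switch ⊤ ⊥) source target)
              ⊎ (σ₃ 5 0 ≡ 0 × ¬ Connected (graph A none) (switch ⊤ ⊥) source target))
          × _) → Session A
      answered run₁ t₁≤ run₂ t₂≤ (_ , _ , run₃ , t₃≤ , sound , _) = record
        { run₁ = run₁ ; run₂ = run₂ ; run₃ = run₃ ; t₁≤ = t₁≤ ; t₂≤ = t₂≤ ; t₃≤ = t₃≤ ; sound = sound }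
      updated : ∀ {t₁ σ₁} →
        ⟨ preprocess , graphInput 0 (graph A none) ⊤ ⟩⇓[ wordBound k n ] t₁ , σ₁ → t₁ ≤ C 0 · n ^ℝ x →
        (∃₂ λ t₂ σ₂ →
            ⟨ update , updateInput {n} ⊥ σ₁ ⟩⇓[ wordBound k n ] t₂ , σ₂
          × t₂ ≤ f 0 · n ^ℝ e-update n
          × (∀ qs → AnswersAll query (wordBound k n) (λ s → s ≤ f 0 · n ^ℝ e-query n)
                      (graph A none) (switch ⊤ ⊥) σ₂ qs)) → Session A
      updated run₁ t₁≤ (_ , _ , run₂ , t₂≤ , answers) =
        answered run₁ t₁≤ run₂ t₂≤ (answers ((source , target) ∷ []) (on source) (on target))
      preprocessed : (∃₂ λ t₁ σ₁ →
            ⟨ preprocess , graphInput 0 (graph A none) ⊤ ⟩⇓[ wordBound k n ] t₁ , σ₁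
          × t₁ ≤ C 0 · n ^ℝ x
          × (∀ (D : Subset n) → ∣ D ∣ ≡ 0 → ∃₂ λ t₂ σ₂ →
            ⟨ update , updateInput D σ₁ ⟩⇓[ wordBound k n ] t₂ , σ₂
          × t₂ ≤ f 0 · n ^ℝ e-update n
          × (∀ qs → AnswersAll query (wordBound k n) (λ s → s ≤ f 0 · n ^ℝ e-query n)
                      (graph A none) (switch ⊤ D) σ₂ qs))) → Session A
      preprocessed (_ , _ , run₁ , t₁≤ , updates) = updated run₁ t₁≤ (updates ⊥ (∣⊥∣≡0 n))

    session-reads : ∀ {A} → Session A → List Cell
    session-reads s = reads run₁ ++ reads run₂ ++ reads run₃
      where open Session s

    length-session-reads : ∀ {A} (s : Session A) → let open Session s in
      length (session-reads s) ≤ programLoads preprocess * t₁ + (programLoads update * t₂ + programLoads query * t₃)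
    length-session-reads s = subst (_≤ _) (sym (trans (length-++ (reads run₁))
        (cong (length (reads run₁) +_) (length-++ (reads run₂)))))
      (+-mono-≤ (length-reads run₁) (+-mono-≤ (length-reads run₂) (length-reads run₃)))
      where open Session s

    same-answer : ∀ p (s : Session blockwise) (s′ : Session (bridged p)) →
      Unread (Pair forth back p) (session-reads s) → Session.σ₃ s 5 0 ≡ Session.σ₃ s′ 5 0
    same-answer p s s′ unread = agree-run Q S.run₃ S′.run₃ (++⁻ʳ (reads S.run₂) (++⁻ʳ (reads S.run₁) unread))
      (agree-writeFrom Q 4 0 (toℕ source ∷ toℕ target ∷ [])
        (agree-run Q S.run₂ S′.run₂ (++⁻ˡ (reads S.run₂) (++⁻ʳ (reads S.run₁) unread))
          (agree-writeFrom Q 3 0 (∣ ⊥ {n} ∣ ∷ List.map toℕ (List.filter (_∈? ⊥ {n}) (List.allFin n)))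
            (agree-run Q S.run₁ S′.run₁ (++⁻ˡ (reads S.run₁) unread) (same-input p ⊤)))))
      -- The answer is in array 5, the cells of the pair are in array 2.
      5 0 λ { (inj₁ ()) ; (inj₂ ()) }
      where
      module S = Session s
      module S′ = Session s′
      Q : Cell → Set
      Q = Pair forth back p

  oracle-reads-hidden :
    ¬ (∀ {t₁ t₂ t₃} → t₁ ≤ C 0 · n ^ℝ x → t₂ ≤ f 0 · n ^ℝ e-update n → t₃ ≤ f 0 · n ^ℝ e-query n →
       programLoads preprocess * t₁ + (programLoads update * t₂ + programLoads query * t₃) < M * M)
  oracle-reads-hidden few = refute (avoided-pair forth back disjoint (session-reads s)
    (≤-<-trans (length-session-reads s) (few (Session.t₁≤ s) (Session.t₂≤ s) (Session.t₃≤ s))))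
    where
    s : Session blockwise
    s = session blockwise
    refute : ¬ (∃[ p ] Unread (Pair forth back p) (session-reads s))
    refute (p , unread) = clash (Session.sound s) (Session.sound s′)
      where
      s′ : Session (bridged p)
      s′ = session (bridged p)
      clash :
        (Session.σ₃ s 5 0 ≡ 1 × Connected (graph blockwise none) (switch ⊤ ⊥) source target) ⊎ (Session.σ₃ s 5 0 ≡ 0 × _) →
        (Session.σ₃ s′ 5 0 ≡ 1 × _) ⊎ (Session.σ₃ s′ 5 0 ≡ 0 × ¬ Connected (graph (bridged p) none)
            (switch ⊤ ⊥) source target) →
        Data.Empty.⊥
      clash (inj₁ (_ , path)) _                    = separated path
      clash (inj₂ _)          (inj₂ (_ , ¬path))   = ¬path (joined p _ on)
      clash (inj₂ (ans , _))  (inj₁ (ans′ , _))    =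
        one≢zero (trans (sym ans′) (trans (sym (same-answer p s s′ unread)) ans))

-- With B = b + 1, the exponent a / B is 2 - 1 / B. If M² ≤ L, then M ^ (2 B) ≤ (C 10 ^ a) ^ B M ^
-- (2 B - 1), and cancelling leaves M ≤ (C 10 ^ a) ^ B.
subquadratic<square : ∀ {n M a b C L} .{{_ : NonZero M}} → n ≡ 10 * M → suc a ≡ 2 * suc b →
  (C * 10 ^ a) ^ suc b < M → Bound n a (suc b) C L → L < M * M
subquadratic<square {n} {M} {a} {b} {C} {L} n≡10M 1+a≡2B D<M bd = ≰⇒> λ M²≤L → <⇒≱ D<M
  (*-cancelʳ-≤ M ((C * 10 ^ a) ^ suc b) (M ^ a) {{m^n≢0 M a}} (begin
    M ^ suc a               ≡⟨ cong (M ^_) 1+a≡2B ⟩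
    M ^ (2 * suc b)         ≡⟨ ^-*-assoc M 2 (suc b) ⟨
    (M * (M * 1)) ^ suc b   ≡⟨ cong (λ m → (M * m) ^ suc b) (*-identityʳ M) ⟩
    (M * M) ^ suc b         ≤⟨ Bound.unbounded (bound-scale 10 n≡10M (bound-weaken M²≤L ≤-refl bd)) ⟩
    (C * 10 ^ a) ^ suc b * M ^ a ∎))
  where
  open ≤-Reasoning
  instance
    n≢0 : NonZero n
    n≢0 = subst NonZero (sym n≡10M) (m*n≢0 10 M)

-- The exponent is 2 - 1 / (b + 1). For update and query it suffices that o(1) is eventually at most
-- 1, which this exponent still dominates.
no-subquadratic-preprocessing : ∀ {x b} → ¬ below x (frac (suc (2 * b)) b) → ¬ Oracle 25 x
no-subquadratic-preprocessing {x} {b} x≤ O =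
  oracle-reads-hidden O M λ t₁≤ t₂≤ t₃≤ →
    subquadratic<square n≡10M (lem b) (s≤s (m≤m+n (D ^ suc b) (N₁ + N₂)))
      (bound-+ (bound-* lp (^ℚ⇒bound (t₁≤ _ x≤)))
        (bound-+ (bound-* lu (linear (t₂≤ _ (proj₂ (proj₂ (update-vanishing _ (frac-positive 0 0)) n N₁≤n)))))
                 (bound-* lq (linear (t₃≤ _ (proj₂ (proj₂ (query-vanishing _ (frac-positive 0 0)) n N₂≤n)))))))
  where
  open Oracle O
  a lp lu lq D N₁ N₂ M n : ℕ
  a  = suc (2 * b)
  lp = programLoads preprocess
  lu = programLoads update
  lq = programLoads query
  D  = 2 * (lp * C 0 + 2 * (lu * f 0 + lq * f 0)) * 10 ^ a
  N₁ = proj₁ (update-vanishing (frac 1 0) (frac-positive 0 0))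
  N₂ = proj₁ (query-vanishing (frac 1 0) (frac-positive 0 0))
  -- Exceeding `D ^ suc b` makes the reads fewer than M²; the other summands put n beyond both
  -- thresholds of the vanishing exponents.
  M  = suc (D ^ suc b + (N₁ + N₂))
  n  = 5 * (M + M)

  lem : ∀ b → suc (suc (2 * b)) ≡ 2 * suc b
  lem = solve-∀

  n≡10M : n ≡ 10 * M
  n≡10M = five-doubles M
    where
    five-doubles : ∀ m → 5 * (m + m) ≡ 10 * m
    five-doubles = solve-∀

  M≤n : M ≤ n
  M≤n = ≤-trans (m≤n*m M 10) (≤-reflexive (sym n≡10M))

  N₁≤n : N₁ ≤ n
  N₁≤n = ≤-trans (m≤n⇒m≤1+n (≤-trans (m≤m+n N₁ N₂) (m≤n+m (N₁ + N₂) (D ^ suc b)))) M≤n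

  N₂≤n : N₂ ≤ n
  N₂≤n = ≤-trans (m≤n⇒m≤1+n (≤-trans (m≤n+m N₂ N₁) (m≤n+m (N₁ + N₂) (D ^ suc b)))) M≤n

  linear : ∀ {F t} → t ≤ F · n ^ℚ frac 1 0 → Bound n a (suc b) F t
  linear p = bound-rescale {a = 1} {b = 1} (≤-trans (≤-reflexive (*-identityˡ (suc b)))
    (≤-trans (s≤s (m≤n*m b 2)) (≤-reflexive (sym (*-identityʳ a))))) (^ℚ⇒bound p)

-- Memory updates

≡ᵇ-refl : ∀ i → (i ≡ᵇ i) ≡ true
≡ᵇ-refl i = Equivalence.to T-≡ (≡⇒≡ᵇ i i refl)

≢⇒≡ᵇ-false : ∀ {i j} → i ≢ j → (i ≡ᵇ j) ≡ false
≢⇒≡ᵇ-false {i} {j} i≢j with i ≡ᵇ j in eq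
... | false = refl
... | true  = contradiction (≡ᵇ⇒≡ i j (subst T (sym eq) tt)) i≢j

update-same : ∀ (σ : Memory) x i v → (σ [ x , i ↦ v ]) x i ≡ v
update-same σ x i v rewrite ≡ᵇ-refl x | ≡ᵇ-refl i = refl

update-array-≢ : ∀ (σ : Memory) {x y} i v {j} → y ≢ x → (σ [ x , i ↦ v ]) y j ≡ σ y j
update-array-≢ σ i v y≢x rewrite ≢⇒≡ᵇ-false y≢x = refl

update-index-≢ : ∀ (σ : Memory) {x i v y j} → j ≢ i → (σ [ x , i ↦ v ]) y j ≡ σ y j
update-index-≢ σ {x} {y = y} j≢i rewrite ≢⇒≡ᵇ-false j≢i with y ≡ᵇ x
... | true  = refl
... | false = refl

update-cong : ∀ x y k {i j v w z z′ : ℕ} → i ≡ j → v ≡ w → z ≡ z′ →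
  (if (y ≡ᵇ x) ∧ (k ≡ᵇ i) then v else z) ≡ (if (y ≡ᵇ x) ∧ (k ≡ᵇ j) then w else z′)
update-cong x y k refl refl refl = refl

update-undo : ∀ (σ : Memory) x i v y k → (σ [ x , i ↦ v ] [ x , i ↦ σ x i ]) y k ≡ σ y k
update-undo σ x i v y k with y ≡ᵇ x in y≡x | k ≡ᵇ i in k≡i
... | false | _     = refl
... | true  | false = refl
... | true  | true  = cong₂ σ (sym (≡ᵇ⇒≡ y x (subst T (sym y≡x) tt))) (sym (≡ᵇ⇒≡ k i (subst T (sym k≡i) tt)))

-- Total correctness with time bounds

record Exec (W : ℕ) (P : Program) (σ : Memory) (T : ℕ) (Post : Memory → Set) : Set where
  constructor exec
  field
    {time}  : ℕ
    {final} : Memory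
    run     : ⟨ P , σ ⟩⇓[ W ] time , final
    time≤   : time ≤ T
    post    : Post final

module _ {W : ℕ} where

  exec-weaken : ∀ {P σ S T Φ Ψ} → S ≤ T → (∀ {τ} → Φ τ → Ψ τ) → Exec W P σ S Φ → Exec W P σ T Ψ
  exec-weaken S≤T Φ⇒Ψ (exec run t≤ post) = exec run (≤-trans t≤ S≤T) (Φ⇒Ψ post)

  exec-seq : ∀ {P Q σ S T Φ Ψ} → Exec W P σ S Φ → (∀ {τ} → Φ τ → Exec W Q τ T Ψ) →
    Exec W (P ⨾ Q) σ (S + T) Ψ
  exec-seq (exec run t≤ post) next with next post
  ... | exec run′ t′≤ post′ = exec (⇓-seq run run′) (+-mono-≤ t≤ t′≤) post′

  exec-store : ∀ {x a b σ} {Φ : Memory → Set} → ⟦ a ⟧ σ < W → ⟦ b ⟧ σ < W →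
    Φ (σ [ x , ⟦ a ⟧ σ ↦ ⟦ b ⟧ σ ]) → Exec W (store x a b) σ 1 Φ
  exec-store a< b< post = exec (⇓-store a< b<) ≤-refl post

  exec-step : ∀ {x a b Q σ T Φ} → ⟦ a ⟧ σ < W → ⟦ b ⟧ σ < W →
    Exec W Q (σ [ x , ⟦ a ⟧ σ ↦ ⟦ b ⟧ σ ]) T Φ → Exec W (store x a b ⨾ Q) σ (suc T) Φ
  exec-step a< b< (exec run t≤ post) = exec (⇓-seq (⇓-store a< b<) run) (s≤s t≤) post

  exec-then : ∀ {g P Q σ T Φ} → ⟦ g ⟧ σ ≢ 0 → Exec W P σ T Φ → Exec W (ifnz g P Q) σ (suc T) Φ
  exec-then g≢0 (exec run t≤ post) = exec (⇓-then g≢0 run) (s≤s t≤) post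

  exec-else : ∀ {g P Q σ T Φ} → ⟦ g ⟧ σ ≡ 0 → Exec W Q σ T Φ → Exec W (ifnz g P Q) σ (suc T) Φ
  exec-else g≡0 (exec run t≤ post) = exec (⇓-else g≡0 run) (s≤s t≤) post

  exec-loop : ∀ {g P σ S T Φ Ψ} → ⟦ g ⟧ σ ≢ 0 → Exec W P σ S Φ →
    (∀ {τ} → Φ τ → Exec W (whilenz g P) τ T Ψ) → Exec W (whilenz g P) σ (suc (S + T)) Ψ
  exec-loop g≢0 (exec run t≤ post) next with next post
  ... | exec run′ t′≤ post′ = exec (⇓-loop g≢0 run run′) (s≤s (+-mono-≤ t≤ t′≤)) post′

-- The memory of the matrix program: array 0 holds N, arrays 1 and 2 the factors,
-- array 3 the product, array 4 a loop counter.  Array 9 + x plays the role of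
-- array x of the oracle.  The stack in arrays 6, 7, 8, whose height is in array 5,
-- records for each store of the oracle the array, the index and the old value.

counter height : Expr
counter = load 4 (lit 0)
height  = load 5 (lit 0)

shift : Expr → Expr
shift (lit k)    = lit k
shift (load x a) = load (9 + x) (shift a)
shift (op o a b) = op o (shift a) (shift b)

logged : ℕ → Expr → Expr → Program
logged x a b =
  store 6 height (lit x) ⨾ (store 7 height a ⨾ (store 8 height (load (9 + x) a) ⨾
  (store 5 (lit 0) (op add (lit 1) height) ⨾ store (9 + x) a b)))

instrument : Program → Program
instrument skip          = skip
instrument (store x a b) = logged x (shift a) (shift b)
instrument (P ⨾ Q)       = instrument P ⨾ instrument Q
instrument (ifnz g P Q)  = ifnz (shift g) (instrument P) (instrument Q)
instrument (whilenz g P) = whilenz (shift g) (instrument P)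

-- Arrays are named by literals only, so the array number on the stack is compared with m - 1, m -
-- 2, ... in turn; the guard vanishes exactly on equality. The final `skip` is never reached, as
-- logged array numbers are below m.
restore : ℕ → Program
restore zero    = skip
restore (suc x) = ifnz (op add (op sub (load 6 height) (lit x)) (op sub (lit x) (load 6 height)))
  (restore x) (store (9 + x) (load 7 height) (load 8 height))

undo : ℕ → Program
undo m = whilenz height (store 5 (lit 0) (op sub height (lit 1)) ⨾ restore m)

StoresBelow : ℕ → Program → Set
StoresBelow m skip          = Unit.⊤
StoresBelow m (store x a b) = x < m
StoresBelow m (P ⨾ Q)       = StoresBelow m P × StoresBelow m Q
StoresBelow m (ifnz g P Q)  = StoresBelow m P × StoresBelow m Q
StoresBelow m (whilenz g P) = StoresBelow m P

storesBelow-mono : ∀ {m n} P → m ≤ n → StoresBelow m P → StoresBelow n P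
storesBelow-mono skip          m≤n b         = tt
storesBelow-mono (store x _ _) m≤n b         = ≤-trans b m≤n
storesBelow-mono (P ⨾ Q)       m≤n (bP , bQ) = storesBelow-mono P m≤n bP , storesBelow-mono Q m≤n bQ
storesBelow-mono (ifnz g P Q)  m≤n (bP , bQ) = storesBelow-mono P m≤n bP , storesBelow-mono Q m≤n bQ
storesBelow-mono (whilenz g P) m≤n b         = storesBelow-mono P m≤n b

arrays : Program → ℕ
arrays skip          = 0
arrays (store x a b) = suc x
arrays (P ⨾ Q)       = arrays P + arrays Q
arrays (ifnz g P Q)  = arrays P + arrays Q
arrays (whilenz g P) = arrays P

storesBelow-arrays : ∀ P → StoresBelow (arrays P) P
storesBelow-arrays skip          = tt
storesBelow-arrays (store x _ _) = ≤-refl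
storesBelow-arrays (P ⨾ Q)       = storesBelow-mono P (m≤m+n _ _) (storesBelow-arrays P) , storesBelow-mono Q
    (m≤n+m _ (arrays P)) (storesBelow-arrays Q)
storesBelow-arrays (ifnz g P Q)  = storesBelow-mono P (m≤m+n _ _) (storesBelow-arrays P) , storesBelow-mono Q
    (m≤n+m _ (arrays P)) (storesBelow-arrays Q)
storesBelow-arrays (whilenz g P) = storesBelow-arrays P

Hosts : Memory → Memory → Set
Hosts σ τ = ∀ x i → τ (9 + x) i ≡ σ x i

Frame : Memory → Memory → Set
Frame φ τ = τ 0 0 ≡ φ 0 0 × (∀ i → τ 3 i ≡ φ 3 i) × τ 4 0 ≡ φ 4 0

⟦shift⟧ : ∀ e {σ τ} → Hosts σ τ → ⟦ shift e ⟧ τ ≡ ⟦ e ⟧ σ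
⟦shift⟧ (lit k)            hosts = refl
⟦shift⟧ (load x a) {σ} {τ} hosts = trans (hosts x (⟦ shift a ⟧ τ)) (cong (σ x) (⟦shift⟧ a hosts))
⟦shift⟧ (op o a b)         hosts = cong₂ ⟦ o ⟧ᵒ (⟦shift⟧ a hosts) (⟦shift⟧ b hosts)

-- Simulation with a log, and its reversal

module Logging (m W : ℕ) (φ σ₀ : Memory) where

  -- Popping the h entries of the stack in τ turns σ back into σ₀.
  data Log (τ : Memory) : ℕ → Memory → Set where
    empty : ∀ {σ} → (∀ x i → σ x i ≡ σ₀ x i) → Log τ 0 σ
    entry : ∀ {h σ} → τ 6 h < m → τ 7 h < W → τ 8 h < W →
      Log τ h (σ [ τ 6 h , τ 7 h ↦ τ 8 h ]) → Log τ (suc h) σ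

  log-cong : ∀ {τ h σ σ′} → (∀ x i → σ x i ≡ σ′ x i) → Log τ h σ → Log τ h σ′
  log-cong eq (empty eq₀)        = empty λ x i → trans (sym (eq x i)) (eq₀ x i)
  log-cong eq (entry x< i< v< l) = entry x< i< v< (log-cong (λ y j → update-cong _ y j refl refl (eq y j)) l)

  log-stack : ∀ {τ τ′ h σ} → (∀ j → j < h → τ 6 j ≡ τ′ 6 j × τ 7 j ≡ τ′ 7 j × τ 8 j ≡ τ′ 8 j) →
    Log τ h σ → Log τ′ h σ
  log-stack same (empty eq) = empty eq
  log-stack {τ} {τ′} {suc h} {σ} same (entry x< i< v< l) with same h ≤-refl
  ... | eq₆ , eq₇ , eq₈ = entry (subst (_< m) eq₆ x<) (subst (_< W) eq₇ i<) (subst (_< W) eq₈ v<)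
    (log-cong (λ y j → cong₂ (λ (xi : ℕ × ℕ) v → (σ [ proj₁ xi , proj₂ xi ↦ v ]) y j) (cong₂ _,_ eq₆ eq₇) eq₈)
      (log-stack (λ j j<h → same j (m<n⇒m<1+n j<h)) l))

  -- `small` is there for the log: the old value of a cell is pushed into array 8, and that store
  -- needs a value below W.
  record State (σ τ : Memory) : Set where
    field
      frame : Frame φ τ
      hosts : Hosts σ τ
      small : ∀ x i → σ x i < W
      log   : Log τ (τ 5 0) σ

  -- The index is evaluated again after pushes have changed arrays 5 to 8, so its value is required
  -- on every memory with the same hosted part and frame. This covers shifted oracle expressions as
  -- well as inputs computed from N and the counter.
  logged-exec : ∀ {σ τ x a b i v} → State σ τ → x < m → m ≤ W → suc (τ 5 0) < W → i < W → v < W →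
    (∀ τ → Hosts σ τ → Frame φ τ → ⟦ a ⟧ τ ≡ i) →
    (∀ τ → Hosts σ τ → Frame φ τ → ⟦ b ⟧ τ ≡ v) →
    Exec W (logged x a b) τ 5 λ τ′ → State (σ [ x , i ↦ v ]) τ′ × τ′ 5 0 ≡ suc (τ 5 0)
  logged-exec {σ} {τ} {x} {a} {b} {i} {v} s x<m m≤W h+1<W i<W v<W ⟦a⟧ ⟦b⟧ =
    exec-step h<W (<-≤-trans x<m m≤W)
    (exec-step h<W (subst (_< W) (sym a₁) i<W)
    (exec-step h<W (subst (_< W) (sym old) (small x i))
    (exec-step (≤-trans (s≤s z≤n) h+1<W) h+1<W
    (exec-store (subst (_< W) (sym a₄) i<W) (subst (_< W) (sym b₄) v<W)
      (record { frame = frame ; hosts = hosts′ ; small = small′ ; log = log′ } , refl)))))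
    where
    open State s
    h : ℕ
    h = τ 5 0
    τ₁ τ₂ τ₃ τ₄ τ₅ : Memory
    τ₁ = τ [ 6 , h ↦ x ]
    τ₂ = τ₁ [ 7 , h ↦ ⟦ a ⟧ τ₁ ]
    τ₃ = τ₂ [ 8 , h ↦ τ₂ (9 + x) (⟦ a ⟧ τ₂) ]
    τ₄ = τ₃ [ 5 , 0 ↦ suc h ]
    τ₅ = τ₄ [ 9 + x , ⟦ a ⟧ τ₄ ↦ ⟦ b ⟧ τ₄ ]
    h<W : h < W
    h<W = ≤-trans (n≤1+n _) h+1<W
    a₁ : ⟦ a ⟧ τ₁ ≡ i
    a₁ = ⟦a⟧ τ₁ hosts frame
    a₄ : ⟦ a ⟧ τ₄ ≡ i
    a₄ = ⟦a⟧ τ₄ hosts frame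
    b₄ : ⟦ b ⟧ τ₄ ≡ v
    b₄ = ⟦b⟧ τ₄ hosts frame
    old : τ (9 + x) (⟦ a ⟧ τ₂) ≡ σ x i
    old = trans (hosts x _) (cong (σ x) (⟦a⟧ τ₂ hosts frame))
    hosts′ : Hosts (σ [ x , i ↦ v ]) τ₅
    hosts′ y j = update-cong x y j a₄ b₄ (hosts y j)
    small′ : ∀ y j → (σ [ x , i ↦ v ]) y j < W
    small′ y j with (y ≡ᵇ x) ∧ (j ≡ᵇ i)
    ... | true  = v<W
    ... | false = small y j
    top₆ : τ₅ 6 h ≡ x
    top₆ = update-same τ 6 h x
    top₇ : τ₅ 7 h ≡ i
    top₇ = trans (update-same τ₁ 7 h _) a₁
    top₈ : τ₅ 8 h ≡ σ x i
    top₈ = trans (update-same τ₂ 8 h _) old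
    log′ : Log τ₅ (suc h) (σ [ x , i ↦ v ])
    log′ = entry (subst (_< m) (sym top₆) x<m) (subst (_< W) (sym top₇) i<W) (subst (_< W) (sym top₈) (small x i))
      (log-cong (λ y j → sym (trans
          (cong₂ (λ (xi : ℕ × ℕ) w → (σ [ x , i ↦ v ] [ proj₁ xi , proj₂ xi ↦ w ]) y j) (cong₂ _,_ top₆ top₇) top₈)
          (update-undo σ x i v y j)))
        (log-stack (λ j j<h → sym (update-index-≢ τ {6} {y = 6} (<⇒≢ j<h)) , sym
            (update-index-≢ τ₁ {7} {y = 7} (<⇒≢ j<h)) , sym (update-index-≢ τ₂ {8} {y = 8} (<⇒≢ j<h))) log))

  module _ (m≤W : m ≤ W) where

    -- A store becomes five, any other step stays one, and the stack grows by at most one entry per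
    -- step; the last hypothesis keeps its height a word. W₀ is the word bound of the oracle, W that
    -- of the simulation.
    instrument-exec : ∀ {W₀ P σ σ′ τ t} → W₀ ≤ W → StoresBelow m P → ⟨ P , σ ⟩⇓[ W₀ ] t , σ′ →
      State σ τ → τ 5 0 + t < W →
      Exec W (instrument P) τ (5 * t) λ τ′ → State σ′ τ′ × τ′ 5 0 ≤ τ 5 0 + t
    instrument-exec {τ = τ} W₀≤W below ⇓-skip s room = exec ⇓-skip (s≤s z≤n) (s , m≤m+n (τ 5 0) 1)
    instrument-exec {σ = σ} {τ = τ} W₀≤W x<m (⇓-store {a = a} {b} a< b<) s room =
      exec-weaken ≤-refl (λ (s′ , h) → s′ , ≤-reflexive (trans h (+-comm 1 (τ 5 0))))
        (logged-exec s x<m m≤W (subst (_< W) (+-comm (τ 5 0) 1) room) (<-≤-trans a< W₀≤W) (<-≤-trans b< W₀≤W)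
          (λ _ hosts _ → ⟦shift⟧ a hosts) (λ _ hosts _ → ⟦shift⟧ b hosts))
    instrument-exec {τ = τ} W₀≤W (P< , Q<) (⇓-seq {s = s₁} {t} p q) s room =
      exec-weaken (≤-reflexive (sym (*-distribˡ-+ 5 s₁ t))) (λ z → z)
        (exec-seq (instrument-exec W₀≤W P< p s (≤-<-trans (+-monoʳ-≤ (τ 5 0) (m≤m+n s₁ t)) room))
          λ (s′ , h≤) → exec-weaken ≤-refl (map₂ λ h≤′ → ≤-trans h≤′ (later h≤))
            (instrument-exec W₀≤W Q< q s′ (≤-<-trans (later h≤) room)))
      where
      later : ∀ {h} → h ≤ τ 5 0 + s₁ → h + t ≤ τ 5 0 + (s₁ + t)
      later h≤ = ≤-trans (+-monoˡ-≤ t h≤) (≤-reflexive (+-assoc (τ 5 0) s₁ t))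
    instrument-exec {τ = τ} W₀≤W (P< , Q<) (⇓-then {g} {t = t} g≢0 p) s room =
      exec-weaken (1+5t t) (map₂ λ h≤ → ≤-trans h≤ (+-monoʳ-≤ (τ 5 0) (n≤1+n t)))
        (exec-then (g≢0 ∘ trans (sym (⟦shift⟧ g (State.hosts s))))
          (instrument-exec W₀≤W P< p s (≤-<-trans (+-monoʳ-≤ (τ 5 0) (n≤1+n t)) room)))
      where
      1+5t : ∀ t → suc (5 * t) ≤ 5 * suc t
      1+5t t = ≤-trans (+-monoˡ-≤ (5 * t) (s≤s (z≤n {4}))) (≤-reflexive (sym (*-suc 5 t)))
    instrument-exec {τ = τ} W₀≤W (P< , Q<) (⇓-else {g} {t = t} g≡0 q) s room =
      exec-weaken (1+5t t) (map₂ λ h≤ → ≤-trans h≤ (+-monoʳ-≤ (τ 5 0) (n≤1+n t)))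
        (exec-else (trans (⟦shift⟧ g (State.hosts s)) g≡0)
          (instrument-exec W₀≤W Q< q s (≤-<-trans (+-monoʳ-≤ (τ 5 0) (n≤1+n t)) room)))
      where
      1+5t : ∀ t → suc (5 * t) ≤ 5 * suc t
      1+5t t = ≤-trans (+-monoˡ-≤ (5 * t) (s≤s (z≤n {4}))) (≤-reflexive (sym (*-suc 5 t)))
    instrument-exec {τ = τ} W₀≤W P< (⇓-done {g} g≡0) s room =
      exec (⇓-done (trans (⟦shift⟧ g (State.hosts s)) g≡0)) (s≤s z≤n) (s , m≤m+n (τ 5 0) 1)
    instrument-exec {τ = τ} W₀≤W P< (⇓-loop {g} {s = s₁} {t} g≢0 p q) s room =
      exec-weaken (≤-trans (s≤s (≤-reflexive (sym (*-distribˡ-+ 5 s₁ t))))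
          (≤-trans (+-monoˡ-≤ (5 * (s₁ + t)) (s≤s (z≤n {4}))) (≤-reflexive (sym (*-suc 5 (s₁ + t)))))) (λ z → z)
        (exec-loop (g≢0 ∘ trans (sym (⟦shift⟧ g (State.hosts s))))
          (instrument-exec W₀≤W P< p s (≤-<-trans (+-monoʳ-≤ (τ 5 0) (≤-trans (m≤m+n s₁ t) (n≤1+n _))) room))
          λ (s′ , h≤) → exec-weaken ≤-refl (map₂ λ h≤′ → ≤-trans h≤′ (later h≤))
            (instrument-exec W₀≤W P< q s′ (≤-<-trans (later h≤) room)))
      where
      later : ∀ {h} → h ≤ τ 5 0 + s₁ → h + t ≤ τ 5 0 + suc (s₁ + t)
      later h≤ = ≤-trans (+-monoˡ-≤ t h≤) (≤-trans (≤-reflexive (+-assoc (τ 5 0) s₁ t)) (+-monoʳ-≤ (τ 5 0) (n≤1+n _)))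

    exec-instrument : ∀ {W₀ P σ τ T Φ} → W₀ ≤ W → StoresBelow m P → Exec W₀ P σ T Φ →
      State σ τ → τ 5 0 + T < W →
      Exec W (instrument P) τ (5 * T) λ τ′ → ∃[ σ′ ] (Φ σ′ × State σ′ τ′ × τ′ 5 0 ≤ τ 5 0 + T)
    exec-instrument {τ = τ} W₀≤W below (exec run t≤T post) s room =
      exec-weaken (*-monoʳ-≤ 5 t≤T) (λ (s′ , h≤) → _ , post , s′ , ≤-trans h≤ (+-monoʳ-≤ (τ 5 0) t≤T))
        (instrument-exec W₀≤W below run s (≤-<-trans (+-monoʳ-≤ (τ 5 0) t≤T) room))

  restore-exec : ∀ {τ} k → τ 6 (τ 5 0) < k → τ 7 (τ 5 0) < W → τ 8 (τ 5 0) < W →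
    Exec W (restore k) τ (suc k) (_≡ τ [ 9 + τ 6 (τ 5 0) , τ 7 (τ 5 0) ↦ τ 8 (τ 5 0) ])
  restore-exec {τ} (suc k) x<1+k i< v< with τ 6 (τ 5 0) ≟ k
  ... | yes x≡k = exec-weaken (s≤s (s≤s z≤n)) (λ z → z)
    (exec-else (cong₂ _+_ (m≤n⇒m∸n≡0 (≤-reflexive x≡k)) (m≤n⇒m∸n≡0 (≤-reflexive (sym x≡k))))
      (exec-store i< v< (cong (λ x → τ [ 9 + x , τ 7 (τ 5 0) ↦ τ 8 (τ 5 0) ]) (sym x≡k))))
  ... | no x≢k = exec-then (λ eq → x≢k (≤-antisym (m∸n≡0⇒m≤n (m+n≡0⇒m≡0 _ eq)) (m∸n≡0⇒m≤n (m+n≡0⇒n≡0 (τ 6 (τ 5 0) ∸ k) eq))))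
    (restore-exec k (≤∧≢⇒< (s≤s⁻¹ x<1+k) x≢k) i< v<)

  -- The height is decremented first, so that it points at the entry to pop. An entry costs a guard,
  -- the decrement and at most m + 1 steps of `restore`; the last guard is the extra step.
  undo-exec : ∀ {h σ τ φ} → τ 5 0 ≡ h → h < W → Frame φ τ → Hosts σ τ → Log τ h σ →
    Exec W (undo m) τ (suc (h * (3 + m))) λ τ′ → Frame φ τ′ × Hosts σ₀ τ′ × τ′ 5 0 ≡ 0
  undo-exec h≡ h<W frame hosts (empty eq) =
    exec (⇓-done h≡) ≤-refl (frame , (λ x i → trans (hosts x i) (eq x i)) , h≡)
  undo-exec {suc h} {σ} {τ} {φ} h≡ h<W frame hosts (entry x< i< v< log) =
    exec-weaken (s≤s (≤-reflexive (+-suc (suc (suc m)) (h * (3 + m))))) (λ z → z)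
      (exec-loop (λ eq → case trans (sym h≡) eq of λ ())
        (exec-step (≤-trans (s≤s z≤n) h<W) (subst (_< W) (sym h′≡) (≤-trans (n≤1+n _) h<W))
          (restore-exec m (subst (λ k → τ 6 k < m) (sym h′≡) x<) (subst (λ k → τ 7 k < W) (sym h′≡) i<)
              (subst (λ k → τ 8 k < W) (sym h′≡) v<)))
        λ { refl → undo-exec {φ = φ} h′≡ (≤-trans (n≤1+n _) h<W) frame hosts′ (log-stack (λ _ _ → refl , refl , refl) log) })
    where
    h′≡ : τ 5 0 ∸ 1 ≡ h
    h′≡ = cong (_∸ 1) h≡
    h′ : ℕ
    h′ = τ 5 0 ∸ 1
    hosts′ : Hosts (σ [ τ 6 h , τ 7 h ↦ τ 8 h ]) (τ [ 5 , 0 ↦ h′ ] [ 9 + τ 6 h′ , τ 7 h′ ↦ τ 8 h′ ])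
    hosts′ y j rewrite h′≡ = update-cong (τ 6 h) y j refl refl (hosts y j)

-- Arithmetic and boolean expressions

-- `1 ∸ k` is the bit of k = 0: `orE` applies it twice to clip a sum to 0 or 1, `ltE` tests that
-- `suc a ∸ b` vanishes, `eqE` that both truncated differences do.
andE orE ltE eqE remE : Expr → Expr → Expr
andE a b = op mul a b
orE  a b = op sub (lit 1) (op sub (lit 1) (op add a b))
ltE  a b = op sub (lit 1) (op sub (op add (lit 1) a) b)
eqE  a b = op sub (lit 1) (op add (op sub a b) (op sub b a))
remE a b = op sub a (op mul (op div a b) b)

bit-∧ : ∀ p q → bit p * bit q ≡ bit (p ∧ q)
bit-∧ true  true  = refl
bit-∧ true  false = refl
bit-∧ false q     = refl

bit-∨ : ∀ p q → 1 ∸ (1 ∸ (bit p + bit q)) ≡ bit (p ∨ q)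
bit-∨ true  true  = refl
bit-∨ true  false = refl
bit-∨ false true  = refl
bit-∨ false false = refl

bit-<ᵇ : ∀ a b → 1 ∸ (suc a ∸ b) ≡ bit (a <ᵇ b)
bit-<ᵇ a       zero    = 0∸n≡0 a
bit-<ᵇ zero    (suc b) = cong (1 ∸_) (0∸n≡0 b)
bit-<ᵇ (suc a) (suc b) = bit-<ᵇ a b

bit-≡ᵇ : ∀ a b → 1 ∸ ((a ∸ b) + (b ∸ a)) ≡ bit (a ≡ᵇ b)
bit-≡ᵇ zero    zero    = refl
bit-≡ᵇ zero    (suc b) = 0∸n≡0 b
bit-≡ᵇ (suc a) zero    = 0∸n≡0 (a + 0)
bit-≡ᵇ (suc a) (suc b) = bit-≡ᵇ a b

module _ {τ : Memory} where

  ⟦andE⟧ : ∀ {a b p q} → ⟦ a ⟧ τ ≡ bit p → ⟦ b ⟧ τ ≡ bit q → ⟦ andE a b ⟧ τ ≡ bit (p ∧ q)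
  ⟦andE⟧ {p = p} {q} eq eq′ = trans (cong₂ _*_ eq eq′) (bit-∧ p q)

  ⟦orE⟧ : ∀ {a b p q} → ⟦ a ⟧ τ ≡ bit p → ⟦ b ⟧ τ ≡ bit q → ⟦ orE a b ⟧ τ ≡ bit (p ∨ q)
  ⟦orE⟧ {p = p} {q} eq eq′ = trans (cong₂ (λ k l → 1 ∸ (1 ∸ (k + l))) eq eq′) (bit-∨ p q)

  ⟦ltE⟧ : ∀ {a b k l} → ⟦ a ⟧ τ ≡ k → ⟦ b ⟧ τ ≡ l → ⟦ ltE a b ⟧ τ ≡ bit (k <ᵇ l)
  ⟦ltE⟧ {k = k} {l} refl refl = bit-<ᵇ k l

  ⟦eqE⟧ : ∀ {a b k l} → ⟦ a ⟧ τ ≡ k → ⟦ b ⟧ τ ≡ l → ⟦ eqE a b ⟧ τ ≡ bit (k ≡ᵇ l)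
  ⟦eqE⟧ {k = k} {l} refl refl = bit-≡ᵇ k l

  ⟦div⟧ : ∀ {a b n u v} → v < n → ⟦ a ⟧ τ ≡ n * u + v → ⟦ b ⟧ τ ≡ n → ⟦ op div a b ⟧ τ ≡ u
  ⟦div⟧ {n = n@(suc _)} {u} {v} v<n eq eq′ = trans (cong₂ ⟦ div ⟧ᵒ eq eq′)
    (trans (+-distrib-/-∣ˡ v (m∣m*n u))
      (trans (cong₂ _+_ (trans (cong (_/ n) (*-comm n u)) (m*n/n≡m u n)) (m<n⇒m/n≡0 v<n)) (+-identityʳ u)))

  ⟦remE⟧ : ∀ {a b n u v} → v < n → ⟦ a ⟧ τ ≡ n * u + v → ⟦ b ⟧ τ ≡ n → ⟦ remE a b ⟧ τ ≡ v
  ⟦remE⟧ {a} {b} {n} {u} {v} v<n eq eq′ = trans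
    (cong₂ _∸_ eq (trans (cong₂ _*_ (⟦div⟧ {a} {b} v<n eq eq′) eq′) (*-comm u n)))
    (m+n∸m≡n (n * u) v)

-- Loops over a counter

advance : Program
advance = store 4 (lit 0) (op add (lit 1) counter)

for : Expr → Program → Program
for bound body = store 4 (lit 0) (lit 0) ⨾ whilenz (op sub bound counter) (body ⨾ advance)

fill : ℕ → Expr → Expr → Program
fill x bound value = for bound (store x counter value)

Same : ℕ → Memory → Memory → Set
Same x φ τ = ∀ y i → y ≢ 4 → y ≢ x → τ y i ≡ φ y i

module _ {W : ℕ} where

  -- A round costs its guard, the body and `advance`; the 2 is the initial store and the last guard.
  -- The bound is evaluated anew in every round, so the invariant has to determine it.
  for-exec : ∀ {bound body T τ m} (I : ℕ → Memory → Set) → m < W →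
    (∀ {c τ} → I c τ → ⟦ bound ⟧ τ ≡ m × τ 4 0 ≡ c) →
    (∀ {c τ} → c < m → I c τ → Exec W body τ T λ τ′ → τ′ 4 0 ≡ c × I (suc c) (τ′ [ 4 , 0 ↦ suc c ])) →
    I 0 (τ [ 4 , 0 ↦ 0 ]) →
    Exec W (for bound body) τ (2 + m * (2 + T)) (I m)
  for-exec {bound} {body} {T} {m = m} I m<W control step I₀ =
    exec-step (≤-trans (s≤s z≤n) m<W) (≤-trans (s≤s z≤n) m<W) (loop m refl I₀)
    where
    loop : ∀ r {c τ} → c + r ≡ m → I c τ →
      Exec W (whilenz (op sub bound counter) (body ⨾ advance)) τ (suc (r * (2 + T))) (I m)
    loop zero {c} {τ} c+0≡m Ic = exec
      (⇓-done (trans (cong₂ _∸_ (proj₁ (control Ic)) (proj₂ (control Ic)))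
        (trans (cong (m ∸_) (trans (sym (+-identityʳ c)) c+0≡m)) (n∸n≡0 m))))
      ≤-refl (subst (λ k → I k τ) (trans (sym (+-identityʳ c)) c+0≡m) Ic)
    loop (suc r) {c} {τ} c+r≡m Ic = exec-weaken (≤-reflexive (time T r)) (λ z → z)
      (exec-loop (λ eq → <⇒≱ c<m (m∸n≡0⇒m≤n (trans (sym (cong₂ _∸_ (proj₁ (control Ic)) (proj₂ (control Ic)))) eq)))
        (exec-seq (step c<m Ic) λ {τ} (c≡ , Ic+1) →
          exec-store (≤-trans (s≤s z≤n) m<W) (subst (λ k → suc k < W) (sym c≡) (≤-<-trans c<m m<W))
            (subst (λ k → I (suc c) (τ [ 4 , 0 ↦ suc k ])) (sym c≡) Ic+1))
        (loop r (trans (sym (+-suc c r)) c+r≡m)))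
      where
      c<m : c < m
      c<m = subst (c <_) c+r≡m (m<m+n c (s≤s z≤n))
      time : ∀ s r → suc (s + 1 + suc (r * (2 + s))) ≡ suc (suc r * (2 + s))
      time s r = cong suc (trans (+-suc (s + 1) (r * (2 + s))) (cong (λ k → suc (k + r * (2 + s))) (+-comm s 1)))

  -- The cells from m on are tracked too, because `Hosts` compares the memories at every address.
  fill-exec : ∀ {x bound value τ m} (f : Fin m → ℕ) → x ≢ 4 → m < W → (∀ p → f p < W) →
    (∀ {τ′} → Same x τ τ′ → ⟦ bound ⟧ τ′ ≡ m) →
    (∀ {τ′} → Same x τ τ′ → ∀ p → τ′ 4 0 ≡ toℕ p → ⟦ value ⟧ τ′ ≡ f p) →
    Exec W (fill x bound value) τ (2 + m * 3) λ τ′ →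
      Same x τ τ′ × (∀ p → τ′ x (toℕ p) ≡ f p) × (∀ i → m ≤ i → τ′ x i ≡ τ x i)
  fill-exec {x} {bound} {value} {τ} {m} f x≢4 m<W f<W ⟦bound⟧ ⟦value⟧ =
    exec-weaken ≤-refl (λ (_ , same , filled , rest) → same , (λ p → filled p (toℕ<n p)) , rest)
      (for-exec I m<W (λ (c≡ , same , _) → ⟦bound⟧ same , c≡) step
        (refl , (λ y i y≢4 _ → update-array-≢ τ 0 0 y≢4) , (λ p ()) , λ i _ → update-array-≢ τ 0 0 x≢4))
    where
    I : ℕ → Memory → Set
    I c τ′ = τ′ 4 0 ≡ c × Same x τ τ′ × (∀ p → toℕ p < c → τ′ x (toℕ p) ≡ f p) × (∀ i → c ≤ i → τ′ x i ≡ τ x i)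
    step : ∀ {c τ′} → c < m → I c τ′ →
      Exec W (store x counter value) τ′ 1 λ τ″ → τ″ 4 0 ≡ c × I (suc c) (τ″ [ 4 , 0 ↦ suc c ])
    step {c} {τ′} c<m (c≡ , same , filled , rest) =
      exec-store (subst (_< W) (sym c≡) (<-trans c<m m<W)) (subst (_< W) (sym v≡) (f<W p))
        (trans (update-array-≢ τ′ (τ′ 4 0) (⟦ value ⟧ τ′) (x≢4 ∘ sym)) c≡ , refl , same′ , filled′ , rest′)
      where
      p : Fin m
      p = fromℕ< c<m
      v≡ : ⟦ value ⟧ τ′ ≡ f p
      v≡ = ⟦value⟧ same p (trans c≡ (sym (toℕ-fromℕ< c<m)))
      τ₁ τ₂ : Memory
      τ₁ = τ′ [ x , τ′ 4 0 ↦ ⟦ value ⟧ τ′ ]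
      τ₂ = τ₁ [ 4 , 0 ↦ suc c ]
      same′ : Same x τ τ₂
      same′ y i y≢4 y≢x = trans (update-array-≢ τ₁ 0 (suc c) y≢4)
        (trans (update-array-≢ τ′ (τ′ 4 0) (⟦ value ⟧ τ′) y≢x) (same y i y≢4 y≢x))
      filled′ : ∀ q → toℕ q < suc c → τ₂ x (toℕ q) ≡ f q
      filled′ q q<1+c with toℕ q ≟ c
      ... | yes q≡c = trans (update-array-≢ τ₁ 0 (suc c) x≢4)
        (trans (cong (τ₁ x) (trans q≡c (sym c≡))) (trans (update-same τ′ x (τ′ 4 0) _)
          (trans v≡ (cong f (toℕ-injective (trans (toℕ-fromℕ< c<m) (sym q≡c)))))))
      ... | no q≢c = trans (update-array-≢ τ₁ 0 (suc c) x≢4)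
        (trans (update-index-≢ τ′ {x} {y = x} (λ q≡ → q≢c (trans q≡ c≡))) (filled q (≤∧≢⇒< (s≤s⁻¹ q<1+c) q≢c)))
      rest′ : ∀ i → suc c ≤ i → τ₂ x i ≡ τ x i
      rest′ i c<i = trans (update-array-≢ τ₁ 0 (suc c) x≢4)
        (trans (update-index-≢ τ′ {x} {y = x} (λ i≡ → <⇒≢ c<i (trans (sym c≡) (sym i≡)))) (rest i (<⇒≤ c<i)))

-- Cells of a list written into an array

writeFrom-array-≢ : ∀ {x y i j} vs (σ : Memory) → y ≢ x → writeFrom x i vs σ y j ≡ σ y j
writeFrom-array-≢ []       σ y≢x = refl
writeFrom-array-≢ {x} {i = i} (v ∷ vs) σ y≢x = trans (writeFrom-array-≢ vs (σ [ x , i ↦ v ]) y≢x) (update-array-≢ σ i v y≢x)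

writeFrom-before : ∀ {x i j} vs (σ : Memory) → j < i → writeFrom x i vs σ x j ≡ σ x j
writeFrom-before []       σ j<i = refl
writeFrom-before {x} {i} (v ∷ vs) σ j<i = trans (writeFrom-before vs (σ [ x , i ↦ v ]) (m<n⇒m<1+n j<i))
    (update-index-≢ σ {x} {y = x} (<⇒≢ j<i))

writeFrom-after : ∀ {x i j} vs (σ : Memory) → i + length vs ≤ j → writeFrom x i vs σ x j ≡ σ x j
writeFrom-after []       σ le = refl
writeFrom-after {x} {i} {j} (v ∷ vs) σ le =
  trans (writeFrom-after vs (σ [ x , i ↦ v ]) le′)
      (update-index-≢ σ {x} {y = x} (λ j≡i → <⇒≢ (≤-trans (m≤m+n (suc i) (length vs)) le′) (sym j≡i)))
  where
  le′ : suc i + length vs ≤ j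
  le′ = subst (_≤ j) (+-suc i (length vs)) le

writeFrom-tabulate : ∀ {x m} i (f : Fin m → ℕ) (σ : Memory) p → writeFrom x i (tabulate f) σ x (i + toℕ p) ≡ f p
writeFrom-tabulate {x} i f σ zero    = trans (cong
    (writeFrom x (suc i) (tabulate (f ∘ suc)) (σ [ x , i ↦ f zero ]) x) (+-identityʳ i))
  (trans (writeFrom-before (tabulate (f ∘ suc)) _ ≤-refl) (update-same σ x i (f zero)))
writeFrom-tabulate {x} i f σ (suc p) = trans (cong
    (writeFrom x (suc i) (tabulate (f ∘ suc)) (σ [ x , i ↦ f zero ]) x) (+-suc i (toℕ p)))
  (writeFrom-tabulate (suc i) (f ∘ suc) _ p)

write-unique : ∀ {x m} (f : Fin m → ℕ) {σ : Memory} {v : ℕ → ℕ} →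
  (∀ p → v (toℕ p) ≡ f p) → (∀ i → m ≤ i → v i ≡ σ x i) → ∀ i → v i ≡ write x (tabulate f) σ x i
write-unique {x} {m} f {σ} {v} filled rest i with i <? m
... | yes i<m = subst (λ j → v j ≡ write x (tabulate f) σ x j) (toℕ-fromℕ< i<m)
  (trans (filled (fromℕ< i<m)) (sym (writeFrom-tabulate 0 f σ (fromℕ< i<m))))
... | no  i≮m = trans (rest i (≮⇒≥ i≮m)) (sym (writeFrom-after (tabulate f) σ
    (subst (_≤ i) (sym (length-tabulate f)) (≮⇒≥ i≮m))))

toList-tabulate : ∀ {m} (g : Fin m → Bool) → List.map bit (Vec.toList (Vec.tabulate g)) ≡ tabulate (bit ∘ g)
toList-tabulate {zero}  g = refl
toList-tabulate {suc m} g = cong (bit (g zero) ∷_) (toList-tabulate (g ∘ suc))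

writeFrom-small : ∀ {W x i} vs {σ : Memory} → All (_< W) vs → (∀ y j → σ y j < W) → ∀ y j → writeFrom x i vs σ y j < W
writeFrom-small []       []           small y j = small y j
writeFrom-small {W} {x} {i} (v ∷ vs) {σ} (v<W ∷ vs<W) small = writeFrom-small vs vs<W small′
  where
  small′ : ∀ y j → (σ [ x , i ↦ v ]) y j < W
  small′ y j with (y ≡ᵇ x) ∧ (j ≡ᵇ i)
  ... | true  = v<W
  ... | false = small y j

bit<2 : ∀ b → bit b < 2
bit<2 b = s≤s (bit≤1 b)

-- Two-element sets as update lists

module _ {A : Set} {Q : A → Set} (Q? : Decidable Q) where

  filter-none : ∀ {n} (f : Fin n → A) → (∀ i → ¬ Q (f i)) → filter Q? (tabulate f) ≡ []
  filter-none {zero}  f none = refl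
  filter-none {suc n} f none = trans (filter-reject Q? (none zero)) (filter-none (f ∘ suc) (none ∘ suc))

  filter-one : ∀ {n} (f : Fin n → A) k → Q (f k) → (∀ i → Q (f i) → i ≡ k) → filter Q? (tabulate f) ≡ f k ∷ []
  filter-one f zero    q only = trans (filter-accept Q? q)
    (cong (f zero ∷_) (filter-none (f ∘ suc) λ i q → case only (suc i) q of λ ()))
  filter-one f (suc k) q only = trans (filter-reject Q? λ q₀ → case only zero q₀ of λ ())
    (filter-one (f ∘ suc) k q λ i q → case only (suc i) q of λ { refl → refl })

  filter-two : ∀ {n} (f : Fin n → A) k l → toℕ k < toℕ l → Q (f k) → Q (f l) →
    (∀ i → Q (f i) → i ≡ k ⊎ i ≡ l) → filter Q? (tabulate f) ≡ f k ∷ f l ∷ []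
  filter-two f zero    (suc l) k<l qk ql only = trans (filter-accept Q? qk)
    (cong (f zero ∷_) (filter-one (f ∘ suc) l ql λ i q → case only (suc i) q of λ { (inj₁ ()) ; (inj₂ refl) → refl }))
  filter-two f (suc k) (suc l) k<l qk ql only = trans (filter-reject Q? λ q₀ → case only zero q₀ of λ { (inj₁ ()) ; (inj₂ ()) })
    (filter-two (f ∘ suc) k l (s≤s⁻¹ k<l) qk ql λ i q → case only (suc i) q of λ { (inj₁ refl) → inj₁ refl ; (inj₂ refl) → inj₂ refl })

∣⁅x⁆∪⁅y⁆∣≡2 : ∀ {n} (x y : Fin n) → toℕ x < toℕ y → ∣ ⁅ x ⁆ ∪ ⁅ y ⁆ ∣ ≡ 2
∣⁅x⁆∪⁅y⁆∣≡2 zero    (suc y) _   = cong suc (trans (cong ∣_∣ (∪-identityˡ ⁅ y ⁆)) (∣⁅x⁆∣≡1 y))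
∣⁅x⁆∪⁅y⁆∣≡2 (suc x) (suc y) x<y = ∣⁅x⁆∪⁅y⁆∣≡2 x y (s≤s⁻¹ x<y)

updateInput-pair : ∀ {n} (x y : Fin n) σ → toℕ x < toℕ y →
  updateInput (⁅ x ⁆ ∪ ⁅ y ⁆) σ ≡ write 3 (2 ∷ toℕ x ∷ toℕ y ∷ []) σ
updateInput-pair x y σ x<y = cong (λ vs → write 3 vs σ) (cong₂ _∷_ (∣⁅x⁆∪⁅y⁆∣≡2 x y x<y)
  (cong (List.map toℕ) (filter-two (_∈? (⁅ x ⁆ ∪ ⁅ y ⁆)) id x y x<y
    (x∈p∪q⁺ (inj₁ (x∈⁅x⁆ x))) (x∈p∪q⁺ {p = ⁅ x ⁆} (inj₂ (x∈⁅x⁆ y)))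
    λ i i∈ → Sum.map (x∈⁅y⁆⇒x≡y x) (x∈⁅y⁆⇒x≡y y) (x∈p∪q⁻ ⁅ x ⁆ ⁅ y ⁆ i∈))))

-- The reduction

module Reduction (P m : ℕ) .{{_ : NonZero P}} (preprocess update query : Program) where

  sizeE orderE : Expr
  sizeE  = load 0 (lit 0)
  orderE = op mul (lit (3 + (P + P))) sizeE

  linkE : (a i b j : Expr) → Expr
  linkE a i b j =
    orE (andE (andE (eqE a (lit 0)) (eqE b (lit 1))) (load 1 (op add (op mul sizeE i) j)))
   (orE (andE (andE (eqE a (lit 1)) (eqE b (lit 2))) (load 2 (op add (op mul sizeE i) j)))
        (andE (andE (ltE (lit 2) a) (ltE a (lit (3 + P)))) (ltE (lit (2 + P)) b)))

  linkedE : (u v : Expr) → Expr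
  linkedE u v = orE
    (linkE (op div u sizeE) (remE u sizeE) (op div v sizeE) (remE v sizeE))
    (linkE (op div v sizeE) (remE v sizeE) (op div u sizeE) (remE u sizeE))

  -- Builds `graphInput 2 G middle` in arrays 9, 10 and 11, the hosted arrays 0, 1 and 2; the
  -- literal 2 stored there is the update size d.
  setup : Program
  setup = store 9 (lit 0) orderE ⨾ (store 9 (lit 1) (lit 2) ⨾
    (fill 10 orderE (eqE (op div counter sizeE) (lit 1)) ⨾
     fill 11 (op mul orderE orderE) (linkedE (op div counter orderE) (remE counter orderE))))

  -- The counter is N i + j; rows are in block 0 and columns in block 2.
  rowE columnE : Expr
  rowE    = op add (op mul sizeE (lit 0)) (op div counter sizeE)
  columnE = op add (op mul sizeE (lit 2)) (remE counter sizeE)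

  -- The update and query inputs are written by logged stores as well, five in all, so that `undo`
  -- reverts them too.
  session : Program
  session =
    logged 3 (lit 0) (lit 2) ⨾ (logged 3 (lit 1) rowE ⨾ (logged 3 (lit 2) columnE ⨾ (instrument update ⨾
    (logged 4 (lit 0) rowE ⨾ (logged 4 (lit 1) columnE ⨾ instrument query)))))

  -- Array 14 hosts the oracle's answer array 5; the answer is copied out before `undo` erases it.
  entry : Program
  entry = session ⨾ (store 3 counter (load 14 (lit 0)) ⨾ undo m)

  -- Resetting the height discards the log of the preprocessing, so each `undo` stops at the
  -- preprocessed memory. Instrumenting the preprocessing serves to relocate its arrays.
  multiply : Program
  multiply = setup ⨾ (instrument preprocess ⨾ (store 5 (lit 0) (lit 0) ⨾ for (op mul sizeE sizeE) entry))

  module _ {N : ℕ} .{{_ : NonZero N}} (A B : Matrix N) where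

    open Blocks P {N}

    n : ℕ
    n = K * N

    G : Graph n
    G = graph A B

    record Factors (τ : Memory) : Set where
      field
        size   : τ 0 0 ≡ N
        left   : ∀ i j → τ 1 (N * toℕ i + toℕ j) ≡ bit (A i j)
        right  : ∀ i j → τ 2 (N * toℕ i + toℕ j) ≡ bit (B i j)

    toℕ-coords : ∀ v → toℕ v ≡ N * toℕ (proj₁ (coords v)) + toℕ (proj₂ (coords v))
    toℕ-coords v = trans (cong toℕ (sym (vertex-coords v))) (toℕ-vertex (proj₁ (coords v)) (proj₂ (coords v)))

    toℕ-remQuot : ∀ {k} l (p : Fin (k * l)) → toℕ p ≡ l * toℕ (proj₁ (remQuot {k} l p)) + toℕ (proj₂ (remQuot {k} l p))
    toℕ-remQuot {k} l p = trans (cong toℕ (sym (combine-remQuot {k} l p)))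
        (toℕ-combine (proj₁ (remQuot {k} l p)) (proj₂ (remQuot {k} l p)))

    module _ {τ : Memory} (factors : Factors τ) where

      open Factors factors

      ⟦orderE⟧ : ⟦ orderE ⟧ τ ≡ n
      ⟦orderE⟧ = cong (K *_) size

      ⟦linkE⟧ : ∀ {aE iE bE jE} a i b j → ⟦ aE ⟧ τ ≡ a → ⟦ iE ⟧ τ ≡ toℕ i → ⟦ bE ⟧ τ ≡ b → ⟦ jE ⟧ τ ≡ toℕ j →
        ⟦ linkE aE iE bE jE ⟧ τ ≡ bit (link A B a i b j)
      ⟦linkE⟧ {aE} {iE} {bE} {jE} a i b j a≡ i≡ b≡ j≡ =
        ⟦orE⟧ {τ} {a = andE (andE (eqE aE (lit 0)) (eqE bE (lit 1))) (load 1 pos)} {b = orE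
            (andE (andE (eqE aE (lit 1)) (eqE bE (lit 2))) (load 2 pos)) pads}
          {p = ((a ≡ᵇ 0) ∧ (b ≡ᵇ 1)) ∧ A i j} {q = ((a ≡ᵇ 1) ∧ (b ≡ᵇ 2)) ∧ B i j ∨ ((2 <ᵇ a) ∧ (a <ᵇ 3 + P)) ∧ (2 + P <ᵇ b)}
          (⟦andE⟧ {τ} {a = andE (eqE aE (lit 0)) (eqE bE (lit 1))} {b = load 1 pos} {p = (a ≡ᵇ 0) ∧ (b ≡ᵇ 1)}
            (⟦andE⟧ {τ} {a = eqE aE (lit 0)} {b = eqE bE (lit 1)} {p = a ≡ᵇ 0}
                (⟦eqE⟧ {τ} {a = aE} {b = lit 0} a≡ refl) (⟦eqE⟧ {τ} {a = bE} {b = lit 1} b≡ refl))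
            (trans (cong (τ 1) pos≡) (left i j)))
          (⟦orE⟧ {τ} {a = andE (andE (eqE aE (lit 1)) (eqE bE (lit 2))) (load 2 pos)} {b = pads} {p =
              ((a ≡ᵇ 1) ∧ (b ≡ᵇ 2)) ∧ B i j}
            (⟦andE⟧ {τ} {a = andE (eqE aE (lit 1)) (eqE bE (lit 2))} {b = load 2 pos} {p = (a ≡ᵇ 1) ∧ (b ≡ᵇ 2)}
              (⟦andE⟧ {τ} {a = eqE aE (lit 1)} {b = eqE bE (lit 2)} {p = a ≡ᵇ 1}
                  (⟦eqE⟧ {τ} {a = aE} {b = lit 1} a≡ refl) (⟦eqE⟧ {τ} {a = bE} {b = lit 2} b≡ refl))
              (trans (cong (τ 2) pos≡) (right i j)))
            (⟦andE⟧ {τ} {a = andE (ltE (lit 2) aE) (ltE aE (lit (3 + P)))} {b = ltE (lit (2 + P)) bE} {p =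
                (2 <ᵇ a) ∧ (a <ᵇ 3 + P)}
              (⟦andE⟧ {τ} {a = ltE (lit 2) aE} {b = ltE aE (lit (3 + P))} {p = 2 <ᵇ a}
                  (⟦ltE⟧ {τ} {a = lit 2} {b = aE} refl a≡) (⟦ltE⟧ {τ} {a = aE} {b = lit (3 + P)} a≡ refl))
              (⟦ltE⟧ {τ} {a = lit (2 + P)} {b = bE} refl b≡)))
        where
        pos pads : Expr
        pos  = op add (op mul sizeE iE) jE
        pads = andE (andE (ltE (lit 2) aE) (ltE aE (lit (3 + P)))) (ltE (lit (2 + P)) bE)
        pos≡ : ⟦ pos ⟧ τ ≡ N * toℕ i + toℕ j
        pos≡ = cong₂ _+_ (cong₂ _*_ size i≡) j≡

      ⟦block⟧ : ∀ uE u → ⟦ uE ⟧ τ ≡ toℕ u → ⟦ op div uE sizeE ⟧ τ ≡ toℕ (proj₁ (coords u))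
      ⟦block⟧ uE u u≡ = ⟦div⟧ {τ} {a = uE} {b = sizeE} (toℕ<n (proj₂ (coords u))) (trans u≡ (toℕ-coords u)) size

      ⟦offset⟧ : ∀ uE u → ⟦ uE ⟧ τ ≡ toℕ u → ⟦ remE uE sizeE ⟧ τ ≡ toℕ (proj₂ (coords u))
      ⟦offset⟧ uE u u≡ = ⟦remE⟧ {τ} {a = uE} {b = sizeE} {u = toℕ (proj₁ (coords u))}
          (toℕ<n (proj₂ (coords u))) (trans u≡ (toℕ-coords u)) size

      ⟦linkedE⟧ : ∀ uE vE u v → ⟦ uE ⟧ τ ≡ toℕ u → ⟦ vE ⟧ τ ≡ toℕ v → ⟦ linkedE uE vE ⟧ τ ≡ bit (adj G u v)
      ⟦linkedE⟧ uE vE u v u≡ v≡ = ⟦orE⟧ {τ} {a = linkE (op div uE sizeE) (remE uE sizeE) (op div vE sizeE) (remE vE sizeE)}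
        {b = linkE (op div vE sizeE) (remE vE sizeE) (op div uE sizeE) (remE uE sizeE)}
        {p = link A B (toℕ (proj₁ (coords u))) (proj₂ (coords u)) (toℕ (proj₁ (coords v))) (proj₂ (coords v))}
        {q = link A B (toℕ (proj₁ (coords v))) (proj₂ (coords v)) (toℕ (proj₁ (coords u))) (proj₂ (coords u))}
        (⟦linkE⟧ {op div uE sizeE} {remE uE sizeE} {op div vE sizeE} {remE vE sizeE} _ _ _ _
            (⟦block⟧ uE u u≡) (⟦offset⟧ uE u u≡) (⟦block⟧ vE v v≡) (⟦offset⟧ vE v v≡))
        (⟦linkE⟧ {op div vE sizeE} {remE vE sizeE} {op div uE sizeE} {remE uE sizeE} _ _ _ _
            (⟦block⟧ vE v v≡) (⟦offset⟧ vE v v≡) (⟦block⟧ uE u u≡) (⟦offset⟧ uE u u≡))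

    private
      τ₀ : Memory
      τ₀ = matrixInput A B

    matrixInput-left : ∀ i j → τ₀ 1 (N * toℕ i + toℕ j) ≡ bit (A i j)
    matrixInput-left i j = trans (cong (write 1 (rowMajor A) (write 2 (rowMajor B) blank) 1) (sym (toℕ-combine i j)))
      (trans (writeFrom-tabulate {1} 0 _ (write 2 (rowMajor B) blank) (combine i j))
          (cong (bit ∘ uncurry A) (remQuot-combine i j)))

    matrixInput-right : ∀ i j → τ₀ 2 (N * toℕ i + toℕ j) ≡ bit (B i j)
    matrixInput-right i j = trans (writeFrom-array-≢ (rowMajor A) (write 2 (rowMajor B) blank) λ ())
      (trans (cong (write 2 (rowMajor B) blank 2) (sym (toℕ-combine i j)))
        (trans (writeFrom-tabulate {2} 0 _ blank (combine i j)) (cong (bit ∘ uncurry B) (remQuot-combine i j))))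

    matrixInput-blank : ∀ y i → τ₀ (3 + y) i ≡ 0
    matrixInput-blank y i = trans (writeFrom-array-≢ (rowMajor A) (write 2 (rowMajor B) blank) λ ())
      (writeFrom-array-≢ (rowMajor B) blank λ ())

    input : Memory
    input = graphInput 2 G middle

    module _ {W : ℕ} (n²<W : n * n < W) (2<W : 2 < W) where

      n<W : n < W
      n<W = ≤-<-trans (m≤m*n n n {{m*n≢0 K N}}) n²<W

      input-small : ∀ x i → input x i < W
      input-small = writeFrom-small (n ∷ 2 ∷ []) (n<W ∷ 2<W ∷ [])
        (writeFrom-small (List.map bit (Vec.toList middle))
            (subst (All (_< W)) (sym (toList-tabulate _))
            (tabulate⁺ λ v → <-trans (bit<2 (toℕ (proj₁ (coords v)) ≡ᵇ 1)) 2<W))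
          (writeFrom-small (rowMajor (adj G)) (tabulate⁺ λ p → <-trans
              (bit<2 (uncurry (adj G) (remQuot n p))) 2<W) λ _ _ → ≤-trans (s≤s z≤n) 2<W))

      setup-exec : Exec W setup τ₀ (2 + ((2 + n * 3) + (2 + n * n * 3)))
        λ τ → Factors τ × Hosts input τ × τ 5 0 ≡ 0
      setup-exec =
        exec-step (≤-trans (s≤s z≤n) 2<W) n<W (exec-step (≤-trans (s≤s (s≤s z≤n)) 2<W) 2<W
        (exec-seq
          (fill-exec onBit (λ ()) n<W (λ v → <-trans (bit<2 (toℕ (proj₁ (coords v)) ≡ᵇ 1)) 2<W)
            (λ same → ⟦orderE⟧ (start same))
            (λ {τ} same v c≡ → ⟦eqE⟧ {τ} {op div counter sizeE} {lit 1} (⟦block⟧ (start same) counter v c≡) refl))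
          λ {τ₂} (same₂ , filled₂ , rest₂) →
        exec-weaken ≤-refl (λ {τ₃} (same₃ , filled₃ , rest₃) →
            carry same₂ same₃
          , hosts same₂ filled₂ rest₂ same₃ filled₃ rest₃
          , trans (same₃ 5 0 (λ ()) (λ ())) (trans (same₂ 5 0 (λ ()) (λ ())) (matrixInput-blank 2 0)))
        (fill-exec adjBit (λ ()) n²<W (λ p → <-trans (bit<2 (uncurry (adj G) (remQuot n p))) 2<W)
          (λ same → cong₂ _*_ (⟦orderE⟧ (carry same₂ same)) (⟦orderE⟧ (carry same₂ same)))
          (λ {τ} same p c≡ → ⟦linkedE⟧ (carry same₂ same) (op div counter orderE) (remE counter orderE) _ _
            (⟦div⟧ {τ} {counter} {orderE} (toℕ<n (proj₂ (remQuot {n} n p))) (trans c≡ (toℕ-remQuot {n} n p))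
                (⟦orderE⟧ (carry same₂ same)))
            (⟦remE⟧ {τ} {counter} {orderE} {u = toℕ (proj₁ (remQuot {n} n p))}
                (toℕ<n (proj₂ (remQuot {n} n p))) (trans c≡ (toℕ-remQuot {n} n p))
                (⟦orderE⟧ (carry same₂ same)))))))
        where
        onBit : Vertex → ℕ
        onBit v = bit (toℕ (proj₁ (coords v)) ≡ᵇ 1)
        adjBit : Fin (n * n) → ℕ
        adjBit p = bit (uncurry (adj G) (remQuot n p))
        τ₁ : Memory
        τ₁ = τ₀ [ 9 , 0 ↦ n ] [ 9 , 1 ↦ 2 ]
        start : ∀ {τ} → Same 10 τ₁ τ → Factors τ
        start same = record
          { size  = same 0 0 (λ ()) (λ ())
          ; left  = λ i j → trans (same 1 _ (λ ()) (λ ())) (matrixInput-left i j)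
          ; right = λ i j → trans (same 2 _ (λ ()) (λ ())) (matrixInput-right i j) }
        carry : ∀ {τ₂ τ} → Same 10 τ₁ τ₂ → Same 11 τ₂ τ → Factors τ
        carry same₂ same = record
          { size  = trans (same 0 0 (λ ()) (λ ())) (Factors.size (start same₂))
          ; left  = λ i j → trans (same 1 _ (λ ()) (λ ())) (Factors.left (start same₂) i j)
          ; right = λ i j → trans (same 2 _ (λ ()) (λ ())) (Factors.right (start same₂) i j) }
        hosts : ∀ {τ₂ τ₃} →
          Same 10 τ₁ τ₂ → (∀ v → τ₂ 10 (toℕ v) ≡ onBit v) → (∀ i → n ≤ i → τ₂ 10 i ≡ τ₁ 10 i) →
          Same 11 τ₂ τ₃ → (∀ p → τ₃ 11 (toℕ p) ≡ adjBit p) → (∀ i → n * n ≤ i → τ₃ 11 i ≡ τ₂ 11 i) →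
          Hosts input τ₃
        hosts same₂ _ _ same₃ _ _ 0 i = trans (same₃ 9 i (λ ()) (λ ())) (trans (same₂ 9 i (λ ()) (λ ()))
          (update-cong 0 0 i {i = 1} refl refl (update-cong 0 0 i {i = 0} refl refl
            (trans (matrixInput-blank 6 i)
              (sym (trans (writeFrom-array-≢ (List.map bit (Vec.toList middle))
                  (write 2 (rowMajor (adj G)) blank) λ ())
                  (writeFrom-array-≢ (rowMajor (adj G)) blank λ ())))))))
        hosts {τ₂} {τ₃} same₂ filled₂ rest₂ same₃ _ _ 1 i = trans
          (write-unique {1} onBit {write 2 (rowMajor (adj G)) blank} {τ₃ 10}
            (λ v → trans (same₃ 10 _ (λ ()) (λ ())) (filled₂ v))
            (λ j n≤j → trans (same₃ 10 j (λ ()) (λ ()))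
                (trans (rest₂ j n≤j) (trans (matrixInput-blank 7 j)
                (sym (writeFrom-array-≢ (rowMajor (adj G)) blank λ ()))))) i)
          (sym (cong (λ vs → write 1 vs (write 2 (rowMajor (adj G)) blank) 1 i)
              (toList-tabulate (λ v → toℕ (proj₁ (coords v)) ≡ᵇ 1))))
        hosts {τ₂} {τ₃} same₂ _ _ same₃ filled₃ rest₃ 2 i = trans
          (write-unique {2} adjBit {blank} {τ₃ 11} filled₃
            (λ j n²≤j → trans (rest₃ j n²≤j) (trans (same₂ 11 j (λ ()) (λ ())) (matrixInput-blank 8 j))) i)
          (sym (writeFrom-array-≢ (List.map bit (Vec.toList middle)) (write 2 (rowMajor (adj G)) blank) λ ()))
        hosts same₂ _ _ same₃ _ _ (suc (suc (suc x))) i = trans (same₃ (12 + x) i (λ ()) (λ ()))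
            (trans (same₂ (12 + x) i (λ ()) (λ ()))
          (trans (matrixInput-blank (9 + x) i)
            (sym (trans (writeFrom-array-≢ (List.map bit (Vec.toList middle))
                (write 2 (rowMajor (adj G)) blank) λ ()) (writeFrom-array-≢ (rowMajor (adj G)) blank λ ())))))

      module _ {W₀ Tp Tu Tq : ℕ} (W₀≤W : W₀ ≤ W) (m≤W : m ≤ W) (Tp<W : Tp < W) (room : 5 + Tu + Tq < W)
               (preprocess< : StoresBelow m preprocess) (update< : StoresBelow m update) (query< : StoresBelow m query)
               (3<m : 3 < m) (4<m : 4 < m) where

        -- All entries start from the same preprocessed σ; the nested `Exec` chains the query to the
        -- memory that the update leaves.
        Answers : Memory → Set
        Answers σ = ∀ i j → Exec W₀ update (updateInput (endpoints i j) σ) Tu λ σ₂ →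
          Exec W₀ query (queryInput (vertex zero i) (vertex (suc (suc zero)) j) σ₂) Tq λ σ₃ →
          σ₃ 5 0 ≡ bit ((A ⊗ B) i j)

        sessionTime entryTime : ℕ
        sessionTime = 5 + (5 + (5 + (5 * Tu + (5 + (5 + 5 * Tq)))))
        entryTime   = sessionTime + suc (suc ((5 + Tu + Tq) * (3 + m)))

        session-exec : ∀ {σ₁ τ} i j → Answers σ₁ → Logging.State m W τ σ₁ σ₁ τ → τ 5 0 ≡ 0 →
          τ 0 0 ≡ N → τ 4 0 ≡ N * toℕ i + toℕ j →
          Exec W session τ sessionTime λ τ′ →
            ∃[ σ₃ ] (σ₃ 5 0 ≡ bit ((A ⊗ B) i j) × Logging.State m W τ σ₁ σ₃ τ′ × τ′ 5 0 ≤ 5 + Tu + Tq)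
        session-exec {σ₁} {τ} i j answers s₀ h₀≡0 size c≡ =
          exec-seq (log 3 0 2 3<m s₀ (fits 0 (s≤s z≤n) (≤-reflexive h₀≡0)) 0<W 2<W (λ _ _ _ → refl)
              (λ _ _ _ → refl)) λ (s₁ , h₁) →
          exec-seq (log 3 1 x 3<m s₁ (fits 1 (s≤s (s≤s z≤n)) (≤-reflexive (step h₁ h₀≡0))) 1<W x<W
              (λ _ _ _ → refl) (λ τ″ _ → ⟦rowE⟧ τ″)) λ (s₂ , h₂) →
          exec-seq (log 3 2 z 3<m s₂ (fits 2 (s≤s (s≤s (s≤s z≤n)))
              (≤-reflexive (step h₂ (step h₁ h₀≡0)))) 2<W z<W (λ _ _ _ → refl) (λ τ″ _ → ⟦columnE⟧ τ″)) λ
              (s₃ , h₃) →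
          let h₃≡3 = step h₃ (step h₂ (step h₁ h₀≡0)) in
          exec-seq (exec-instrument m≤W W₀≤W update<
              (subst (λ σ → Exec W₀ update σ Tu _) (updateInput-pair _ _ σ₁ (row<column i j)) (answers i j)) s₃
            (≤-<-trans (≤-trans (+-monoˡ-≤ Tu (≤-reflexive h₃≡3))
                (≤-trans (m≤n+m (3 + Tu) 2) (m≤m+n (5 + Tu) Tq))) room)) λ { {τ₄} (σ₂ , ask , s₄ , h₄) →
          let h₄≤ = ≤-trans h₄ (+-monoˡ-≤ Tu (≤-reflexive h₃≡3)) in
          exec-seq (log 4 0 x 4<m s₄ (fits (3 + Tu) (m≤n⇒m≤1+n (m≤m+n (4 + Tu) Tq)) h₄≤) 0<W x<W
              (λ _ _ _ → refl) (λ τ″ _ → ⟦rowE⟧ τ″)) λ (s₅ , h₅) →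
          exec-seq (log 4 1 z 4<m s₅ (fits (4 + Tu) (m≤m+n (5 + Tu) Tq)
              (≤-trans (≤-reflexive h₅) (s≤s h₄≤))) 1<W z<W (λ _ _ _ → refl) (λ τ″ _ → ⟦columnE⟧ τ″)) λ
              (s₆ , h₆) →
          let h₆≤ = ≤-trans (≤-reflexive h₆) (s≤s (≤-trans (≤-reflexive h₅) (s≤s h₄≤))) in
          exec-weaken ≤-refl (λ (σ₃ , answer , s₇ , h₇) → σ₃ , answer , s₇ , ≤-trans h₇ (+-monoˡ-≤ Tq h₆≤))
            (exec-instrument m≤W W₀≤W query< ask s₆ (≤-<-trans (+-monoˡ-≤ Tq h₆≤) room)) }
          where
          open Logging m W τ σ₁
          x z : ℕ
          x = toℕ (vertex zero i)
          z = toℕ (vertex (suc (suc zero)) j)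
          0<W : 0 < W
          0<W = ≤-trans (s≤s z≤n) 2<W
          1<W : 1 < W
          1<W = ≤-trans (s≤s (s≤s z≤n)) 2<W
          x<W : x < W
          x<W = <-trans (toℕ<n (vertex zero i)) n<W
          z<W : z < W
          z<W = <-trans (toℕ<n (vertex (suc (suc zero)) j)) n<W
          ⟦rowE⟧ : ∀ τ′ → Frame τ τ′ → ⟦ rowE ⟧ τ′ ≡ x
          ⟦rowE⟧ τ′ (f₀ , _ , f₄) = trans (cong₂ _+_ (cong (_* 0) (trans f₀ size))
              (⟦div⟧ {τ′} {counter} {sizeE} (toℕ<n j) (trans f₄ c≡) (trans f₀ size)))
            (sym (toℕ-vertex zero i))
          ⟦columnE⟧ : ∀ τ′ → Frame τ τ′ → ⟦ columnE ⟧ τ′ ≡ z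
          ⟦columnE⟧ τ′ (f₀ , _ , f₄) = trans (cong₂ _+_ (cong (_* 2) (trans f₀ size))
              (⟦remE⟧ {τ′} {counter} {sizeE} {u = toℕ i} (toℕ<n j) (trans f₄ c≡) (trans f₀ size)))
            (sym (toℕ-vertex (suc (suc zero)) j))
          log : ∀ {σ τ′} y k v {a b} → y < m → State σ τ′ → suc (τ′ 5 0) < W → k < W → v < W →
            (∀ τ″ → Hosts σ τ″ → Frame τ τ″ → ⟦ a ⟧ τ″ ≡ k) → (∀ τ″ → Hosts σ τ″ → Frame τ τ″ → ⟦ b ⟧ τ″ ≡ v) →
            Exec W (logged y a b) τ′ 5 λ τ″ → State (σ [ y , k ↦ v ]) τ″ × τ″ 5 0 ≡ suc (τ′ 5 0)
          log y k v y<m s h<W k<W v<W = logged-exec s y<m m≤W h<W k<W v<W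
          step : ∀ {a b c} → a ≡ suc b → b ≡ c → a ≡ suc c
          step a≡ b≡ = trans a≡ (cong suc b≡)
          fits : ∀ {h} k → k < 5 + Tu + Tq → h ≤ k → suc h < W
          fits k k< h≤k = ≤-<-trans (≤-trans (s≤s h≤k) k<) room

        entry-exec : ∀ {σ₁ τ} i j → Answers σ₁ → Logging.State m W τ σ₁ σ₁ τ → τ 5 0 ≡ 0 →
          τ 0 0 ≡ N → τ 4 0 ≡ N * toℕ i + toℕ j → τ 4 0 < W →
          Exec W entry τ entryTime λ τ′ →
            Frame (τ [ 3 , τ 4 0 ↦ bit ((A ⊗ B) i j) ]) τ′ × Hosts σ₁ τ′ × τ′ 5 0 ≡ 0
        entry-exec {σ₁} {τ} i j answers s₀ h₀≡0 size c≡ c<W =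
          exec-seq (session-exec i j answers s₀ h₀≡0 size c≡) λ { {τ₁} (σ₃ , answer , s , h≤) →
          let open Logging m W τ σ₁
              (f₀ , f₃ , f₄) = State.frame s
              value≡ : τ₁ 14 0 ≡ bit ((A ⊗ B) i j)
              value≡ = trans (State.hosts s 5 0) answer
          in
          exec-step (subst (_< W) (sym f₄) c<W) (subst (_< W) (sym value≡) (<-trans (bit<2 ((A ⊗ B) i j)) 2<W))
          (exec-weaken (s≤s (*-monoˡ-≤ (3 + m) h≤)) (λ z → z)
            -- The saved answer has changed array 3, so undoing is framed by the memory containing
            -- it; arrays 5 to 8 are untouched and the log carries over.
            (undo-exec {φ = τ [ 3 , τ 4 0 ↦ bit ((A ⊗ B) i j) ]} refl (≤-<-trans h≤ room)
              (f₀ , (λ k → update-cong 3 3 k {i = τ₁ 4 0} f₄ value≡ (f₃ k)) , f₄)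
              (State.hosts s) (log-stack (λ _ _ → refl , refl , refl) (State.log s)))) }

        multiplyTime : ℕ
        multiplyTime = 2 + ((2 + n * 3) + (2 + n * n * 3)) + (5 * Tp + suc (2 + N * N * (2 + entryTime)))

        multiply-exec : Exec W₀ preprocess input Tp Answers →
          Exec W multiply τ₀ multiplyTime λ τ → ∀ i j → τ 3 (toℕ i * N + toℕ j) ≡ bit ((A ⊗ B) i j)
        multiply-exec pre =
          exec-seq setup-exec λ { {τ₁} (factors , hosts₁ , h≡0) →
          exec-seq (Logging.exec-instrument m W τ₁ input m≤W W₀≤W preprocess< pre
              (initial hosts₁ input-small h≡0) (subst (λ h → h + Tp < W) (sym h≡0) Tp<W))
            λ { {τ₂} (σ₁ , answers , s , _) →
          let module S = Logging.State s
          in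
          exec-step (≤-trans (s≤s z≤n) 2<W) (≤-trans (s≤s z≤n) 2<W)
          (exec-weaken ≤-refl (λ {τ} → entries {σ₁} {τ})
            (for-exec (I σ₁) N²<W (λ (size , c≡ , _) → cong₂ _*_ size size , c≡)
              (λ {c} {τ} → iteration {σ₁} {c} {τ} answers S.small)
              (trans (proj₁ S.frame) (Factors.size factors) , refl , refl , S.hosts , λ _ ()))) } }
          where
          initial : ∀ {σ τ} → Hosts σ τ → (∀ x i → σ x i < W) → τ 5 0 ≡ 0 → Logging.State m W τ σ σ τ
          initial {σ} {τ} hosts small h≡0 = record
            { frame = refl , (λ _ → refl) , refl
            ; hosts = hosts
            ; small = small
            ; log   = subst (λ h → Logging.Log m W τ σ τ h σ) (sym h≡0) (Logging.empty λ _ _ → refl) }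
          product : Fin (N * N) → ℕ
          product p = bit (uncurry (A ⊗ B) (remQuot N p))
          -- Between entries the stack is empty and the hosted memory is again σ₁, so each entry can
          -- restart the log from there.
          I : Memory → ℕ → Memory → Set
          I σ₁ c τ = τ 0 0 ≡ N × τ 4 0 ≡ c × τ 5 0 ≡ 0 × Hosts σ₁ τ × (∀ q → toℕ q < c → τ 3 (toℕ q) ≡ product q)
          N²<W : N * N < W
          N²<W = ≤-<-trans (*-mono-≤ (m≤n*m N K) (m≤n*m N K)) n²<W
          iteration : ∀ {σ₁ c τ} → Answers σ₁ → (∀ x i → σ₁ x i < W) → c < N * N → I σ₁ c τ →
            Exec W entry τ entryTime λ τ′ → τ′ 4 0 ≡ c × I σ₁ (suc c) (τ′ [ 4 , 0 ↦ suc c ])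
          iteration {σ₁} {c} {τ} answers small c<N² (size , c≡ , h≡0 , hosts , written) =
            exec-weaken ≤-refl (λ { {τ′} ((f₀ , f₃ , f₄) , hosts′ , h′≡0) →
                trans f₄ c≡ , trans f₀ size , refl , h′≡0 , hosts′ , λ q q<1+c → trans (f₃ (toℕ q)) (written′ q q<1+c) })
              (entry-exec _ _ answers (initial hosts small h≡0) h≡0 size (trans c≡p (toℕ-remQuot {N} N p))
                  (subst (_< W) (sym c≡) (<-trans c<N² N²<W)))
            where
            p : Fin (N * N)
            p = fromℕ< c<N²
            c≡p : τ 4 0 ≡ toℕ p
            c≡p = trans c≡ (sym (toℕ-fromℕ< c<N²))
            written′ : ∀ q → toℕ q < suc c → (τ [ 3 , τ 4 0 ↦ product p ]) 3 (toℕ q) ≡ product q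
            written′ q q<1+c with toℕ q ≟ c
            ... | yes q≡c = trans (cong ((τ [ 3 , τ 4 0 ↦ product p ]) 3) (trans q≡c (sym c≡)))
              (trans (update-same τ 3 (τ 4 0) (product p))
                  (cong product (toℕ-injective (trans (toℕ-fromℕ< c<N²) (sym q≡c)))))
            ... | no q≢c = trans (update-index-≢ τ {3} {y = 3} (λ q≡ → q≢c (trans q≡ c≡)))
                (written q (≤∧≢⇒< (s≤s⁻¹ q<1+c) q≢c))
          entries : ∀ {σ₁ τ} → I σ₁ (N * N) τ → ∀ i j → τ 3 (toℕ i * N + toℕ j) ≡ bit ((A ⊗ B) i j)
          entries {τ = τ} (_ , _ , _ , _ , written) i j = trans
            (cong (τ 3) (trans (cong (_+ toℕ j) (*-comm (toℕ i) N)) (sym (toℕ-combine i j))))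
            (trans (written (combine i j) (toℕ<n (combine i j))) (cong (bit ∘ uncurry (A ⊗ B)) (remQuot-combine i j)))

-- Polynomial bounds on words

-- The base is at least 2 for every N, so a constant c is absorbed by c < 2 ^ c, and the factor 2 of
-- a sum by one more power.
record Poly (N k m : ℕ) : Set where
  constructor poly
  field unpoly : m ≤ (2 + N) ^ k

open Poly

module _ {N : ℕ} where

  poly-≤ : ∀ {k l m n} → k ≤ l → n ≤ m → Poly N k m → Poly N l n
  poly-≤ k≤l n≤m (poly p) = poly (≤-trans n≤m (≤-trans p (^-monoʳ-≤ (2 + N) k≤l)))

  poly-const : ∀ c → Poly N c (suc c)
  poly-const c = poly (≤-trans (n<2^n c) (^-monoˡ-≤ c (s≤s (s≤s z≤n))))

  poly-const-≤ : ∀ c → Poly N c c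
  poly-const-≤ c = poly-≤ ≤-refl (n≤1+n c) (poly-const c)

  poly-+ : ∀ {k l m n} → Poly N k m → Poly N l n → Poly N (suc (k + l)) (m + n)
  poly-+ {k} {l} {m} {n} p q = poly (begin
    m + n                  ≤⟨ +-mono-≤ (unpoly (poly-≤ (m≤m+n k l) ≤-refl p)) (unpoly (poly-≤ (m≤n+m l k) ≤-refl q)) ⟩
    X + X                  ≡⟨ cong (X +_) (+-identityʳ X) ⟨
    2 * X                  ≤⟨ *-monoˡ-≤ X {2} {2 + N} (s≤s (s≤s z≤n)) ⟩
    (2 + N) * X            ∎)
    where
    open ≤-Reasoning
    X : ℕ
    X = (2 + N) ^ (k + l)

  poly-* : ∀ {k l m n} → Poly N k m → Poly N l n → Poly N (k + l) (m * n)
  poly-* {k} {l} (poly p) (poly q) = poly (≤-trans (*-mono-≤ p q) (≤-reflexive (sym (^-distribˡ-+-* (2 + N) k l))))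

  poly-^ : ∀ {k m} j → Poly N k m → Poly N (k * j) (m ^ j)
  poly-^ {k} j (poly p) = poly (≤-trans (^-monoˡ-≤ j p) (≤-reflexive (^-*-assoc (2 + N) k j)))

  poly-N : Poly N 1 N
  poly-N = poly (≤-trans (m≤n+m N 2) (≤-reflexive (sym (*-identityʳ (2 + N)))))

-- From preprocessing in time O(n ^ u), u > 2, to multiplication in time O(n ^ u)

module FastMultiplication
  {x : ℝ} (O : Oracle 25 x) (b d P : ℕ) .{{_ : NonZero P}}
  (x≤ : ¬ below x (frac (suc d + suc b * 2) b))
  -- The preprocessing exponent is 2 + (d + 1) / (b + 1): the N² entries use up the 2, and the rest
  -- is left for each update or query. P also acts as the threshold for o(1), since n ≥ P for every
  -- N ≥ 1.
  (update-fast : ∀ n → P ≤ n → ¬ below (Oracle.e-update O n) (frac (suc d) b))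
  (query-fast : ∀ n → P ≤ n → ¬ below (Oracle.e-query O n) (frac (suc d) b))
  where

  open Oracle O

  e m K : ℕ
  e = suc d + suc b * 2
  -- `session` itself stores into the hosted arrays 3 and 4, hence the 5; the sum bounds the arrays
  -- of all three programs.
  m = 5 + (arrays preprocess + (arrays update + arrays query))
  K = 3 + (P + P)

  open Reduction P m preprocess update query hiding (n; G; n<W)

  preprocess< : StoresBelow m preprocess
  preprocess< = storesBelow-mono preprocess (m≤n⇒m≤o+n 5 (m≤m+n (arrays preprocess) _)) (storesBelow-arrays preprocess)

  update< : StoresBelow m update
  update< = storesBelow-mono update (m≤n⇒m≤o+n 5 (m≤n⇒m≤o+n (arrays preprocess) (m≤m+n (arrays update) _)))
      (storesBelow-arrays update)

  query< : StoresBelow m query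
  query< = storesBelow-mono query (m≤n⇒m≤o+n 5 (m≤n⇒m≤o+n (arrays preprocess)
      (m≤n+m (arrays query) (arrays update)))) (storesBelow-arrays query)

  -- Exponents of 2 + N bounding, in this order, n, the time of the preprocessing, the
  -- time of an update or a query, and the words of the whole computation.
  kₙ kₚ kᵤ wordExponent : ℕ
  kₙ = K + 1
  kₚ = C 2 + kₙ * e
  kᵤ = f 2 + kₙ * suc d
  -- One summand for each lower bound required of W: the oracle's word bound, m, the preprocessing
  -- time, the stack height, n², and 2.
  wordExponent = suc (2 + kₙ) * k + (m + (suc (1 + kₚ) + (suc (suc (6 + kᵤ) + kᵤ) + (suc (1 + (kₙ + kₙ)) + 3))))

  -- Coefficient of N² (T + 1), T bounding an update or query: 12 K² for the setup, 3 for the stack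
  -- reset and the loop's own two steps, the rest for one entry.
  slope : ℕ
  slope = (12 * (K * K) + 3) + (29 + 5 * (3 + m))

  constant : ℕ
  constant = 2 * (5 * (C 2 * K ^ e) + slope * (2 * (1 + f 2 * K ^ suc d)))

  module _ {N : ℕ} .{{_ : NonZero N}} (A B : Matrix N) where

    open Blocks P {N} hiding (K)

    n : ℕ
    n = K * N

    G : Graph n
    G = graph A B

    instance
      n≢0 : NonZero n
      n≢0 = m*n≢0 K N

    P≤n : P ≤ n
    P≤n = ≤-trans (m≤n+m P (3 + P)) (m≤m*n K N)

    2≤n : 2 ≤ n
    2≤n = ≤-trans (s≤s (s≤s z≤n)) (m≤m*n K N)

    preprocessRoot : ∃[ T ] (T ^ suc b ≤ C 2 ^ suc b * n ^ e × ∀ t → t ^ suc b ≤ C 2 ^ suc b * n ^ e → t ≤ T)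
    preprocessRoot = greatest-root (suc b) _

    updateRoot : ∃[ T ] (T ^ suc b ≤ f 2 ^ suc b * n ^ suc d × ∀ t → t ^ suc b ≤ f 2 ^ suc b * n ^ suc d → t ≤ T)
    updateRoot = greatest-root (suc b) _

    Tp Tu : ℕ
    Tp = proj₁ preprocessRoot
    Tu = proj₁ updateRoot

    Tp-bound : Bound n e (suc b) (C 2) Tp
    Tp-bound = bounded (proj₁ (proj₂ preprocessRoot))

    Tu-bound : Bound n (suc d) (suc b) (f 2) Tu
    Tu-bound = bounded (proj₁ (proj₂ updateRoot))

    ≤Tp : ∀ {t} → t ≤ C 2 · n ^ℝ x → t ≤ Tp
    ≤Tp t≤ = proj₂ (proj₂ preprocessRoot) _ (Bound.unbounded (^ℚ⇒bound (t≤ _ x≤)))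

    ≤Tu : ∀ {t} → t ≤ f 2 · n ^ℚ frac (suc d) b → t ≤ Tu
    ≤Tu t≤ = proj₂ (proj₂ updateRoot) _ (Bound.unbounded (^ℚ⇒bound t≤))

    W : ℕ
    W = wordBound wordExponent N

    n-poly : Poly N kₙ n
    n-poly = poly-* (poly-const-≤ K) poly-N

    Tp-poly : Poly N kₚ Tp
    Tp-poly = poly-≤ ≤-refl (bound-crude Tp-bound) (poly-* (poly-const-≤ (C 2)) (poly-^ e n-poly))

    Tu-poly : Poly N kᵤ Tu
    Tu-poly = poly-≤ ≤-refl (bound-crude Tu-bound) (poly-* (poly-const-≤ (f 2)) (poly-^ (suc d) n-poly))

    k₀ k₁ k₂ k₃ : ℕ
    k₀ = suc (2 + kₙ) * k
    k₁ = suc (1 + kₚ)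
    k₂ = suc (suc (6 + kᵤ) + kᵤ)
    k₃ = suc (1 + (kₙ + kₙ))

    wordBound≤W : wordBound k n ≤ W
    wordBound≤W = unpoly (poly-≤ (m≤m+n k₀ _) ≤-refl (poly-^ k (poly-+ (poly-const-≤ 2) n-poly)))

    m≤W : m ≤ W
    m≤W = unpoly (poly-≤ (m≤n⇒m≤o+n k₀ (m≤m+n m _)) ≤-refl (poly-const-≤ m))

    Tp<W : Tp < W
    Tp<W = unpoly (poly-≤ (m≤n⇒m≤o+n k₀ (m≤n⇒m≤o+n m (m≤m+n k₁ _))) ≤-refl (poly-+ (poly-const-≤ 1) Tp-poly))

    room : 5 + Tu + Tu < W
    room = unpoly (poly-≤ (m≤n⇒m≤o+n k₀ (m≤n⇒m≤o+n m (m≤n⇒m≤o+n k₁ (m≤m+n k₂ _)))) ≤-refl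
      (poly-+ (poly-+ (poly-const-≤ 6) Tu-poly) Tu-poly))

    n²<W : n * n < W
    n²<W = unpoly (poly-≤ (m≤n⇒m≤o+n k₀ (m≤n⇒m≤o+n m (m≤n⇒m≤o+n k₁ (m≤n⇒m≤o+n k₂ (m≤m+n k₃ 3))))) ≤-refl
      (poly-+ (poly-const-≤ 1) (poly-* n-poly n-poly)))

    2<W : 2 < W
    2<W = unpoly (poly-≤ (m≤n⇒m≤o+n k₀ (m≤n⇒m≤o+n m (m≤n⇒m≤o+n k₁ (m≤n⇒m≤o+n k₂ (m≤n+m 3 k₃))))) ≤-refl
      (poly-const-≤ 3))

    Answered : Memory → Set
    Answered = Answers A B n²<W 2<W {W₀ = wordBound k n} {Tp = Tp} {Tu = Tu} {Tq = Tu} wordBound≤W m≤W Tp<W room preprocess< update< query< (s≤s (s≤s (s≤s (s≤s z≤n)))) (s≤s (s≤s (s≤s (s≤s (s≤s z≤n)))))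

    connectivity-bit : ∀ i j {a} →
      (a ≡ 1 × Connected G (switch middle (endpoints i j)) (vertex zero i) (vertex (suc (suc zero)) j)) ⊎
      (a ≡ 0 × ¬ Connected G (switch middle (endpoints i j)) (vertex zero i) (vertex (suc (suc zero)) j)) →
      a ≡ bit ((A ⊗ B) i j)
    connectivity-bit i j (inj₁ (refl , path)) = lem ((A ⊗ B) i j) (connected⇒product A B path)
      where
      lem : ∀ p → T p → 1 ≡ bit p
      lem true _ = refl
    connectivity-bit i j (inj₂ (refl , ¬path)) = lem ((A ⊗ B) i j) (¬path ∘ product⇒connected A B)
      where
      lem : ∀ p → ¬ T p → 0 ≡ bit p
      lem true  ¬p = contradiction tt ¬p
      lem false _  = refl

    preprocess-exec : Exec (wordBound k n) preprocess (graphInput 2 G middle) Tp Answered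
    preprocess-exec = preprocessed (correct n 2 2≤n G middle (dense A B))
      where
      queried : ∀ {σ} i j →
        (∃₂ λ t τ →
            ⟨ query , queryInput (vertex zero i) (vertex (suc (suc zero)) j) σ ⟩⇓[ wordBound k n ] t , τ
          × t ≤ f 2 · n ^ℝ e-query n
          × ((τ 5 0 ≡ 1 × Connected G (switch middle (endpoints i j)) (vertex zero i) (vertex (suc (suc zero)) j)) ⊎
             (τ 5 0 ≡ 0 × ¬ Connected G (switch middle (endpoints i j)) (vertex zero i) (vertex (suc (suc zero)) j)))
          × Unit.⊤) →
        Exec (wordBound k n) query (queryInput (vertex zero i)
            (vertex (suc (suc zero)) j) σ) Tu λ τ → τ 5 0 ≡ bit ((A ⊗ B) i j)
      queried i j (_ , _ , run , t≤ , answer , _) = exec run (≤Tu (t≤ _ (query-fast n P≤n))) (connectivity-bit i j answer)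
      updated : ∀ {σ} i j →
        (∃₂ λ t τ →
            ⟨ update , updateInput (endpoints i j) σ ⟩⇓[ wordBound k n ] t , τ
          × t ≤ f 2 · n ^ℝ e-update n
          × (∀ qs → AnswersAll query (wordBound k n) (λ s → s ≤ f 2 · n ^ℝ e-query n)
                      G (switch middle (endpoints i j)) τ qs)) →
        Exec (wordBound k n) update (updateInput (endpoints i j) σ) Tu λ τ →
          Exec (wordBound k n) query (queryInput (vertex zero i)
              (vertex (suc (suc zero)) j) τ) Tu λ τ′ → τ′ 5 0 ≡ bit ((A ⊗ B) i j)
      updated i j (_ , _ , run , t≤ , answers) = exec run (≤Tu (t≤ _ (update-fast n P≤n)))
        (queried i j (answers ((vertex zero i , vertex (suc (suc zero)) j) ∷ []) row-on column-on))
      preprocessed :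
        (∃₂ λ t σ →
            ⟨ preprocess , graphInput 2 G middle ⟩⇓[ wordBound k n ] t , σ
          × t ≤ C 2 · n ^ℝ x
          × (∀ (D : Subset n) → ∣ D ∣ ≡ 2 → ∃₂ λ t τ →
               ⟨ update , updateInput D σ ⟩⇓[ wordBound k n ] t , τ
             × t ≤ f 2 · n ^ℝ e-update n
             × (∀ qs → AnswersAll query (wordBound k n) (λ s → s ≤ f 2 · n ^ℝ e-query n)
                         G (switch middle D) τ qs))) →
        Exec (wordBound k n) preprocess (graphInput 2 G middle) Tp Answered
      preprocessed (_ , _ , run , t≤ , updates) = exec run (≤Tp t≤)
        λ i j → updated i j (updates (endpoints i j) (∣⁅x⁆∪⁅y⁆∣≡2 _ _ (row<column i j)))

    -- N² (T + 1) is at least 1 and absorbs every term except the preprocessing time, which already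
    -- has a bound with the full exponent.
    time-linear : ∀ Tp T → 2 + ((2 + n * 3) + (2 + n * n * 3)) +
        (5 * Tp + suc (2 + N * N * (2 + ((5 + (5 + (5 + (5 * T + (5 + (5 + 5 * T)))))) + suc
            (suc ((5 + T + T) * (3 + m)))))))
      ≤ 5 * Tp + slope * (N * N * suc T)
    time-linear Tp T = begin
      2 + ((2 + n * 3) + (2 + n * n * 3)) + (5 * Tp + (3 + q * (2 + entry′)))
        ≤⟨ +-mono-≤ setup≤ (+-monoʳ-≤ (5 * Tp) (+-mono-≤ (*-monoʳ-≤ 3 Q≥1) (*-monoʳ-≤ q entry≤))) ⟩
      12 * (K * K) * Q + (5 * Tp + (3 * Q + q * (c * suc T)))
        ≡⟨ regroup (12 * (K * K)) Q (5 * Tp) q c (suc T) ⟩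
      5 * Tp + slope * Q ∎
      where
      open ≤-Reasoning
      q Q c entry′ : ℕ
      q = N * N
      Q = q * suc T
      c = 29 + 5 * (3 + m)
      entry′ = (5 + (5 + (5 + (5 * T + (5 + (5 + 5 * T)))))) + suc (suc ((5 + T + T) * (3 + m)))
      Q≥1 : 1 ≤ Q
      Q≥1 = >-nonZero⁻¹ Q {{m*n≢0 q (suc T) {{m*n≢0 N N}}}}
      regroup : ∀ k Q p q c s → k * (q * s) + (p + (3 * (q * s) + q * (c * s))) ≡ p + (k + 3 + c) * (q * s)
      regroup = solve-∀
      n²≤ : n * n ≤ K * K * Q
      n²≤ = ≤-trans (≤-reflexive ([m*n]*[o*p]≡[m*o]*[n*p] K N K N)) (*-monoʳ-≤ (K * K) (m≤m*n q (suc T)))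
      setup≤ : 2 + ((2 + n * 3) + (2 + n * n * 3)) ≤ 12 * (K * K) * Q
      setup≤ = begin
        2 + ((2 + n * 3) + (2 + n * n * 3))
          ≤⟨ +-mono-≤ (*-monoʳ-≤ 2 n²≥1) (+-mono-≤ (+-mono-≤ (*-monoʳ-≤ 2 n²≥1) (*-monoˡ-≤ 3 (m≤m*n n n)))
              (+-monoˡ-≤ (n * n * 3) (*-monoʳ-≤ 2 n²≥1))) ⟩
        2 * (n * n) + ((2 * (n * n) + n * n * 3) + (2 * (n * n) + n * n * 3))
          ≡⟨ twelve (n * n) ⟩
        12 * (n * n)            ≤⟨ *-monoʳ-≤ 12 n²≤ ⟩
        12 * (K * K * Q)        ≡⟨ *-assoc 12 (K * K) Q ⟨
        12 * (K * K) * Q        ∎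
        where
        n²≥1 : 1 ≤ n * n
        n²≥1 = >-nonZero⁻¹ (n * n) {{m*n≢0 n n}}
        twelve : ∀ s → 2 * s + ((2 * s + s * 3) + (2 * s + s * 3)) ≡ 12 * s
        twelve = solve-∀
      entry≤ : 2 + entry′ ≤ c * suc T
      -- The added 19 T + 3 T (3 + m) is the exact difference of the two sides.
      entry≤ = ≤-trans (m≤m+n (2 + entry′) (19 * T + 3 * T * (3 + m))) (≤-reflexive (expand T m))
        where
        open +-*-Solver
        expand : ∀ T m → 2 + ((5 + (5 + (5 + (5 * T + (5 + (5 + 5 * T)))))) + suc
            (suc ((5 + T + T) * (3 + m)))) + (19 * T + 3 * T * (3 + m)) ≡ (29 + 5 * (3 + m)) * suc T
        expand = solve 2 (λ T m →
          con 2 :+ ((con 5 :+ (con 5 :+ (con 5 :+ (con 5 :* T :+ (con 5 :+ (con 5 :+ con 5 :* T)))))) :+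
              (con 1 :+ (con 1 :+ ((con 5 :+ T :+ T) :* (con 3 :+ m))))) :+
              (con 19 :* T :+ con 3 :* T :* (con 3 :+ m))
            := (con 29 :+ con 5 :* (con 3 :+ m)) :* (con 1 :+ T)) refl

    time-bound : Bound N e (suc b) constant (5 * Tp + slope * (N * N * suc Tu))
    time-bound = bound-+
      (bound-* 5 (bound-scale K refl Tp-bound))
      (bound-* slope (bound-square-* refl (bound-+ one (bound-scale K refl Tu-bound))))
      where
      one : Bound N (suc d) (suc b) 1 1
      one = bounded (m≤m*n (1 ^ suc b) (N ^ suc d) {{m^n≢0 N (suc d)}})

    product-run : ∃₂ λ t σ →
        ⟨ multiply , matrixInput A B ⟩⇓[ W ] t , σ
      × t ≤ constant · N ^ℝ ⌈ frac e b ⌉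
      × (∀ i j → σ 3 (toℕ i * N + toℕ j) ≡ bit ((A ⊗ B) i j))
    product-run = package (exec-weaken (time-linear Tp Tu) id
      (multiply-exec A B n²<W 2<W wordBound≤W m≤W Tp<W room preprocess< update< query<
          (s≤s (s≤s (s≤s (s≤s z≤n)))) (s≤s (s≤s (s≤s (s≤s (s≤s z≤n))))) preprocess-exec))
      where
      package : ∀ {Φ} → Exec W multiply (matrixInput A B) (5 * Tp + slope * (N * N * suc Tu)) Φ → ∃₂ λ t σ →
        ⟨ multiply , matrixInput A B ⟩⇓[ W ] t , σ × t ≤ constant · N ^ℝ ⌈ frac e b ⌉ × Φ σ
      package (exec run t≤ post) = _ , _ , run ,
        (λ q ¬q<u → bound⇒^ℚ (ℚ.≮⇒≥ ¬q<u) (bound-weaken t≤ ≤-refl time-bound)) , post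

  computable : BMMComputable ⌈ frac e b ⌉
  computable = multiply , wordExponent , constant , λ N A B → product-run A B

-- Choice of the exponents, and the contradiction

no-superquadratic-oracle : ∀ {ω ε r} → Isωbool ω → 0ℚ ℚ.< r → below ε r → Oracle 25 (ω -ʳ ε) →
  ¬ below ω (frac 2 0)
no-superquadratic-oracle {ω} {ε} (ω≤ , _) 0<r r∈ O 2∈ with unit-frac-≤ 0<r | open-up ω 2∈
... | d₀ , 1/≤r | u , 2<u , u∈ with 2+unit-≤ 2<u
-- The grid step is at most r < ε, and m₀ / (b + 1) = 2 + 1 / (b + 1) is below ω. If m is the last
-- grid point below ω, then ω - ε ≤ m / (b + 1), so products are computable with that exponent and ω
-- ≤ m / (b + 1), against `m∈`.
... | e₀ , m₀/≤u = lattice-gap ω b {m₀} (lower-≤ ω (m₀/≤u d₀) u∈) λ m m₀≤m m∈ m+1∉ →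
  ℚ.<-irrefl refl (ω≤ ⌈ frac m b ⌉ (subst (λ m → BMMComputable ⌈ frac m b ⌉) (lem m m₀≤m)
    (fast (m ∸ m₀) (subst (λ m → ¬ below (ω -ʳ ε) (frac m b)) (sym (lem m m₀≤m)) (above-shift ω ε r∈ (1/≤r e₀) m+1∉)))) m∈)
  where
  b m₀ : ℕ
  b = e₀ + d₀ * suc e₀
  m₀ = suc (2 * suc b)
  lem : ∀ m → m₀ ≤ m → suc (m ∸ m₀) + suc b * 2 ≡ m
  lem m m₀≤m = trans (cong suc (trans (+-comm (m ∸ m₀) (suc b * 2)) (cong (_+ (m ∸ m₀)) (*-comm (suc b) 2))))
      (m+[n∸m]≡n m₀≤m)
  fast : ∀ d → ¬ below (ω -ʳ ε) (frac (suc d + suc b * 2) b) → BMMComputable ⌈ frac (suc d + suc b * 2) b ⌉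
  -- With P one more than the sum of the thresholds, n ≥ P passes both, and P is nonzero.
  fast d x≤ = FastMultiplication.computable O b d (suc (N₁ + N₂)) x≤
    (λ n P≤n → proj₂ (proj₂ (update-vanishing _ (frac-positive d b)) n (≤-trans (m≤n⇒m≤1+n (m≤m+n N₁ N₂)) P≤n)))
    (λ n P≤n → proj₂ (proj₂ (query-vanishing _ (frac-positive d b)) n (≤-trans (m≤n⇒m≤1+n (m≤n+m N₂ N₁)) P≤n)))
    where
    open Oracle O
    N₁ N₂ : ℕ
    N₁ = proj₁ (update-vanishing (frac (suc d) b) (frac-positive d b))
    N₂ = proj₁ (query-vanishing (frac (suc d) b) (frac-positive d b))

-- If 2 = (2 b + 2) / (b + 1) is not below ω, one grid step down bounds ω - ε by 2 - 1 / (b + 1).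
no-quadratic-oracle : ∀ {ω ε r} → 0ℚ ℚ.< r → below ε r → Oracle 25 (ω -ʳ ε) →
  ¬ ¬ below ω (frac 2 0)
no-quadratic-oracle {ω} {ε} 0<r r∈ O 2∉ with unit-frac-≤ 0<r
... | d₀ , 1/≤r = no-subquadratic-preprocessing {b = b}
  (above-shift ω ε r∈ (1/≤r 0) λ 2∈ → 2∉ (lower-≤ ω
      (frac-mono-≤ {2} {0} {suc (suc (2 * b))} {b} (≤-reflexive (lem b))) 2∈)) O
  where
  b : ℕ
  b = 0 + d₀ * 1
  lem : ∀ b → 2 * suc b ≡ suc (suc (2 * b)) * 1
  lem = solve-∀

lemma7p3 : Σ[ c ∈ ℕ ] (∀ (ω : ℝ) → Isωbool ω →
    ∀ (ε : ℝ) → Positive ε → ¬ Oracle c (ω -ʳ ε))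
lemma7p3 = 25 , λ ω ω-inf ε 0∈ O → case open-up ε 0∈ of λ where
  (r , 0<r , r∈) → no-quadratic-oracle 0<r r∈ O (no-superquadratic-oracle ω-inf 0<r r∈ O)
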